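{- There is an absolute constant $c>0$ such that for all $n\ge 2$, every Nullstellensatz proof of infeasibility of the pigeonhole principle system $\mathrm{PHP}_n$ (with $n$ pigeons and $n-1$ holes) has total coefficient size at least $c\, n^{3/4}\left(\frac{2}{\sqrt e}\right)^{n}$; that is, the total coefficient size is $\Omega\!\left(n^{3/4}\left(\frac{2}{\sqrt e}\right)^{n}\right)$.
   Context: Pigeonhole system $\mathrm{PHP}_n$: there are Boolean variables $x_{i,j}$ for $i\in[n]$ (pigeons), $j\in[n-1]$ (holes); write $\bar x_{i,j}=1-x_{i,j}$. The (non-Boolean) axioms are: for each $i\in[n]$, $\prod_{j=1}^{n-1}\bar x_{i,j}=0$; and for each pair of distinct $i_1,i_2\in[n]$ and each $j\in[n-1]$, $x_{i_1,j}x_{i_2,j}=0$. Boolean Nullstellensatz proofs: given Boolean variables $y_1,\dots,y_N$, a monomial is a product $\prod_{a\in S}y_a\prod_{b\in T}(1-y_b)$ with $S,T\subseteq[N]$ disjoint. Given axioms $p_1=0,\dots,p_m=0$, a Nullstellensatz proof of infeasibility is a polynomial identity $1=\sum_{i=1}^m p_iq_i+\sum_{a=1}^N g_a(y_a^2-y_a)$ with polynomials $q_i,g_a$ with real coefficients, where each $q_i$ is given as a real linear combination $q_i=\sum_r c_{ir}r$ of monomials $r$ of the form $\prod_{a\in S}y_a\prod_{b\in T}(1-y_b)$ with $S,T\subseteq[N]$ disjoint. Its total coefficient size is $\sum_{i=1}^m T(q_i)$ where $T(q_i)=\sum_r|c_{ir}|$ (the Boolean axioms $y_a^2-y_a=0$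 are used for free). -}

module Defs where

open import Algebra.Bundles using (CommutativeRing; CommutativeSemiring)
import Algebra.Solver.Ring.NaturalCoefficients.Default as NaturalCoefficients
open import Data.Bool.Base as Bool using (true; false; if_then_else_)
open import Data.Fin.Base as Fin using (Fin; combine)
import Data.Fin.Properties as Fin
open import Data.Fin.Subset using (Subset; _∩_; Empty)
open import Data.Fin.Subset.Properties using (_∈?_)
import Data.Integer.Base as ℤ
import Data.Integer.Properties as ℤ
open import Data.Integer.Base using (+_; +[1+_]; -[1+_])
open import Data.List.Base using (List; []; _∷_; _++_; map; foldr; length; lookup; allFin; filter; cartesianProduct; cartesianProductWith)
open import Data.List.Relation.Unary.AllPairs using (AllPairs)
import Data.Nat.Base as ℕ
import Data.Nat.Properties as ℕ
open import Data.Nat.Base using (ℕ; zero; suc; _∸_; _!)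
open import Data.Nat.Solver using () renaming (module +-*-Solver to ℕ-Solver)
import Data.Rational as ℚ
import Data.Rational.Properties as ℚ
import Data.Rational.Unnormalised as ℚᵘ
import Data.Rational.Unnormalised.Properties as ℚᵘ
open import Data.Rational using (ℚ; mkℚ; 0ℚ; 1ℚ; ½; ↥_; ↧ₙ_)
open import Data.Rational.Solver using (module +-*-Solver)
open import Data.Product.Base using (∃; _×_; _,_; proj₁; proj₂)
open import Data.Sum.Base using (inj₁; inj₂)
open import Data.Vec.Base as Vec using (Vec; replicate; zipWith; _[_]≔_)
import Data.Vec.Properties as Vec
open import Level using (0ℓ)
open import Relation.Binary.PropositionalEquality using (_≡_; refl; sym; trans; cong; cong₂; subst; subst₂; module ≡-Reasoning)
open import Relation.Nullary using (¬_; yes; no; does; contradiction)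

------------------------------------------------------------------------
-- Facts about ℕ and ℚ

module ℕ-Lemmas where

  open import Data.Nat.Base using (_+_; _*_)
  open ℕ-Solver using (solve; _:=_; _:+_; _:*_; con)

  scale : ∀ a b N → a * (b * N * (b * N)) ≡ a * b * (N * N) * b
  scale = solve 3 (λ a b N → a :* (b :* N :* (b :* N)) := a :* b :* (N :* N) :* b) refl

  split : ∀ s b → suc s * (b * b) ≡ (s * b + 1 * b) * b
  split = solve 2 (λ s b → (con 1 :+ s) :* (b :* b) := (s :* b :+ con 1 :* b) :* b) refl

  telescope : ∀ n → (1 * (2 + n) + 1 * ((2 + n) * (1 + n))) * (1 + n) ≡ 1 * ((2 + n) * (1 + n) * (2 + n))
  telescope = solve 1 (λ n → (con 1 :* (con 2 :+ n) :+ con 1 :* ((con 2 :+ n) :* (con 1 :+ n))) :* (con 1 :+ n)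
                          := con 1 :* ((con 2 :+ n) :* (con 1 :+ n) :* (con 2 :+ n))) refl

module Semiring-Identities (R : CommutativeSemiring 0ℓ 0ℓ) where

  open CommutativeSemiring R renaming (refl to ≈-refl)
  open NaturalCoefficients R using (solve; _:=_; _:+_; _:*_)

  product-difference : ∀ a b c′ d d′ → a * (b + d′) + d * (a + c′) ≈ (a * b + d * c′) + a * (d + d′)
  product-difference = solve 5 (λ a b c′ d d′ →
    a :* (b :+ d′) :+ d :* (a :+ c′) := (a :* b :+ d :* c′) :+ a :* (d :+ d′)) ≈-refl

  scaled-difference : ∀ p q a b′ → p * q * (a + b′) ≈ q * (p * a) + p * (q * b′)
  scaled-difference = solve 4 (λ p q a b′ → p :* q :* (a :+ b′) := q :* (p :* a) :+ p :* (q :* b′)) ≈-refl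

  square-step : ∀ r δ → (r + δ) * (r + δ) + δ * δ + (δ * (r + δ) + δ * (r + δ)) ≈ (r + (δ + δ)) * (r + (δ + δ))
  square-step = solve 2 (λ r δ → (r :+ δ) :* (r :+ δ) :+ δ :* δ :+ (δ :* (r :+ δ) :+ δ :* (r :+ δ))
                                 := (r :+ (δ :+ δ)) :* (r :+ (δ :+ δ))) ≈-refl

module ℚ-Lemmas where

  open import Data.Rational.Base using (_+_; _*_; _-_; -_; ∣_∣; _≤_; _<_)
  open +-*-Solver using (solve; _:=_; _:+_; _:-_; :-_)

  open Semiring-Identities (CommutativeRing.commutativeSemiring ℚ.+-*-commutativeRing)

  *-difference : ∀ a b c d → a * b - c * d ≡ a * (b - d) + d * (a - c)
  *-difference a b c d = sym (begin
    a * (b - d) + d * (a - c)            ≡⟨ product-difference a b (- c) d (- d) ⟩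
    (a * b + d * - c) + a * (d + - d)    ≡⟨ cong (λ z → (a * b + d * - c) + a * z) (ℚ.+-inverseʳ d) ⟩
    (a * b + d * - c) + a * 0ℚ           ≡⟨ cong (λ z → (a * b + d * - c) + z) (ℚ.*-zeroʳ a) ⟩
    (a * b + d * - c) + 0ℚ               ≡⟨ ℚ.+-identityʳ (a * b + d * - c) ⟩
    a * b + d * - c                      ≡⟨ cong (λ z → a * b + z) (sym (ℚ.neg-distribʳ-* d c)) ⟩
    a * b - d * c                        ≡⟨ cong (λ z → a * b - z) (ℚ.*-comm d c) ⟩
    a * b - c * d                        ∎)
    where open ≡-Reasoning

  *-scaled-difference : ∀ p q a b → p * q * (a - b) ≡ q * (p * a) - p * (q * b)
  *-scaled-difference p q a b = begin
    p * q * (a - b)                ≡⟨ scaled-difference p q a (- b) ⟩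
    q * (p * a) + p * (q * - b)    ≡⟨ cong (λ z → q * (p * a) + p * z) (sym (ℚ.neg-distribʳ-* q b)) ⟩
    q * (p * a) + p * - (q * b)    ≡⟨ cong (λ z → q * (p * a) + z) (sym (ℚ.neg-distribʳ-* p (q * b))) ⟩
    q * (p * a) - p * (q * b)      ∎
    where open ≡-Reasoning

  *-square-step : ∀ r δ → (r + δ) * (r + δ) + δ * δ + (δ * (r + δ) + δ * (r + δ)) ≡ (r + (δ + δ)) * (r + (δ + δ))
  *-square-step = square-step

  ½+½ : ∀ p → ½ * p + ½ * p ≡ p
  ½+½ p = trans (sym (ℚ.*-distribʳ-+ p ½ ½)) (ℚ.*-identityˡ p)

  pos-* : ∀ {p q} → 0ℚ < p → 0ℚ < q → 0ℚ < p * q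
  pos-* {p} {q} 0<p 0<q =
    ℚ.positive⁻¹ (p * q) {{ℚ.pos*pos⇒pos p {{ℚ.positive 0<p}} q {{ℚ.positive 0<q}}}}

  ½-pos : ∀ {p} → 0ℚ < p → 0ℚ < ½ * p
  ½-pos = pos-* (ℚ.positive⁻¹ ½)

  *-mono-≤ : ∀ {p q r s} → 0ℚ ≤ p → 0ℚ ≤ r → p ≤ q → r ≤ s → p * r ≤ q * s
  *-mono-≤ {p} {q} {r} {s} 0≤p 0≤r p≤q r≤s = ℚ.≤-trans
    (ℚ.*-monoʳ-≤-nonNeg r {{ℚ.nonNegative 0≤r}} p≤q)
    (ℚ.*-monoˡ-≤-nonNeg q {{ℚ.nonNegative (ℚ.≤-trans 0≤p p≤q)}} r≤s)

  ∣-∣< : ∀ {p b} → p < b → - p < b → ∣ p ∣ < b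
  ∣-∣< {p} {b} u v with ℚ.∣p∣≡p∨∣p∣≡-p p
  ... | inj₁ eq = subst (_< b) (sym eq) u
  ... | inj₂ eq = subst (_< b) (sym eq) v

  ∣-∣-swap : ∀ p q → ∣ p - q ∣ ≡ ∣ q - p ∣
  ∣-∣-swap p q = trans (cong ∣_∣ (solve 2 (λ p q → p :- q := :- (q :- p)) refl p q))
                       (ℚ.∣-p∣≡∣p∣ (q - p))

  p≤∣p∣ : ∀ p → p ≤ ∣ p ∣
  p≤∣p∣ p with ℚ.≤-total 0ℚ p
  ... | inj₁ 0≤p = ℚ.≤-reflexive (sym (ℚ.0≤p⇒∣p∣≡p 0≤p))
  ... | inj₂ p≤0 = ℚ.≤-trans p≤0 (ℚ.0≤∣p∣ p)

  ∣-∣-lip : ∀ p q → ∣ p ∣ - ∣ q ∣ ≤ ∣ p - q ∣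
  ∣-∣-lip p q = begin
    ∣ p ∣ - ∣ q ∣                  ≡⟨ cong (λ z → ∣ z ∣ - ∣ q ∣) (solve 2 (λ p q → p := (p :- q) :+ q) refl p q) ⟩
    ∣ (p - q) + q ∣ - ∣ q ∣        ≤⟨ ℚ.+-monoˡ-≤ (- ∣ q ∣) (ℚ.∣p+q∣≤∣p∣+∣q∣ (p - q) q) ⟩
    (∣ p - q ∣ + ∣ q ∣) - ∣ q ∣    ≡⟨ solve 2 (λ a b → (a :+ b) :- b := a) refl ∣ p - q ∣ ∣ q ∣ ⟩
    ∣ p - q ∣                      ∎
    where open ℚ.≤-Reasoning

  p-q<r⇒p<q+r : ∀ {p q r} → p - q < r → p < q + r
  p-q<r⇒p<q+r {p} {q} {r} h =
    subst₂ _<_ (solve 2 (λ p q → q :+ (p :- q) := p) refl p q) refl (ℚ.+-monoʳ-< q h)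

  p<q+r⇒p-q<r : ∀ {p q r} → p < q + r → p - q < r
  p<q+r⇒p-q<r {p} {q} {r} h =
    subst ((p - q) <_) (solve 2 (λ q r → (q :+ r) :- q := r) refl q r) (ℚ.+-monoˡ-< (- q) h)

  quotient : ∀ {ε b} → 0ℚ < ε → 0ℚ < b → ∃ λ δ → 0ℚ < δ × b * δ ≡ ε
  quotient {ε} {b} 0<ε 0<b = (1/b * ε) , pos-* (ℚ.positive⁻¹ 1/b {{ℚ.1/pos⇒pos b}}) 0<ε , eq
    where
    instance
      _ = ℚ.positive 0<b
      _ = ℚ.pos⇒nonZero b {{ℚ.positive 0<b}}
    1/b = ℚ.1/ b
    eq : b * (1/b * ε) ≡ ε
    eq = trans (sym (ℚ.*-assoc b 1/b ε))
               (trans (cong (_* ε) (ℚ.*-inverseʳ b)) (ℚ.*-identityˡ ε))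

  fromℚᵘ-mono-≤ : ∀ {p q} → p ℚᵘ.≤ q → ℚ.fromℚᵘ p ≤ ℚ.fromℚᵘ q
  fromℚᵘ-mono-≤ {p} {q} h = ℚ.toℚᵘ-cancel-≤
    (ℚᵘ.≤-respˡ-≃ (ℚᵘ.≃-sym (ℚ.toℚᵘ-fromℚᵘ p)) (ℚᵘ.≤-respʳ-≃ (ℚᵘ.≃-sym (ℚ.toℚᵘ-fromℚᵘ q)) h))

  fromℚᵘ-mono-< : ∀ {p q} → p ℚᵘ.< q → ℚ.fromℚᵘ p < ℚ.fromℚᵘ q
  fromℚᵘ-mono-< {p} {q} h = ℚ.toℚᵘ-cancel-<
    (ℚᵘ.<-respˡ-≃ (ℚᵘ.≃-sym (ℚ.toℚᵘ-fromℚᵘ p)) (ℚᵘ.<-respʳ-≃ (ℚᵘ.≃-sym (ℚ.toℚᵘ-fromℚᵘ q)) h))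

  fromℚᵘ-homo-+ : ∀ p q → ℚ.fromℚᵘ (p ℚᵘ.+ q) ≡ ℚ.fromℚᵘ p + ℚ.fromℚᵘ q
  fromℚᵘ-homo-+ p q = ℚ.toℚᵘ-injective
    (ℚᵘ.≃-trans (ℚ.toℚᵘ-fromℚᵘ (p ℚᵘ.+ q)) (ℚᵘ.≃-sym
      (ℚᵘ.≃-trans (ℚ.toℚᵘ-homo-+ (ℚ.fromℚᵘ p) (ℚ.fromℚᵘ q))
                  (ℚᵘ.+-cong (ℚ.toℚᵘ-fromℚᵘ p) (ℚ.toℚᵘ-fromℚᵘ q)))))

  fromℚᵘ-homo-* : ∀ p q → ℚ.fromℚᵘ (p ℚᵘ.* q) ≡ ℚ.fromℚᵘ p * ℚ.fromℚᵘ q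
  fromℚᵘ-homo-* p q = ℚ.toℚᵘ-injective
    (ℚᵘ.≃-trans (ℚ.toℚᵘ-fromℚᵘ (p ℚᵘ.* q)) (ℚᵘ.≃-sym
      (ℚᵘ.≃-trans (ℚ.toℚᵘ-homo-* (ℚ.fromℚᵘ p) (ℚ.fromℚᵘ q))
                  (ℚᵘ.*-cong (ℚ.toℚᵘ-fromℚᵘ p) (ℚ.toℚᵘ-fromℚᵘ q)))))

  archimedean : ∀ {ε} → 0ℚ < ε → ∃ λ N → ∀ n → N ℕ.≤ n → + 1 ℚ./ suc n < ε
  archimedean {mkℚ +[1+ a ] d c} _ = suc d , λ n d<n →
    subst (+ 1 ℚ./ suc n <_) (ℚ.fromℚᵘ-toℚᵘ (mkℚ +[1+ a ] d c))
      (fromℚᵘ-mono-< {ℚᵘ.mkℚᵘ (+ 1) n} {ℚᵘ.mkℚᵘ +[1+ a ] d}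
        (ℚᵘ.*<* (ℤ.+<+ (ℕ.≤-trans (subst (ℕ._< suc n) (sym (ℕ.+-identityʳ (suc d))) (ℕ.s≤s d<n))
                                  (ℕ.m≤m+n (suc n) (a ℕ.* suc n))))))
  archimedean {mkℚ (+ 0) d c} (ℚ.*<* (ℤ.+<+ ()))
  archimedean {mkℚ -[1+ a ] d c} (ℚ.*<* ())

------------------------------------------------------------------------
-- Real numbers: Cauchy sequences of rationals, up to _≈_

IsCauchy : (ℕ → ℚ) → Set
IsCauchy x = ∀ ε → 0ℚ ℚ.< ε → ∃ λ N → ∀ m n → N ℕ.≤ m → N ℕ.≤ n → ℚ.∣ x m ℚ.- x n ∣ ℚ.< ε

module Cauchy-Lemmas where

  open import Data.Rational.Base using (_+_; _*_; _-_; -_; ∣_∣; _≤_; _<_)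
  open +-*-Solver using (solve; _:=_; _:+_; _:-_; :-_)
  open ℕ-Lemmas
  open ℚ-Lemmas

  OneSided : (ℕ → ℚ) → Set
  OneSided x = ∀ ε → 0ℚ < ε → ∃ λ N → ∀ m n → N ℕ.≤ m → N ℕ.≤ n → x m - x n < ε

  oneSided⇒cauchy : ∀ x → OneSided x → IsCauchy x
  oneSided⇒cauchy x h ε 0<ε with h ε 0<ε
  ... | N , f = N , λ m n N≤m N≤n → ∣-∣< (f m n N≤m N≤n)
    (subst (_< ε) (solve 2 (λ p q → q :- p := :- (p :- q)) refl (x m) (x n)) (f n m N≤n N≤m))

  abstract
    const-cauchy : ∀ q → IsCauchy (λ _ → q)
    const-cauchy q ε 0<ε = 0 , λ _ _ _ _ → subst (λ z → ∣ z ∣ < ε) (sym (ℚ.+-inverseʳ q)) 0<ε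

  abstract
    neg-cauchy : ∀ x → IsCauchy x → IsCauchy (λ n → - x n)
    neg-cauchy x cx ε 0<ε with cx ε 0<ε
    ... | N , f = N , λ m n N≤m N≤n → subst (_< ε)
      (trans (∣-∣-swap (x m) (x n)) (cong ∣_∣ (solve 2 (λ p q → q :- p := :- p :- :- q) refl (x m) (x n))))
      (f m n N≤m N≤n)

  abstract
    +-cauchy : ∀ x y → IsCauchy x → IsCauchy y → IsCauchy (λ n → x n + y n)
    +-cauchy x y cx cy ε 0<ε with cx (½ * ε) (½-pos 0<ε) | cy (½ * ε) (½-pos 0<ε)
    ... | M , f | N , g = M ℕ.⊔ N , λ m n h k → begin-strict
      ∣ (x m + y m) - (x n + y n) ∣
        ≡⟨ cong ∣_∣ (solve 4 (λ a b c d → (a :+ b) :- (c :+ d) := (a :- c) :+ (b :- d)) refl (x m) (y m) (x n) (y n)) ⟩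
      ∣ (x m - x n) + (y m - y n) ∣
        ≤⟨ ℚ.∣p+q∣≤∣p∣+∣q∣ (x m - x n) (y m - y n) ⟩
      ∣ x m - x n ∣ + ∣ y m - y n ∣
        <⟨ ℚ.+-mono-< (f m n (ℕ.m⊔n≤o⇒m≤o M N h) (ℕ.m⊔n≤o⇒m≤o M N k))
                      (g m n (ℕ.m⊔n≤o⇒n≤o M N h) (ℕ.m⊔n≤o⇒n≤o M N k)) ⟩
      ½ * ε + ½ * ε
        ≡⟨ ½+½ ε ⟩
      ε ∎
      where open ℚ.≤-Reasoning

  abstract
    ∣-∣-cauchy : ∀ x → IsCauchy x → IsCauchy (λ n → ∣ x n ∣)
    ∣-∣-cauchy x cx = oneSided⇒cauchy (λ n → ∣ x n ∣) λ ε 0<ε →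
      let N , f = cx ε 0<ε in
      N , λ m n N≤m N≤n → ℚ.≤-<-trans (∣-∣-lip (x m) (x n)) (f m n N≤m N≤n)

  bounded : ∀ x → IsCauchy x → ∃ λ b → 0ℚ < b × ∃ λ N → ∀ n → N ℕ.≤ n → ∣ x n ∣ < b
  bounded x cx with cx 1ℚ (ℚ.positive⁻¹ 1ℚ)
  ... | N , f = ∣ x N ∣ + 1ℚ
              , ℚ.+-mono-≤-< (ℚ.0≤∣p∣ (x N)) (ℚ.positive⁻¹ 1ℚ)
              , N
              , λ n N≤n → p-q<r⇒p<q+r (ℚ.≤-<-trans (∣-∣-lip (x n) (x N)) (f n N N≤n ℕ.≤-refl))

  private
    ∣*∣-mono-< : ∀ a b p q → 0ℚ < b → ∣ a ∣ < b → ∣ p ∣ < q → ∣ a ∣ * ∣ p ∣ < b * q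
    ∣*∣-mono-< a b p q 0<b a<b p<q = ℚ.≤-<-trans
      (ℚ.*-monoʳ-≤-nonNeg ∣ p ∣ {{ℚ.∣-∣-nonNeg p}} (ℚ.<⇒≤ a<b))
      (ℚ.*-monoʳ-<-pos b {{ℚ.positive 0<b}} p<q)

    *-close : ∀ a b c d k l δ η → 0ℚ < k → 0ℚ < l → ∣ a ∣ < k → ∣ d ∣ < l →
              ∣ b - d ∣ < δ → ∣ a - c ∣ < η → ∣ a * b - c * d ∣ < k * δ + l * η
    *-close a b c d k l δ η 0<k 0<l a<k d<l b~d a~c = begin-strict
      ∣ a * b - c * d ∣                          ≡⟨ cong ∣_∣ (*-difference a b c d) ⟩
      ∣ a * (b - d) + d * (a - c) ∣              ≤⟨ ℚ.∣p+q∣≤∣p∣+∣q∣ (a * (b - d)) (d * (a - c)) ⟩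
      ∣ a * (b - d) ∣ + ∣ d * (a - c) ∣          ≡⟨ cong₂ _+_ (ℚ.∣p*q∣≡∣p∣*∣q∣ a (b - d)) (ℚ.∣p*q∣≡∣p∣*∣q∣ d (a - c)) ⟩
      ∣ a ∣ * ∣ b - d ∣ + ∣ d ∣ * ∣ a - c ∣      <⟨ ℚ.+-mono-< (∣*∣-mono-< a k (b - d) δ 0<k a<k b~d)
                                                              (∣*∣-mono-< d l (a - c) η 0<l d<l a~c) ⟩
      k * δ + l * η                              ∎
      where open ℚ.≤-Reasoning

  abstract
    *-cauchy : ∀ x y → IsCauchy x → IsCauchy y → IsCauchy (λ n → x n * y n)
    *-cauchy x y cx cy ε 0<ε =
      let k , 0<k , K , x<k = bounded x cx
          l , 0<l , L , y<l = bounded y cy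
          δ , 0<δ , kδ      = quotient (½-pos 0<ε) 0<k
          η , 0<η , lη      = quotient (½-pos 0<ε) 0<l
          M , f             = cx η 0<η
          N , g             = cy δ 0<δ
          KL = K ℕ.⊔ L
          MN = M ℕ.⊔ N
      in KL ℕ.⊔ MN , λ m n h h′ →
        let KL≤m = ℕ.m⊔n≤o⇒m≤o KL MN h
            KL≤n = ℕ.m⊔n≤o⇒m≤o KL MN h′
            MN≤m = ℕ.m⊔n≤o⇒n≤o KL MN h
            MN≤n = ℕ.m⊔n≤o⇒n≤o KL MN h′
        in subst (∣ x m * y m - x n * y n ∣ <_) (trans (cong₂ _+_ kδ lη) (½+½ ε))
             (*-close (x m) (y m) (x n) (y n) k l δ η 0<k 0<l
               (x<k m (ℕ.m⊔n≤o⇒m≤o K L KL≤m)) (y<l n (ℕ.m⊔n≤o⇒n≤o K L KL≤n))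
               (g m n (ℕ.m⊔n≤o⇒n≤o M N MN≤m) (ℕ.m⊔n≤o⇒n≤o M N MN≤n))
               (f m n (ℕ.m⊔n≤o⇒m≤o M N MN≤m) (ℕ.m⊔n≤o⇒m≤o M N MN≤n)))

  inv : ℚ → ℚ
  inv q with q ℚ.≟ 0ℚ
  ... | yes _   = 0ℚ
  ... | no  q≢0 = (ℚ.1/ q) {{ℚ.≢-nonZero q≢0}}

  inv-inverse : ∀ {q} → 0ℚ < q → q * inv q ≡ 1ℚ
  inv-inverse {q} 0<q with q ℚ.≟ 0ℚ
  ... | yes q≡0 = contradiction (sym q≡0) (ℚ.<⇒≢ 0<q)
  ... | no  q≢0 = ℚ.*-inverseʳ q {{ℚ.≢-nonZero q≢0}}

  abstract
    inv-cauchy : ∀ x → IsCauchy x → (∃ λ δ → 0ℚ < δ × ∃ λ N → ∀ n → N ℕ.≤ n → 0ℚ + δ < x n) →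
                 IsCauchy (λ n → inv (x n))
    inv-cauchy x cx (δ , 0<δ , M , f) = oneSided⇒cauchy (λ n → inv (x n)) λ ε 0<ε →
      let N , g = cx (δ * δ * ε) (pos-* (pos-* 0<δ 0<δ) 0<ε) in
      M ℕ.⊔ N , λ m n h k →
        one ε 0<ε (lower m (ℕ.m⊔n≤o⇒m≤o M N h)) (lower n (ℕ.m⊔n≤o⇒m≤o M N k))
            (ℚ.≤-<-trans (p≤∣p∣ (x n - x m)) (g n m (ℕ.m⊔n≤o⇒n≤o M N k) (ℕ.m⊔n≤o⇒n≤o M N h)))
      where
      lower : ∀ n → M ℕ.≤ n → δ < x n
      lower n h = subst (_< x n) (ℚ.+-identityˡ δ) (f n h)
      one : ∀ {p q} ε → 0ℚ < ε → δ < p → δ < q → q - p < δ * δ * ε → inv p - inv q < ε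
      one {p} {q} ε 0<ε δ<p δ<q h = ℚ.*-cancelˡ-<-nonNeg (p * q) {{ℚ.nonNegative (ℚ.<⇒≤ (pos-* 0<p 0<q))}} (begin-strict
        p * q * (inv p - inv q)
          ≡⟨ *-scaled-difference p q (inv p) (inv q) ⟩
        q * (p * inv p) - p * (q * inv q)
          ≡⟨ cong₂ (λ a b → q * a - p * b) (inv-inverse 0<p) (inv-inverse 0<q) ⟩
        q * 1ℚ - p * 1ℚ
          ≡⟨ cong₂ _-_ (ℚ.*-identityʳ q) (ℚ.*-identityʳ p) ⟩
        q - p
          <⟨ h ⟩
        δ * δ * ε
          ≤⟨ ℚ.*-monoʳ-≤-nonNeg ε {{ℚ.nonNegative (ℚ.<⇒≤ 0<ε)}}
               (*-mono-≤ (ℚ.<⇒≤ 0<δ) (ℚ.<⇒≤ 0<δ) (ℚ.<⇒≤ δ<p) (ℚ.<⇒≤ δ<q)) ⟩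
        p * q * ε ∎)
        where
        open ℚ.≤-Reasoning
        0<p : 0ℚ < p
        0<p = ℚ.<-trans 0<δ δ<p
        0<q : 0ℚ < q
        0<q = ℚ.<-trans 0<δ δ<q

  -- The largest r ≤ suc s with r * r ≤ n, given s * s ≤ n.
  isqrtStep : ℕ → ℕ → ℕ
  isqrtStep s n = if suc s ℕ.* suc s ℕ.≤ᵇ n then suc s else s

  isqrt : ℕ → ℕ
  isqrt zero    = zero
  isqrt (suc n) = isqrtStep (isqrt n) (suc n)

  isqrtStep-lower : ∀ s n → s ℕ.* s ℕ.≤ n → isqrtStep s n ℕ.* isqrtStep s n ℕ.≤ n
  isqrtStep-lower s n h with suc s ℕ.* suc s ℕ.≤ᵇ n in eq
  ... | true  = ℕ.≤ᵇ⇒≤ (suc s ℕ.* suc s) n (subst Bool.T (sym eq) _)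
  ... | false = h

  isqrtStep-upper : ∀ s n → n ℕ.≤ suc s ℕ.* suc s → n ℕ.< suc (isqrtStep s n) ℕ.* suc (isqrtStep s n)
  isqrtStep-upper s n h with suc s ℕ.* suc s ℕ.≤ᵇ n in eq
  ... | true  = ℕ.≤-<-trans h (ℕ.*-mono-< (ℕ.n<1+n (suc s)) (ℕ.n<1+n (suc s)))
  ... | false = ℕ.≰⇒> (λ k → subst Bool.T eq (ℕ.≤⇒≤ᵇ k))

  isqrt-lower : ∀ n → isqrt n ℕ.* isqrt n ℕ.≤ n
  isqrt-lower zero    = ℕ.z≤n
  isqrt-lower (suc n) = isqrtStep-lower (isqrt n) (suc n) (ℕ.m≤n⇒m≤1+n (isqrt-lower n))

  isqrt-upper : ∀ n → n ℕ.< suc (isqrt n) ℕ.* suc (isqrt n)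
  isqrt-upper zero    = ℕ.s≤s ℕ.z≤n
  isqrt-upper (suc n) = isqrtStep-upper (isqrt n) (suc n) (isqrt-upper n)

  -- With ∣ q ∣ = a / b and N = n + 1, the largest multiple of 1 / (b N) whose
  -- square is at most ∣ q ∣; it is within 1 / N of the square root of ∣ q ∣.
  sqrtApprox : ℚ → ℕ → ℚ
  sqrtApprox q n = + isqrt (a ℕ.* b ℕ.* (suc n ℕ.* suc n)) ℚ./ (b ℕ.* suc n)
    where
    a = ℤ.∣ ↥ q ∣
    b = ↧ₙ q
    instance _ = ℕ.m*n≢0 b (suc n)

  sqrtApprox≥0 : ∀ q n → 0ℚ ≤ sqrtApprox q n
  sqrtApprox≥0 q@(mkℚ _ _ _) n = ℚ.nonNegative⁻¹ (sqrtApprox q n)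
    {{ℚ.normalize-nonNeg (isqrt (ℤ.∣ ↥ q ∣ ℕ.* ↧ₙ q ℕ.* (suc n ℕ.* suc n))) (↧ₙ q ℕ.* suc n)}}

  private
    pos-*³ : ∀ s t b → + (s ℕ.* t ℕ.* b) ≡ + s ℤ.* + t ℤ.* + b
    pos-*³ s t b = trans (ℤ.pos-* (s ℕ.* t) b) (cong (ℤ._* + b) (ℤ.pos-* s t))

  sqrtApprox-lower : ∀ q n → sqrtApprox q n * sqrtApprox q n ≤ ∣ q ∣
  sqrtApprox-lower q@(mkℚ num d c) n = begin
    sqrtApprox q n * sqrtApprox q n  ≡⟨ sym (fromℚᵘ-homo-* r r) ⟩
    ℚ.fromℚᵘ (r ℚᵘ.* r)              ≤⟨ fromℚᵘ-mono-≤ {r ℚᵘ.* r} {ℚᵘ.mkℚᵘ (+ a) d} (ℚᵘ.*≤* (subst₂ ℤ._≤_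
                                          (pos-*³ s s (suc d)) (ℤ.pos-* a (bN ℕ.* bN)) (ℤ.+≤+ ineq))) ⟩
    ℚ.fromℚᵘ (ℚᵘ.mkℚᵘ (+ a) d)       ≡⟨ ℚ.fromℚᵘ-toℚᵘ ∣ q ∣ ⟩
    ∣ q ∣                            ∎
    where
    open ℚ.≤-Reasoning
    a  = ℤ.∣ num ∣
    bN = suc d ℕ.* suc n
    s  = isqrt (a ℕ.* suc d ℕ.* (suc n ℕ.* suc n))
    r  = ℚᵘ.mkℚᵘ (+ s) (ℕ.pred bN)
    ineq : s ℕ.* s ℕ.* suc d ℕ.≤ a ℕ.* (bN ℕ.* bN)
    ineq = subst (s ℕ.* s ℕ.* suc d ℕ.≤_) (sym (scale a (suc d) (suc n)))
             (ℕ.*-monoˡ-≤ (suc d) (isqrt-lower (a ℕ.* suc d ℕ.* (suc n ℕ.* suc n))))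

  sqrtApprox-upper : ∀ q n {δ} → + 1 ℚ./ suc n < δ →
                     ∣ q ∣ < (sqrtApprox q n + δ) * (sqrtApprox q n + δ)
  sqrtApprox-upper q@(mkℚ num d c) n {δ} 1/N<δ = begin-strict
    ∣ q ∣                            ≡⟨ sym (ℚ.fromℚᵘ-toℚᵘ ∣ q ∣) ⟩
    ℚ.fromℚᵘ (ℚᵘ.mkℚᵘ (+ a) d)       <⟨ fromℚᵘ-mono-< {ℚᵘ.mkℚᵘ (+ a) d} {r⁺ ℚᵘ.* r⁺} (ℚᵘ.*<* (subst₂ ℤ._<_
                                          (ℤ.pos-* a (bN ℕ.* bN)) (pos-*³ (suc s) (suc s) (suc d)) (ℤ.+<+ ineq))) ⟩
    ℚ.fromℚᵘ (r⁺ ℚᵘ.* r⁺)            ≡⟨ fromℚᵘ-homo-* r⁺ r⁺ ⟩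
    ℚ.fromℚᵘ r⁺ * ℚ.fromℚᵘ r⁺        ≤⟨ *-mono-≤ 0≤r⁺ 0≤r⁺ r⁺≤ r⁺≤ ⟩
    (sqrtApprox q n + δ) * (sqrtApprox q n + δ) ∎
    where
    open ℚ.≤-Reasoning
    a  = ℤ.∣ num ∣
    bN = suc d ℕ.* suc n
    s  = isqrt (a ℕ.* suc d ℕ.* (suc n ℕ.* suc n))
    r  = ℚᵘ.mkℚᵘ (+ s) (ℕ.pred bN)
    r⁺ = ℚᵘ.mkℚᵘ (+ suc s) (ℕ.pred bN)
    1/bN = ℚᵘ.mkℚᵘ (+ 1) (ℕ.pred bN)
    ineq : a ℕ.* (bN ℕ.* bN) ℕ.< suc s ℕ.* suc s ℕ.* suc d
    ineq = subst (ℕ._< suc s ℕ.* suc s ℕ.* suc d) (sym (scale a (suc d) (suc n)))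
             (ℕ.*-monoˡ-< (suc d) (isqrt-upper (a ℕ.* suc d ℕ.* (suc n ℕ.* suc n))))
    0≤r⁺ : 0ℚ ≤ ℚ.fromℚᵘ r⁺
    0≤r⁺ = ℚ.nonNegative⁻¹ (ℚ.fromℚᵘ r⁺) {{ℚ.normalize-nonNeg (suc s) bN}}
    r⁺≃ : r⁺ ℚᵘ.≃ r ℚᵘ.+ 1/bN
    r⁺≃ = ℚᵘ.*≡* (trans (sym (ℤ.pos-* (suc s) (bN ℕ.* bN))) (trans (cong +_ (split s bN))
            (trans (ℤ.pos-* (s ℕ.* bN ℕ.+ 1 ℕ.* bN) bN)
              (cong (ℤ._* + bN) (cong₂ ℤ._+_ (ℤ.pos-* s bN) (ℤ.pos-* 1 bN))))))
    1/bN≤ : ℚ.fromℚᵘ 1/bN ≤ + 1 ℚ./ suc n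
    1/bN≤ = fromℚᵘ-mono-≤ {1/bN} {ℚᵘ.mkℚᵘ (+ 1) n}
      (ℚᵘ.*≤* (ℤ.+≤+ (ℕ.+-monoˡ-≤ 0 (ℕ.m≤m+n (suc n) (d ℕ.* suc n)))))
    r⁺≤ : ℚ.fromℚᵘ r⁺ ≤ sqrtApprox q n + δ
    r⁺≤ = begin
      ℚ.fromℚᵘ r⁺                     ≡⟨ ℚ.fromℚᵘ-cong r⁺≃ ⟩
      ℚ.fromℚᵘ (r ℚᵘ.+ 1/bN)          ≡⟨ fromℚᵘ-homo-+ r 1/bN ⟩
      sqrtApprox q n + ℚ.fromℚᵘ 1/bN  ≤⟨ ℚ.+-monoʳ-≤ (sqrtApprox q n) (ℚ.≤-trans 1/bN≤ (ℚ.<⇒≤ 1/N<δ)) ⟩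
      sqrtApprox q n + δ              ∎

  private
    root-close : ∀ p q r s ε → 0ℚ < ε → 0ℚ ≤ r → q < (r + ½ * ε) * (r + ½ * ε) → s * s ≤ p →
                 p - q < ½ * ε * (½ * ε) → s - r < ε
    root-close p q r s ε 0<ε 0≤r upper lower close with (s - r) ℚ.<? ε
    ... | yes h = h
    ... | no ¬h = contradiction refl (ℚ.<⇒≢ (begin-strict
      p                                             <⟨ p-q<r⇒p<q+r close ⟩
      q + δ * δ                                     <⟨ ℚ.+-monoˡ-< (δ * δ) upper ⟩
      (r + δ) * (r + δ) + δ * δ                     ≡⟨ sym (ℚ.+-identityʳ ((r + δ) * (r + δ) + δ * δ)) ⟩
      (r + δ) * (r + δ) + δ * δ + 0ℚ                ≤⟨ ℚ.+-monoʳ-≤ ((r + δ) * (r + δ) + δ * δ) 0≤rest ⟩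
      (r + δ) * (r + δ) + δ * δ + (δ * (r + δ) + δ * (r + δ))
                                                    ≡⟨ *-square-step r δ ⟩
      (r + (δ + δ)) * (r + (δ + δ))                 ≡⟨ cong (λ z → (r + z) * (r + z)) (½+½ ε) ⟩
      (r + ε) * (r + ε)                             ≤⟨ *-mono-≤ 0≤r+ε 0≤r+ε r+ε≤s r+ε≤s ⟩
      s * s                                         ≤⟨ lower ⟩
      p                                             ∎))
      where
      open ℚ.≤-Reasoning
      δ = ½ * ε
      0≤δ = ℚ.<⇒≤ (½-pos 0<ε)
      0≤r+ε : 0ℚ ≤ r + ε
      0≤r+ε = ℚ.+-mono-≤ 0≤r (ℚ.<⇒≤ 0<ε)
      0≤δr : 0ℚ ≤ δ * (r + δ)
      0≤δr = *-mono-≤ ℚ.≤-refl ℚ.≤-refl 0≤δ (ℚ.+-mono-≤ 0≤r 0≤δ)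
      0≤rest : 0ℚ ≤ δ * (r + δ) + δ * (r + δ)
      0≤rest = ℚ.+-mono-≤ 0≤δr 0≤δr
      r+ε≤s : r + ε ≤ s
      r+ε≤s = subst (r + ε ≤_) (solve 2 (λ r s → r :+ (s :- r) := s) refl r s)
                (ℚ.+-monoʳ-≤ r (ℚ.≮⇒≥ ¬h))

    root-lower : ∀ p r → 1ℚ ≤ p → 0ℚ ≤ r → p < (r + ½) * (r + ½) → + 1 ℚ./ 4 < r
    root-lower p r 1≤p 0≤r upper with + 1 ℚ./ 4 ℚ.<? r
    ... | yes h = h
    ... | no ¬h = contradiction refl (ℚ.<⇒≢ (begin-strict
      1ℚ                       ≤⟨ 1≤p ⟩
      p                        <⟨ upper ⟩
      (r + ½) * (r + ½)        ≤⟨ *-mono-≤ 0≤r+½ 0≤r+½ r+½≤ r+½≤ ⟩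
      (¼ + ½) * (¼ + ½)        ≤⟨ ℚ.≤ᵇ⇒≤ _ ⟩
      1ℚ                       ∎))
      where
      open ℚ.≤-Reasoning
      ¼ = + 1 ℚ./ 4
      0≤r+½ : 0ℚ ≤ r + ½
      0≤r+½ = ℚ.+-mono-≤ 0≤r (ℚ.nonNegative⁻¹ ½)
      r+½≤ : r + ½ ≤ ¼ + ½
      r+½≤ = ℚ.+-monoˡ-≤ ½ (ℚ.≮⇒≥ ¬h)

  abstract
    sqrt-cauchy : ∀ x → IsCauchy x → IsCauchy (λ n → sqrtApprox (x n) n)
    sqrt-cauchy x cx = oneSided⇒cauchy (λ n → sqrtApprox (x n) n) λ ε 0<ε →
      let δ     = ½ * ε
          0<δ   = ½-pos 0<ε
          M , f = archimedean 0<δ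
          N , g = ∣-∣-cauchy x cx (δ * δ) (pos-* 0<δ 0<δ)
      in M ℕ.⊔ N , λ m n h k →
        root-close ∣ x m ∣ ∣ x n ∣ (sqrtApprox (x n) n) (sqrtApprox (x m) m) ε 0<ε
          (sqrtApprox≥0 (x n) n)
          (sqrtApprox-upper (x n) n (f n (ℕ.m⊔n≤o⇒m≤o M N k)))
          (sqrtApprox-lower (x m) m)
          (ℚ.≤-<-trans (p≤∣p∣ (∣ x m ∣ - ∣ x n ∣)) (g m n (ℕ.m⊔n≤o⇒n≤o M N h) (ℕ.m⊔n≤o⇒n≤o M N k)))

  invFact : ℕ → ℚ
  invFact k = (+ 1 ℚ./ (k !)) {{k ℕ.!≢0}}

  -- The partial sums of ∑ 1/k!.
  expSeq : ℕ → ℚ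
  expSeq zero    = invFact 0
  expSeq (suc n) = expSeq n + invFact (suc n)

  invFact≥0 : ∀ k → 0ℚ ≤ invFact k
  invFact≥0 k = ℚ.nonNegative⁻¹ (invFact k) {{ℚ.normalize-nonNeg 1 (k !) {{k ℕ.!≢0}}}}

  expSeq-mono : ∀ {m n} → m ℕ.≤′ n → expSeq m ≤ expSeq n
  expSeq-mono ℕ.≤′-refl = ℚ.≤-refl
  expSeq-mono {m} {suc n} (ℕ.≤′-step h) = ℚ.≤-trans (expSeq-mono h)
    (subst (_≤ expSeq (suc n)) (ℚ.+-identityʳ (expSeq n)) (ℚ.+-monoʳ-≤ (expSeq n) (invFact≥0 (suc n))))

  -- 1/(n+2)! ≤ 1/((n+1)(n+2)) = 1/(n+1) - 1/(n+2)
  invFact-telescope : ∀ n → invFact (suc (suc n)) + + 1 ℚ./ suc (suc n) ≤ + 1 ℚ./ suc n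
  invFact-telescope n = begin
    invFact (suc (suc n)) + ℚ.fromℚᵘ u   ≤⟨ ℚ.+-monoˡ-≤ (ℚ.fromℚᵘ u) bound ⟩
    ℚ.fromℚᵘ v + ℚ.fromℚᵘ u              ≡⟨ sym (fromℚᵘ-homo-+ v u) ⟩
    ℚ.fromℚᵘ (v ℚᵘ.+ u)                  ≡⟨ ℚ.fromℚᵘ-cong v+u≃ ⟩
    + 1 ℚ./ suc n                        ∎
    where
    open ℚ.≤-Reasoning
    N = suc n
    M = suc (suc n)
    u = ℚᵘ.mkℚᵘ (+ 1) (suc n)
    v = ℚᵘ.mkℚᵘ (+ 1) (ℕ.pred (M ℕ.* N))
    recip-anti : ∀ k l .{{_ : ℕ.NonZero k}} .{{_ : ℕ.NonZero l}} → l ℕ.≤ k → + 1 ℚ./ k ≤ + 1 ℚ./ l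
    recip-anti (suc k) (suc l) h = fromℚᵘ-mono-≤ {ℚᵘ.mkℚᵘ (+ 1) k} {ℚᵘ.mkℚᵘ (+ 1) l}
      (ℚᵘ.*≤* (ℤ.+≤+ (ℕ.+-monoˡ-≤ 0 h)))
    bound : invFact (suc (suc n)) ≤ ℚ.fromℚᵘ v
    bound = recip-anti (M !) (M ℕ.* N) {{M ℕ.!≢0}}
      (ℕ.*-monoʳ-≤ M (ℕ.m≤m*n N (n !) {{n ℕ.!≢0}}))
    v+u≃ : v ℚᵘ.+ u ℚᵘ.≃ ℚᵘ.mkℚᵘ (+ 1) n
    v+u≃ = ℚᵘ.*≡* (trans (cong (ℤ._* + N) (cong₂ ℤ._+_ (sym (ℤ.pos-* 1 M)) (sym (ℤ.pos-* 1 (M ℕ.* N)))))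
      (trans (sym (ℤ.pos-* (1 ℕ.* M ℕ.+ 1 ℕ.* (M ℕ.* N)) N))
        (trans (cong +_ (telescope n)) (ℤ.pos-* 1 (M ℕ.* N ℕ.* M)))))

  expSeq-upper : ∀ {m n} → m ℕ.≤′ n → expSeq (suc n) + + 1 ℚ./ suc n ≤ expSeq (suc m) + + 1 ℚ./ suc m
  expSeq-upper ℕ.≤′-refl = ℚ.≤-refl
  expSeq-upper {m} {suc n} (ℕ.≤′-step h) = begin
    expSeq (suc n) + invFact (suc (suc n)) + + 1 ℚ./ suc (suc n)
      ≡⟨ ℚ.+-assoc (expSeq (suc n)) _ _ ⟩
    expSeq (suc n) + (invFact (suc (suc n)) + + 1 ℚ./ suc (suc n))
      ≤⟨ ℚ.+-monoʳ-≤ (expSeq (suc n)) (invFact-telescope n) ⟩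
    expSeq (suc n) + + 1 ℚ./ suc n
      ≤⟨ expSeq-upper h ⟩
    expSeq (suc m) + + 1 ℚ./ suc m ∎
    where open ℚ.≤-Reasoning

  abstract
    expSeq-cauchy : IsCauchy expSeq
    expSeq-cauchy = oneSided⇒cauchy expSeq λ ε 0<ε →
      let N , f = archimedean 0<ε in suc N , one ε 0<ε N f
      where
      one : ∀ ε → 0ℚ < ε → ∀ N → (∀ n → N ℕ.≤ n → + 1 ℚ./ suc n < ε) →
            ∀ m n → N ℕ.< m → N ℕ.< n → expSeq m - expSeq n < ε
      one ε 0<ε N f (suc m) (suc n) (ℕ.s≤s N≤m) (ℕ.s≤s N≤n) with ℕ.≤-total m n
      ... | inj₁ m≤n = p<q+r⇒p-q<r (ℚ.≤-<-trans (expSeq-mono (ℕ.≤⇒≤′ (ℕ.s≤s m≤n)))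
                         (subst (_< expSeq (suc n) + ε) (ℚ.+-identityʳ _) (ℚ.+-monoʳ-< (expSeq (suc n)) 0<ε)))
      ... | inj₂ n≤m = p<q+r⇒p-q<r (begin-strict
        expSeq (suc m)                  ≡⟨ sym (ℚ.+-identityʳ _) ⟩
        expSeq (suc m) + 0ℚ             ≤⟨ ℚ.+-monoʳ-≤ (expSeq (suc m)) (ℚ.nonNegative⁻¹ _ {{ℚ.normalize-nonNeg 1 (suc m)}}) ⟩
        expSeq (suc m) + + 1 ℚ./ suc m  ≤⟨ expSeq-upper (ℕ.≤⇒≤′ n≤m) ⟩
        expSeq (suc n) + + 1 ℚ./ suc n  <⟨ ℚ.+-monoʳ-< (expSeq (suc n)) (f n N≤n) ⟩
        expSeq (suc n) + ε              ∎)
        where open ℚ.≤-Reasoning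

  expSeq≥1 : ∀ n → 1ℚ ≤ expSeq n
  expSeq≥1 n = expSeq-mono (ℕ.≤⇒≤′ {0} {n} ℕ.z≤n)

  sqrtApprox-pos : ∀ q n → 1ℚ ≤ q → + 1 ℚ./ suc n < ½ → 0ℚ + + 1 ℚ./ 4 < sqrtApprox q n
  sqrtApprox-pos q n 1≤q 1/N<½ = subst (_< sqrtApprox q n) (sym (ℚ.+-identityˡ (+ 1 ℚ./ 4)))
    (root-lower ∣ q ∣ (sqrtApprox q n) (ℚ.≤-trans 1≤q (p≤∣p∣ q)) (sqrtApprox≥0 q n)
      (sqrtApprox-upper q n 1/N<½))

  eventually<½ : ∃ λ N → ∀ n → N ℕ.≤ n → + 1 ℚ./ suc n < ½
  eventually<½ = archimedean (ℚ.positive⁻¹ ½)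

  abstract
    sqrt-expSeq-lower : ∃ λ N → ∀ n → N ℕ.≤ n → 0ℚ + + 1 ℚ./ 4 < sqrtApprox (expSeq n) n
    sqrt-expSeq-lower = proj₁ eventually<½ , λ n N≤n →
      sqrtApprox-pos (expSeq n) n (expSeq≥1 n) (proj₂ eventually<½ n N≤n)

open Cauchy-Lemmas

record ℝ : Set where
  constructor mkℝ
  field
    seq    : ℕ → ℚ
    cauchy : IsCauchy seq

open ℝ public

infix  4 _≈_ _≤_ _<_
infix  8 -_
infixl 7 _*_
infixl 6 _+_
infixr 8 _^_

record _≈_ (x y : ℝ) : Set where
  constructor mk≈
  field close : ∀ ε → 0ℚ ℚ.< ε → ∃ λ N → ∀ n → N ℕ.≤ n → ℚ.∣ seq x n ℚ.- seq y n ∣ ℚ.< ε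

record _≤_ (x y : ℝ) : Set where
  constructor mk≤
  field below : ∀ ε → 0ℚ ℚ.< ε → ∃ λ N → ∀ n → N ℕ.≤ n → seq x n ℚ.< seq y n ℚ.+ ε

record _<_ (x y : ℝ) : Set where
  constructor mk<
  field gap : ∃ λ ε → 0ℚ ℚ.< ε × ∃ λ N → ∀ n → N ℕ.≤ n → seq x n ℚ.+ ε ℚ.< seq y n

fromℚ : ℚ → ℝ
fromℚ q = mkℝ (λ _ → q) (const-cauchy q)

fromℕ : ℕ → ℝ
fromℕ n = fromℚ (+ n ℚ./ 1)

0ℝ 1ℝ : ℝ
0ℝ = fromℚ 0ℚ
1ℝ = fromℚ 1ℚ

-_ : ℝ → ℝ
- mkℝ x cx = mkℝ (λ n → ℚ.- x n) (neg-cauchy x cx)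

_+_ : ℝ → ℝ → ℝ
mkℝ x cx + mkℝ y cy = mkℝ (λ n → x n ℚ.+ y n) (+-cauchy x y cx cy)

_*_ : ℝ → ℝ → ℝ
mkℝ x cx * mkℝ y cy = mkℝ (λ n → x n ℚ.* y n) (*-cauchy x y cx cy)

_^_ : ℝ → ℕ → ℝ
x ^ zero  = 1ℝ
x ^ suc n = x * x ^ n

∣_∣ : ℝ → ℝ
∣ mkℝ x cx ∣ = mkℝ (λ n → ℚ.∣ x n ∣) (∣-∣-cauchy x cx)

recip : (x : ℝ) → 0ℝ < x → ℝ
recip (mkℝ x cx) (mk< 0<x) = mkℝ (λ n → inv (x n)) (inv-cauchy x cx 0<x)

-- The square root of ∣ x ∣; only used at nonnegative x.
√_ : ℝ → ℝ
√ mkℝ x cx = mkℝ (λ n → sqrtApprox (x n) n) (sqrt-cauchy x cx)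

e : ℝ
e = mkℝ expSeq expSeq-cauchy

0<√e : 0ℝ < √ e
0<√e = mk< (+ 1 ℚ./ 4 , ℚ.positive⁻¹ (+ 1 ℚ./ 4) , sqrt-expSeq-lower)

2/√e : ℝ
2/√e = fromℕ 2 * recip (√ e) 0<√e

-- n^(3/4), as the fourth root of n³.
_^¾ : ℕ → ℝ
n ^¾ = √ √ (fromℕ n ^ 3)

sumℝ : List ℝ → ℝ
sumℝ = foldr _+_ 0ℝ

------------------------------------------------------------------------
-- Polynomials over ℝ in y₀ , … , y_{N-1}: lists of (coefficient, exponent
-- vector) terms, possibly with repeated exponents, compared coefficientwise

Poly : ℕ → Set
Poly N = List (ℝ × Vec ℕ N)

module _ {N : ℕ} where

  coeff : Poly N → Vec ℕ N → ℝ
  coeff p u = foldr (λ (c , v) s → if does (Vec.≡-dec ℕ._≟_ v u) then c + s else s) 0ℝ p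

  infix 4 _≋_
  record _≋_ (p q : Poly N) : Set where
    constructor mk≋
    field coeff-≈ : ∀ u → coeff p u ≈ coeff q u

  constant : ℝ → Poly N
  constant c = (c , replicate N 0) ∷ []

  var : Fin N → Poly N
  var a = (1ℝ , replicate N 0 [ a ]≔ 1) ∷ []

  infixl 6 _⊕_ _⊖_
  infixl 7 _⊗_

  _⊕_ : Poly N → Poly N → Poly N
  _⊕_ = _++_

  _⊗_ : Poly N → Poly N → Poly N
  _⊗_ = cartesianProductWith (λ (c , u) (d , v) → c * d , zipWith ℕ._+_ u v)

  _⊖_ : Poly N → Poly N → Poly N
  p ⊖ q = p ⊕ constant (- 1ℝ) ⊗ q

  sumP : List (Poly N) → Poly N
  sumP = foldr _⊕_ (constant 0ℝ)

  productP : List (Poly N) → Poly N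
  productP = foldr _⊗_ (constant 1ℝ)

  var̄ : Fin N → Poly N
  var̄ a = constant 1ℝ ⊖ var a

------------------------------------------------------------------------
-- Boolean Nullstellensatz proofs

record Monomial (N : ℕ) : Set where
  field
    S T      : Subset N
    disjoint : Empty (S ∩ T)

open Monomial public

monomialPoly : ∀ {N} → Monomial N → Poly N
monomialPoly {N} r =
  productP (map var (members (S r))) ⊗ productP (map var̄ (members (T r)))
  where
  members : Subset N → List (Fin N)
  members U = filter (_∈? U) (allFin N)

-- A family of coefficients c_r, listed for finitely many distinct monomials r.
record LinearCombination (N : ℕ) : Set where
  field
    terms    : List (ℝ × Monomial N)
    distinct : AllPairs (λ (_ , r) (_ , s) → ¬ (S r ≡ S s × T r ≡ T s)) terms

open LinearCombination public

combinationPoly : ∀ {N} → LinearCombination N → Poly N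
combinationPoly q = sumP (map (λ (c , r) → constant c ⊗ monomialPoly r) (terms q))

coefficientSize : ∀ {N} → LinearCombination N → ℝ
coefficientSize q = sumℝ (map (λ (c , _) → ∣ c ∣) (terms q))

module _ {N : ℕ} (axioms : List (Poly N)) where

  certificate : (Fin (length axioms) → LinearCombination N) → (Fin N → Poly N) → Poly N
  certificate q g =
    sumP (map (λ i → lookup axioms i ⊗ combinationPoly (q i)) (allFin (length axioms)))
    ⊕ sumP (map (λ a → g a ⊗ (var a ⊗ var a ⊖ var a)) (allFin N))

  record NullstellensatzProof : Set where
    field
      q        : Fin (length axioms) → LinearCombination N
      g        : Fin N → Poly N
      identity : constant 1ℝ ≋ certificate q g

totalCoefficientSize : ∀ {N} {axioms : List (Poly N)} → NullstellensatzProof axioms → ℝ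
totalCoefficientSize {axioms = axioms} π = sumℝ (map (λ i → coefficientSize (q i)) (allFin (length axioms)))
  where open NullstellensatzProof π

------------------------------------------------------------------------
-- The pigeonhole system with n pigeons and n - 1 holes

module _ (n : ℕ) where

  pigeonVar : Fin n → Fin (n ∸ 1) → Fin (n ℕ.* (n ∸ 1))
  pigeonVar i j = combine i j

  pigeonAxiom : Fin n → Poly (n ℕ.* (n ∸ 1))
  pigeonAxiom i = productP (map (λ j → var̄ (pigeonVar i j)) (allFin (n ∸ 1)))

  holeAxiom : Fin n → Fin n → Fin (n ∸ 1) → Poly (n ℕ.* (n ∸ 1))
  holeAxiom i₁ i₂ j = var (pigeonVar i₁ j) ⊗ var (pigeonVar i₂ j)

  pigeonPairs : List (Fin n × Fin n)
  pigeonPairs = filter (λ (i₁ , i₂) → i₁ Fin.<? i₂) (cartesianProduct (allFin n) (allFin n))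

  PHP : List (Poly (n ℕ.* (n ∸ 1)))
  PHP = map pigeonAxiom (allFin n)
     ++ cartesianProductWith (λ (i₁ , i₂) j → holeAxiom i₁ i₂ j) pigeonPairs (allFin (n ∸ 1))

-- A Nullstellensatz proof is bounded below by LP duality: for a functional L
-- with L(1) = Z and |L(p r)| ≤ B for all axioms p and monomials r, the total
-- coefficient size is at least Z / B.  With m = n - 1 holes, L integrates against
-- a signed weight D on the maps x : [n] → [m], on which the pigeon axioms vanish,
--
--   D(x) = Σ_{S ⊆ [n]} w(n - |S|) [x is injective on S],
--   w(0) = 0, w(1) = 1, m w(t + 1) = - t w(t) for t ≥ 1,
--
-- chosen so that summing out any single pigeon leaves m times the indicator of
-- the bijections.  Hence Z = m m!, every proper restriction of x is injective
-- almost surely with respect to D, and Σ D² = Z Σ_S w(n - |S|) ≤ Z n.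
-- A hole axiom times a monomial is the indicator of a cube
-- [x i₁ = x i₂ = j] Π_i [x i ∈ A i].  For i ≠ i₁, i₂ the factor [x i ∈ A i] may be
-- replaced by [x i ∈ A i] - ½ = ±½, since a term not depending on x i is
-- annihilated by L because of the collision of i₁ and i₂.  Cauchy-Schwarz then
-- gives L(cube)² ≤ Z n (m/4)^(m-1), so the squared size is at least about
-- m! (4/m)^(m-1), and a Stirling bound turns this into n^(3/2) (4/e)^n.
--
-- Real coefficients are replaced throughout by their k-th rational
-- approximations, the identity of polynomials then holding in the limit.
module Submission where

open import Defs hiding (e; _+_; _*_; -_; ∣_∣; _≤_; _<_; _^_; _≈_)
import Defs as ℝ
open import Algebra.Bundles using (CommutativeRing)
open import Data.Bool.Base using (Bool; true; false; if_then_else_)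
open import Data.Fin.Base as Fin using (Fin; zero; suc; punchIn; toℕ; combine; remQuot)
import Data.Fin.Properties as Fin
open import Data.Fin.Subset using (Subset)
open import Data.Fin.Subset.Properties using (_∈?_)
import Data.Integer.Base as ℤ
import Data.Integer.Properties as ℤ
open import Data.List.Base as List using (List; []; _∷_; _++_; map; allFin; length; filter; cartesianProduct; cartesianProductWith; deduplicate)
open import Data.List.Membership.Propositional using (_∈_)
open import Data.List.Membership.Propositional.Properties using (∈-allFin; ∈-lookup; ∈-++⁻; ∈-map⁻; ∈-++⁺ˡ; ∈-++⁺ʳ; ∈-cartesianProductWith⁻; ∈-filter⁻; ∈-deduplicate⁺)
open import Data.List.Properties using (map-tabulate)
open import Data.List.Relation.Binary.Permutation.Propositional as ↭ using (_↭_; prep; swap; ↭-refl)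
open import Data.List.Relation.Unary.All as All using (All; []; _∷_)
open import Data.List.Relation.Unary.AllPairs using (_∷_)
open import Data.List.Relation.Unary.Any using (here; there)
open import Data.List.Relation.Unary.Unique.DecPropositional.Properties using (deduplicate-!)
open import Data.List.Relation.Unary.Unique.Propositional using (Unique)
open import Data.Nat.Base as ℕ using (ℕ; zero; suc; _!)
import Data.Nat.Properties as ℕ
import Data.Nat.Tactic.RingSolver as ℕ-Solver
open import Data.Product.Base using (∃; _×_; _,_; proj₁; proj₂)
import Data.Rational.Base as ℚ
import Data.Rational.Properties as ℚ
import Data.Rational.Unnormalised.Base as ℚᵘ
open import Data.Sum.Base using (_⊎_; inj₁; inj₂)
open import Data.Vec.Base as Vec using (Vec; []; _∷_; lookup; insertAt; removeAt; toList; replicate; zipWith; _[_]≔_)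
import Data.Vec.Properties as Vec
open import Relation.Binary.PropositionalEquality using (_≡_; _≢_; refl; sym; trans; cong; cong₂; subst; subst₂; module ≡-Reasoning)
open import Relation.Nullary using (Dec; yes; no; does; contradiction)
open import Relation.Nullary.Decidable using (dec⇒maybe; toWitness)
open import Tactic.RingSolver using (solve-∀)
open import Tactic.RingSolver.Core.AlmostCommutativeRing using (AlmostCommutativeRing; fromCommutativeRing)

-- For n ≥ 3 any two pigeons lie in a proper subset, so a nonnegative weight whose proper
-- restrictions are all injective would allow no collision, against the pigeonhole principle: D has
-- to be signed. A signed weight leaves no monotonicity by which L(cube) could be compared with L of
-- a larger set, hence the L² estimate. In it the shift by ½ produces the base 2: unshifted, a free
-- pigeon may contribute up to m to the square sum of the cube; shifted, it contributes exactly m/4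
-- whatever A i is, a gain of 4 per pigeon in the squared size. The bound √(Z n (m/4)^(m-1)),
-- n^(3/4) and 2/√e need not be rational, so the estimates compare squares of rationals and a root
-- is taken only at the end. Approximation costs constants only: at late k the functional is at
-- least Z/2 on the certificate, and the n-th power of the k-th partial sum of e is at most twice
-- the (2n)-th power of the k-th approximation to √e.

module _ where

  open import Algebra.Properties.CommutativeSemiring.Exp (CommutativeRing.commutativeSemiring ℚ.+-*-commutativeRing) using (^-distrib-*)
  open import Algebra.Properties.Semiring.Exp (CommutativeRing.semiring ℚ.+-*-commutativeRing) using (_^_; ^-homo-*)
  open import Data.Rational.Base using (ℚ; 0ℚ; 1ℚ; ½; _+_; _*_; _-_; -_; ∣_∣; _≤_; _<_; positive; nonNegative)
  open ℚ-Lemmas using (*-mono-≤; ½-pos; ½+½; pos-*; quotient; p≤∣p∣; archimedean; fromℚᵘ-homo-+; fromℚᵘ-homo-*)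
  open Cauchy-Lemmas using (invFact; invFact≥0; expSeq; expSeq≥1; inv; inv-inverse; sqrtApprox; sqrtApprox≥0; sqrtApprox-lower; sqrtApprox-upper; sqrt-expSeq-lower)

  -- Order, powers and natural numbers in ℚ

  ℚ-ring : AlmostCommutativeRing _ _
  ℚ-ring = fromCommutativeRing ℚ.+-*-commutativeRing (λ q → dec⇒maybe (0ℚ ℚ.≟ q))

  0≤1 : 0ℚ ≤ 1ℚ
  0≤1 = ℚ.nonNegative⁻¹ 1ℚ

  ≤-mulˡ : ∀ r {p q} → 0ℚ ≤ r → p ≤ q → r * p ≤ r * q
  ≤-mulˡ r 0≤r p≤q = ℚ.*-monoˡ-≤-nonNeg r {{nonNegative 0≤r}} p≤q

  ≤-mulʳ : ∀ r {p q} → 0ℚ ≤ r → p ≤ q → p * r ≤ q * r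
  ≤-mulʳ r 0≤r p≤q = ℚ.*-monoʳ-≤-nonNeg r {{nonNegative 0≤r}} p≤q

  ≤-cancelˡ : ∀ r {p q} → 0ℚ < r → r * p ≤ r * q → p ≤ q
  ≤-cancelˡ r 0<r h = ℚ.*-cancelˡ-≤-pos r {{positive 0<r}} h

  0≤-* : ∀ {p q} → 0ℚ ≤ p → 0ℚ ≤ q → 0ℚ ≤ p * q
  0≤-* {p} {q} 0≤p 0≤q = subst (_≤ p * q) (ℚ.*-zeroʳ p) (≤-mulˡ p 0≤p 0≤q)

  0≤-+ : ∀ {p q} → 0ℚ ≤ p → 0ℚ ≤ q → 0ℚ ≤ p + q
  0≤-+ = ℚ.+-mono-≤

  ≤-+ʳ : ∀ {q} p → 0ℚ ≤ q → p ≤ p + q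
  ≤-+ʳ {q} p 0≤q = subst (_≤ p + q) (ℚ.+-identityʳ p) (ℚ.+-monoʳ-≤ p 0≤q)

  0≤-² : ∀ p → 0ℚ ≤ p * p
  0≤-² p with ℚ.≤-total 0ℚ p
  ... | inj₁ 0≤p = 0≤-* 0≤p 0≤p
  ... | inj₂ p≤0 = subst (0ℚ ≤_) (square-neg p) (0≤-* 0≤-p 0≤-p)
    where
    square-neg : ∀ p → - p * - p ≡ p * p
    square-neg = solve-∀ ℚ-ring
    0≤-p : 0ℚ ≤ - p
    0≤-p = ℚ.neg-antimono-≤ p≤0

  0≤q-p⇒p≤q : ∀ {p q} → 0ℚ ≤ q - p → p ≤ q
  0≤q-p⇒p≤q {p} {q} h = subst₂ _≤_ (ℚ.+-identityˡ p) (e q p) (ℚ.+-monoˡ-≤ p h)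
    where
    e : ∀ q p → q - p + p ≡ q
    e = solve-∀ ℚ-ring

  -- Takes the place of square roots, which ℚ lacks: bounds are proved for squares and brought back
  -- to the quantities themselves here.
  square-cancel-≤ : ∀ {p q} → 0ℚ ≤ q → p * p ≤ q * q → p ≤ q
  square-cancel-≤ {p} {q} 0≤q h with q ℚ.<? p
  ... | no  q≮p = ℚ.≮⇒≥ q≮p
  ... | yes q<p = contradiction (ℚ.<-≤-trans p²>pq (ℚ.≤-trans h (≤-mulʳ q 0≤q (ℚ.<⇒≤ q<p)))) (ℚ.<-irrefl refl)
    where
    p²>pq : p * q < p * p
    p²>pq = ℚ.*-monoʳ-<-pos p {{positive (ℚ.≤-<-trans 0≤q q<p)}} q<p

  ^-nonNeg : ∀ k {p} → 0ℚ ≤ p → 0ℚ ≤ p ^ k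
  ^-nonNeg zero    0≤p = 0≤1
  ^-nonNeg (suc k) 0≤p = 0≤-* 0≤p (^-nonNeg k 0≤p)

  ^-mono-≤ : ∀ k {p q} → 0ℚ ≤ p → p ≤ q → p ^ k ≤ q ^ k
  ^-mono-≤ zero    0≤p p≤q = ℚ.≤-refl
  ^-mono-≤ (suc k) 0≤p p≤q = *-mono-≤ 0≤p (^-nonNeg k 0≤p) p≤q (^-mono-≤ k 0≤p p≤q)

  -- Recursive rather than `+ k / 1`, so that numerals unfold to sums of `1ℚ` within reach of the
  -- ring solver; `ι≡/1` connects the two forms.
  ι : ℕ → ℚ
  ι zero    = 0ℚ
  ι (suc k) = 1ℚ + ι k

  ι-+ : ∀ a b → ι (a ℕ.+ b) ≡ ι a + ι b
  ι-+ zero    b = sym (ℚ.+-identityˡ (ι b))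
  ι-+ (suc a) b = trans (cong (1ℚ +_) (ι-+ a b)) (sym (ℚ.+-assoc 1ℚ (ι a) (ι b)))

  ι-* : ∀ a b → ι (a ℕ.* b) ≡ ι a * ι b
  ι-* zero    b = sym (ℚ.*-zeroˡ (ι b))
  ι-* (suc a) b = trans (ι-+ b (a ℕ.* b)) (trans (cong (ι b +_) (ι-* a b)) (e (ι a) (ι b)))
    where
    e : ∀ x y → y + x * y ≡ (1ℚ + x) * y
    e = solve-∀ ℚ-ring

  0≤ι : ∀ k → 0ℚ ≤ ι k
  0≤ι zero    = ℚ.≤-refl
  0≤ι (suc k) = 0≤-+ 0≤1 (0≤ι k)

  0<ι : ∀ k → 0ℚ < ι (suc k)
  0<ι k = ℚ.+-mono-<-≤ (ℚ.positive⁻¹ 1ℚ) (0≤ι k)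

  ι-mono : ∀ {a b} → a ℕ.≤ b → ι a ≤ ι b
  ι-mono {b = b} ℕ.z≤n = 0≤ι b
  ι-mono (ℕ.s≤s h)     = ℚ.+-monoʳ-≤ 1ℚ (ι-mono h)

  0<ι! : ∀ k → 0ℚ < ι (k !)
  0<ι! k = pos (k !) (ℕ.1≤n! k)
    where
    pos : ∀ j → 1 ℕ.≤ j → 0ℚ < ι j
    pos (suc j) _ = 0<ι j

  -- Finite sums and the Cauchy-Schwarz inequality

  private variable
    A B C : Set

  ∑ : List A → (A → ℚ) → ℚ
  ∑ []       f = 0ℚ
  ∑ (x ∷ xs) f = f x + ∑ xs f

  ∑-cong : ∀ {f g : A → ℚ} (xs : List A) → (∀ x → f x ≡ g x) → ∑ xs f ≡ ∑ xs g
  ∑-cong []       h = refl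
  ∑-cong (x ∷ xs) h = cong₂ _+_ (h x) (∑-cong xs h)

  ∑-zero : ∀ {f : A → ℚ} (xs : List A) → (∀ x → f x ≡ 0ℚ) → ∑ xs f ≡ 0ℚ
  ∑-zero []       h = refl
  ∑-zero (x ∷ xs) h = cong₂ _+_ (h x) (∑-zero xs h)

  ∑-+ : ∀ (f g : A → ℚ) xs → ∑ xs (λ x → f x + g x) ≡ ∑ xs f + ∑ xs g
  ∑-+ f g []       = refl
  ∑-+ f g (x ∷ xs) = trans (cong (f x + g x +_) (∑-+ f g xs)) (e (f x) (g x) (∑ xs f) (∑ xs g))
    where
    e : ∀ a b c d → a + b + (c + d) ≡ a + c + (b + d)
    e = solve-∀ ℚ-ring

  ∑-*ˡ : ∀ c (f : A → ℚ) xs → ∑ xs (λ x → c * f x) ≡ c * ∑ xs f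
  ∑-*ˡ c f []       = sym (ℚ.*-zeroʳ c)
  ∑-*ˡ c f (x ∷ xs) = trans (cong (c * f x +_) (∑-*ˡ c f xs)) (sym (ℚ.*-distribˡ-+ c (f x) (∑ xs f)))

  ∑-*ʳ : ∀ c (f : A → ℚ) xs → ∑ xs (λ x → f x * c) ≡ ∑ xs f * c
  ∑-*ʳ c f xs = trans (∑-cong xs (λ x → ℚ.*-comm (f x) c)) (trans (∑-*ˡ c f xs) (ℚ.*-comm c (∑ xs f)))

  ∑-nonNeg : ∀ {f : A → ℚ} xs → (∀ x → 0ℚ ≤ f x) → 0ℚ ≤ ∑ xs f
  ∑-nonNeg []       h = ℚ.≤-refl
  ∑-nonNeg (x ∷ xs) h = 0≤-+ (h x) (∑-nonNeg xs h)

  ∑-++ : ∀ (f : A → ℚ) xs ys → ∑ (xs ++ ys) f ≡ ∑ xs f + ∑ ys f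
  ∑-++ f []       ys = sym (ℚ.+-identityˡ (∑ ys f))
  ∑-++ f (x ∷ xs) ys = trans (cong (f x +_) (∑-++ f xs ys)) (sym (ℚ.+-assoc (f x) (∑ xs f) (∑ ys f)))

  ∑-map : ∀ (g : A → B) (f : B → ℚ) xs → ∑ (map g xs) f ≡ ∑ xs (λ x → f (g x))
  ∑-map g f []       = refl
  ∑-map g f (x ∷ xs) = cong (f (g x) +_) (∑-map g f xs)

  ∑-cartesian : ∀ (g : A → B → C) (f : C → ℚ) xs ys →
                ∑ (cartesianProductWith g xs ys) f ≡ ∑ xs (λ x → ∑ ys (λ y → f (g x y)))
  ∑-cartesian g f []       ys = refl
  ∑-cartesian g f (x ∷ xs) ys = trans (∑-++ f (map (g x) ys) (cartesianProductWith g xs ys))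
    (cong₂ _+_ (∑-map (g x) f ys) (∑-cartesian g f xs ys))

  ∑-swap : ∀ (f : A → B → ℚ) xs ys → ∑ xs (λ x → ∑ ys (f x)) ≡ ∑ ys (λ y → ∑ xs (λ x → f x y))
  ∑-swap f []       ys = sym (∑-zero ys (λ _ → refl))
  ∑-swap f (x ∷ xs) ys = trans (cong (∑ ys (f x) +_) (∑-swap f xs ys))
    (sym (∑-+ (f x) (λ y → ∑ xs (λ x → f x y)) ys))

  ∑-allFin : ∀ {n} (f : Fin (suc n) → ℚ) → ∑ (allFin (suc n)) f ≡ f zero + ∑ (allFin n) (λ i → f (suc i))
  ∑-allFin {n} f = cong (f zero +_)
    (trans (cong (λ xs → ∑ xs f) (sym (map-tabulate (λ i → i) suc))) (∑-map suc f (allFin n)))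

  ∑-const : ∀ n c → ∑ (allFin n) (λ _ → c) ≡ ι n * c
  ∑-const zero    c = sym (ℚ.*-zeroˡ c)
  ∑-const (suc n) c = trans (∑-allFin {n} (λ _ → c)) (trans (cong (c +_) (∑-const n c)) (e c (ι n)))
    where
    e : ∀ c k → c + k * c ≡ (1ℚ + k) * c
    e = solve-∀ ℚ-ring

  -- Expanding ∑ (w g - b f)² ≥ 0 with b = ∑ f g.
  cauchy-schwarz : ∀ (f g : A → ℚ) xs w → 0ℚ < w → ∑ xs (λ x → f x * f x) ≤ w →
                   ∑ xs (λ x → f x * g x) * ∑ xs (λ x → f x * g x) ≤ w * ∑ xs (λ x → g x * g x)
  cauchy-schwarz f g xs w 0<w a≤w = ≤-cancelˡ w 0<w (0≤q-p⇒p≤q (begin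
    0ℚ                                                ≤⟨ ∑-nonNeg xs (λ x → 0≤-² (w * g x - b * f x)) ⟩
    ∑ xs (λ x → (w * g x - b * f x) * (w * g x - b * f x))
      ≡⟨ ∑-cong xs (λ x → e₁ w b (f x) (g x)) ⟩
    ∑ xs (λ x → w * w * (g x * g x) + (- (w * b + w * b) * (f x * g x) + b * b * (f x * f x)))
      ≡⟨ trans (∑-+ _ _ xs) (cong₂ _+_ (∑-*ˡ (w * w) _ xs) (trans (∑-+ _ _ xs) (cong₂ _+_ (∑-*ˡ (- (w * b + w * b)) _ xs) (∑-*ˡ (b * b) _ xs)))) ⟩
    w * w * c + (- (w * b + w * b) * b + b * b * a)
      ≤⟨ ℚ.+-monoʳ-≤ (w * w * c) (ℚ.+-monoʳ-≤ (- (w * b + w * b) * b) (≤-mulˡ (b * b) (0≤-² b) a≤w)) ⟩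
    w * w * c + (- (w * b + w * b) * b + b * b * w)   ≡⟨ e₂ w b c ⟩
    w * (w * c) - w * (b * b)                         ∎))
    where
    open ℚ.≤-Reasoning
    a = ∑ xs (λ x → f x * f x)
    b = ∑ xs (λ x → f x * g x)
    c = ∑ xs (λ x → g x * g x)
    e₁ : ∀ w b f g → (w * g - b * f) * (w * g - b * f) ≡ w * w * (g * g) + (- (w * b + w * b) * (f * g) + b * b * (f * f))
    e₁ = solve-∀ ℚ-ring
    e₂ : ∀ w b c → w * w * c + (- (w * b + w * b) * b + b * b * w) ≡ w * (w * c) - w * (b * b)
    e₂ = solve-∀ ℚ-ring

  -- Injectivity of finite sequences

  -- Subsets S of the pigeons as Boolean vectors, `true` for a pigeon that is kept; `removed` is
  -- then the argument n - |S| of the weight w.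
  masks : ∀ k → List (Vec Bool k)
  masks zero    = [] ∷ []
  masks (suc k) = map (true ∷_) (masks k) ++ map (false ∷_) (masks k)

  removed : ∀ {k} → Vec Bool k → ℕ
  removed []          = 0
  removed (true ∷ S)  = removed S
  removed (false ∷ S) = suc (removed S)

  ∑-masks : ∀ {k} (G : Vec Bool (suc k) → ℚ) →
            ∑ (masks (suc k)) G ≡ ∑ (masks k) (λ S → G (true ∷ S)) + ∑ (masks k) (λ S → G (false ∷ S))
  ∑-masks {k} G = trans (∑-++ G (map (true ∷_) (masks k)) (map (false ∷_) (masks k)))
    (cong₂ _+_ (∑-map (true ∷_) G (masks k)) (∑-map (false ∷_) G (masks k)))

  -- The sum of C(k, t) g(t) over t.
  binomialSum : ∀ k → (ℕ → ℚ) → ℚ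
  binomialSum k g = ∑ (masks k) (λ S → g (removed S))

  binomialSum-suc : ∀ k g → binomialSum (suc k) g ≡ binomialSum k g + binomialSum k (λ t → g (suc t))
  binomialSum-suc k g = ∑-masks {k} (λ S → g (removed S))

  binomialSum-+ : ∀ k f g → binomialSum k (λ t → f t + g t) ≡ binomialSum k f + binomialSum k g
  binomialSum-+ k f g = ∑-+ (λ S → f (removed S)) (λ S → g (removed S)) (masks k)

  -- t C(k + 1, t) = (k + 1) C(k, t - 1)
  binomialSum-absorb : ∀ k g → binomialSum (suc k) (λ t → ι t * g t) ≡ ι (suc k) * binomialSum k (λ t → g (suc t))
  binomialSum-absorb zero g = e (g 0) (g 1)
    where
    e : ∀ a b → 0ℚ * a + ((1ℚ + 0ℚ) * b + 0ℚ) ≡ (1ℚ + 0ℚ) * (b + 0ℚ)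
    e = solve-∀ ℚ-ring
  binomialSum-absorb (suc k) g = begin
    binomialSum (suc (suc k)) (λ t → ι t * g t)
      ≡⟨ binomialSum-suc (suc k) (λ t → ι t * g t) ⟩
    binomialSum (suc k) (λ t → ι t * g t) + binomialSum (suc k) (λ t → ι (suc t) * g (suc t))
      ≡⟨ cong (binomialSum (suc k) (λ t → ι t * g t) +_) (trans (∑-cong (masks (suc k)) (λ S → e₁ (ι (removed S)) (g (suc (removed S)))))
                              (binomialSum-+ (suc k) (λ t → g (suc t)) (λ t → ι t * g (suc t)))) ⟩
    binomialSum (suc k) (λ t → ι t * g t) + (binomialSum (suc k) (λ t → g (suc t)) + binomialSum (suc k) (λ t → ι t * g (suc t)))
      ≡⟨ cong₂ (λ a b → a + (binomialSum (suc k) (λ t → g (suc t)) + b)) (binomialSum-absorb k g) (binomialSum-absorb k (λ t → g (suc t))) ⟩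
    ι (suc k) * binomialSum k (λ t → g (suc t)) + (binomialSum (suc k) (λ t → g (suc t)) + ι (suc k) * binomialSum k (λ t → g (suc (suc t))))
      ≡⟨ e₂ (ι (suc k)) (binomialSum k (λ t → g (suc t))) (binomialSum (suc k) (λ t → g (suc t))) (binomialSum k (λ t → g (suc (suc t)))) ⟩
    binomialSum (suc k) (λ t → g (suc t)) + ι (suc k) * (binomialSum k (λ t → g (suc t)) + binomialSum k (λ t → g (suc (suc t))))
      ≡⟨ cong (λ z → binomialSum (suc k) (λ t → g (suc t)) + ι (suc k) * z) (sym (binomialSum-suc k (λ t → g (suc t)))) ⟩
    binomialSum (suc k) (λ t → g (suc t)) + ι (suc k) * binomialSum (suc k) (λ t → g (suc t))
      ≡⟨ e₃ (ι (suc k)) (binomialSum (suc k) (λ t → g (suc t))) ⟩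
    ι (suc (suc k)) * binomialSum (suc k) (λ t → g (suc t)) ∎
    where
    open ≡-Reasoning
    e₁ : ∀ t g → (1ℚ + t) * g ≡ g + t * g
    e₁ = solve-∀ ℚ-ring
    e₂ : ∀ k a b c → k * a + (b + k * c) ≡ b + k * (a + c)
    e₂ = solve-∀ ℚ-ring
    e₃ : ∀ k b → b + k * b ≡ (1ℚ + k) * b
    e₃ = solve-∀ ℚ-ring

  module _ {m : ℕ} where

    δ : Fin m → Fin m → ℚ
    δ g h = if does (g Fin.≟ h) then 1ℚ else 0ℚ

    δ-refl : ∀ g → δ g g ≡ 1ℚ
    δ-refl g with g Fin.≟ g
    ... | yes _   = refl
    ... | no  g≢g = contradiction refl g≢g

    δ-≢ : ∀ {g h} → g ≢ h → δ g h ≡ 0ℚ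
    δ-≢ {g} {h} g≢h with g Fin.≟ h
    ... | yes g≡h = contradiction g≡h g≢h
    ... | no  _   = refl

    δ-sym : ∀ g h → δ g h ≡ δ h g
    δ-sym g h with g Fin.≟ h
    ... | yes refl = sym (δ-refl g)
    ... | no  g≢h    = sym (δ-≢ (λ h≡g → g≢h (sym h≡g)))

    δ-idem : ∀ g h → δ g h * δ g h ≡ δ g h
    δ-idem g h with does (g Fin.≟ h)
    ... | true  = refl
    ... | false = refl

    δ-subst : ∀ (f : Fin m → ℚ) g h → δ g h * f h ≡ δ g h * f g
    δ-subst f g h with g Fin.≟ h
    ... | yes refl = refl
    ... | no  _      = trans (ℚ.*-zeroˡ (f h)) (sym (ℚ.*-zeroˡ (f g)))

  ∑-δ : ∀ {m} (g : Fin m) → ∑ (allFin m) (δ g) ≡ 1ℚ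
  ∑-δ {suc m} zero = trans (∑-allFin (δ {suc m} zero))
    (cong (1ℚ +_) (∑-zero {f = λ h → δ {suc m} zero (suc h)} (allFin m) (λ h → refl)))
  ∑-δ {suc m} (suc g) = trans (∑-allFin (δ {suc m} (suc g)))
    (trans (ℚ.+-identityˡ _) (trans (∑-cong (allFin m) (δ-suc g)) (∑-δ g)))
    where
    δ-suc : ∀ g h → δ {suc m} (suc g) (suc h) ≡ δ g h
    δ-suc g h with g Fin.≟ h
    ... | yes refl = refl
    ... | no  _      = refl

  ∑-δ-* : ∀ {m} (f : Fin m → ℚ) g → ∑ (allFin m) (λ h → δ g h * f h) ≡ f g
  ∑-δ-* {m} f g = trans (∑-cong (allFin m) (λ h → δ-subst f g h))
    (trans (∑-*ʳ (f g) (δ g) (allFin m)) (trans (cong (_* f g) (∑-δ g)) (ℚ.*-identityˡ (f g))))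

  module _ {m : ℕ} where

    -- The indicator of h ∉ y. With rational values, injectivity becomes a factor in sums, handled
    -- by idempotence instead of case distinctions.
    fresh : Fin m → List (Fin m) → ℚ
    fresh h []      = 1ℚ
    fresh h (g ∷ y) = (1ℚ - δ g h) * fresh h y

    inj : List (Fin m) → ℚ
    inj []      = 1ℚ
    inj (h ∷ y) = fresh h y * inj y

    fresh-↭ : ∀ h {y z} → y ↭ z → fresh h y ≡ fresh h z
    fresh-↭ h ↭.refl         = refl
    fresh-↭ h (prep g p)   = cong ((1ℚ - δ g h) *_) (fresh-↭ h p)
    fresh-↭ h (swap {y} {z} g g′ p) = trans (cong (λ f → (1ℚ - δ g h) * ((1ℚ - δ g′ h) * f)) (fresh-↭ h p))
      (e (1ℚ - δ g h) (1ℚ - δ g′ h) (fresh h z))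
      where
      e : ∀ a b f → a * (b * f) ≡ b * (a * f)
      e = solve-∀ ℚ-ring
    fresh-↭ h (↭.trans p q) = trans (fresh-↭ h p) (fresh-↭ h q)

    inj-↭ : ∀ {y z} → y ↭ z → inj y ≡ inj z
    inj-↭ ↭.refl       = refl
    inj-↭ (prep g p) = cong₂ _*_ (fresh-↭ g p) (inj-↭ p)
    inj-↭ (swap {y} {z} g g′ p) = trans
      (trans (cong (λ d → (1ℚ - d) * fresh g y * (fresh g′ y * inj y)) (δ-sym g′ g))
               (e (1ℚ - δ g g′) (fresh g y) (fresh g′ y) (inj y)))
      (cong₂ _*_ (cong ((1ℚ - δ g g′) *_) (fresh-↭ g′ p)) (cong₂ _*_ (fresh-↭ g p) (inj-↭ p)))
      where
      e : ∀ d a b i → d * a * (b * i) ≡ d * b * (a * i)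
      e = solve-∀ ℚ-ring
    inj-↭ (↭.trans p q) = trans (inj-↭ p) (inj-↭ q)

    fresh-idem : ∀ h y → fresh h y * fresh h y ≡ fresh h y
    fresh-idem h []      = refl
    fresh-idem h (g ∷ y) = begin
      (1ℚ - d) * f * ((1ℚ - d) * f)              ≡⟨ e₁ d f ⟩
      (1ℚ - d - d + d * d) * (f * f)             ≡⟨ cong₂ (λ a b → (1ℚ - d - d + a) * b) (δ-idem g h) (fresh-idem h y) ⟩
      (1ℚ - d - d + d) * f                       ≡⟨ e₂ d f ⟩
      (1ℚ - d) * f                               ∎
      where
      open ≡-Reasoning
      d = δ g h
      f = fresh h y
      e₁ : ∀ d f → (1ℚ - d) * f * ((1ℚ - d) * f) ≡ (1ℚ - d - d + d * d) * (f * f)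
      e₁ = solve-∀ ℚ-ring
      e₂ : ∀ d f → (1ℚ - d - d + d) * f ≡ (1ℚ - d) * f
      e₂ = solve-∀ ℚ-ring

    -- The values outside y number m - |y| only if y has no repetition, hence the factor `inj y` on
    -- both sides. Adding g to y takes away exactly one value, because g was fresh for y.
    ∑-fresh : ∀ y → inj y * ∑ (allFin m) (λ h → fresh h y) ≡ inj y * (ι m - ι (length y))
    ∑-fresh [] = cong (1ℚ *_) (trans (∑-const m 1ℚ) (e (ι m)))
      where
      e : ∀ k → k * 1ℚ ≡ k - 0ℚ
      e = solve-∀ ℚ-ring
    ∑-fresh (g ∷ y) = begin
      f * i * ∑ (allFin m) (λ h → (1ℚ - δ g h) * fresh h y)
        ≡⟨ cong (f * i *_) (trans (∑-cong (allFin m) (λ h → e₀ (δ g h) (fresh h y))) (∑-+ (λ h → fresh h y) (λ h → - 1ℚ * (δ g h * fresh h y)) (allFin m))) ⟩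
      f * i * (s + ∑ (allFin m) (λ h → - 1ℚ * (δ g h * fresh h y)))
        ≡⟨ cong (λ z → f * i * (s + z)) (trans (∑-*ˡ (- 1ℚ) _ (allFin m)) (cong (- 1ℚ *_) (∑-δ-* (λ h → fresh h y) g))) ⟩
      f * i * (s + - 1ℚ * f)                  ≡⟨ e₁ f i s ⟩
      f * (i * s) - f * f * i                 ≡⟨ cong₂ (λ a b → f * a - b * i) (∑-fresh y) (fresh-idem g y) ⟩
      f * (i * (ι m - ι (length y))) - f * i  ≡⟨ e₂ f i (ι m) (ι (length y)) ⟩
      f * i * (ι m - (1ℚ + ι (length y)))     ∎
      where
      open ≡-Reasoning
      f = fresh g y
      i = inj y
      s = ∑ (allFin m) (λ h → fresh h y)
      e₀ : ∀ d f → (1ℚ - d) * f ≡ f + - 1ℚ * (d * f)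
      e₀ = solve-∀ ℚ-ring
      e₁ : ∀ f i s → f * i * (s + - 1ℚ * f) ≡ f * (i * s) - f * f * i
      e₁ = solve-∀ ℚ-ring
      e₂ : ∀ f i k l → f * (i * (k - l)) - f * i ≡ f * i * (k - (1ℚ + l))
      e₂ = solve-∀ ℚ-ring

    fresh-lookup : ∀ {k} (x : Vec (Fin m) k) i → fresh (lookup x i) (toList x) ≡ 0ℚ
    fresh-lookup (g ∷ x) zero    = trans (cong (λ d → (1ℚ - d) * fresh g (toList x)) (δ-refl g)) (ℚ.*-zeroˡ (fresh g (toList x)))
    fresh-lookup (g ∷ x) (suc i) = trans (cong ((1ℚ - δ g (lookup x i)) *_) (fresh-lookup x i)) (ℚ.*-zeroʳ (1ℚ - δ g (lookup x i)))

    inj-collision : ∀ {k} (x : Vec (Fin m) k) {i j} → i ≢ j → lookup x i ≡ lookup x j → inj (toList x) ≡ 0ℚ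
    inj-collision (g ∷ x) {zero}  {zero}  i≢j eq = contradiction refl i≢j
    inj-collision (g ∷ x) {zero}  {suc j} i≢j eq = trans
      (cong (_* inj (toList x)) (trans (cong (λ h → fresh h (toList x)) eq) (fresh-lookup x j))) (ℚ.*-zeroˡ (inj (toList x)))
    inj-collision (g ∷ x) {suc i} {zero}  i≢j eq = trans
      (cong (_* inj (toList x)) (trans (cong (λ h → fresh h (toList x)) (sym eq)) (fresh-lookup x i))) (ℚ.*-zeroˡ (inj (toList x)))
    inj-collision (g ∷ x) {suc i} {suc j} i≢j eq = trans
      (cong (fresh g (toList x) *_) (inj-collision x (λ i≡j → i≢j (cong suc i≡j)) eq)) (ℚ.*-zeroʳ (fresh g (toList x)))

    select : ∀ {k} → Vec Bool k → Vec (Fin m) k → List (Fin m)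
    select []          []      = []
    select (true ∷ S)  (h ∷ x) = h ∷ select S x
    select (false ∷ S) (h ∷ x) = select S x

    length-select : ∀ {k} (S : Vec Bool k) x → length (select S x) ℕ.+ removed S ≡ k
    length-select []          []      = refl
    length-select (true ∷ S)  (h ∷ x) = cong suc (length-select S x)
    length-select (false ∷ S) (h ∷ x) = trans (ℕ.+-suc (length (select S x)) (removed S)) (cong suc (length-select S x))

    fresh-select : ∀ {k} h (S : Vec Bool k) x → fresh h (toList x) * fresh h (select S x) ≡ fresh h (toList x)
    fresh-select h []          []      = refl
    fresh-select h (true ∷ S)  (g ∷ x) = trans (e d (fresh h (toList x)) (fresh h (select S x)))
      (cong₂ _*_ (idem (δ-idem g h)) (fresh-select h S x))
      where
      d = δ g h
      e : ∀ d a b → (1ℚ - d) * a * ((1ℚ - d) * b) ≡ (1ℚ - d - d + d * d) * (a * b)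
      e = solve-∀ ℚ-ring
      e′ : ∀ d → 1ℚ - d - d + d ≡ 1ℚ - d
      e′ = solve-∀ ℚ-ring
      idem : d * d ≡ d → 1ℚ - d - d + d * d ≡ 1ℚ - d
      idem eq = trans (cong (1ℚ - d - d +_) eq) (e′ d)
    fresh-select h (false ∷ S) (g ∷ x) = trans (ℚ.*-assoc (1ℚ - δ g h) (fresh h (toList x)) (fresh h (select S x)))
      (cong ((1ℚ - δ g h) *_) (fresh-select h S x))

    -- Injectivity passes to subsets; the implication between indicators is written as absorption of
    -- a factor.
    inj-select : ∀ {k} (S : Vec Bool k) x → inj (toList x) * inj (select S x) ≡ inj (toList x)
    inj-select []          []      = refl
    inj-select (true ∷ S)  (h ∷ x) = trans (e (fresh h (toList x)) (inj (toList x)) (fresh h (select S x)) (inj (select S x)))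
      (cong₂ _*_ (fresh-select h S x) (inj-select S x))
      where
      e : ∀ a b c d → a * b * (c * d) ≡ a * c * (b * d)
      e = solve-∀ ℚ-ring
    inj-select (false ∷ S) (h ∷ x) = trans (ℚ.*-assoc (fresh h (toList x)) (inj (toList x)) (inj (select S x)))
      (cong (fresh h (toList x) *_) (inj-select S x))

    -- Inserting a pigeon at position i puts its value inside the selected list, whereas subset sums
    -- peel off the front. Symmetry in the list bridges the difference.
    Respects-↭ : (List (Fin m) → ℕ → ℚ) → Set
    Respects-↭ F = ∀ {y z} t → y ↭ z → F y t ≡ F z t

    ∑⊆ : ∀ {k} → Vec (Fin m) k → (List (Fin m) → ℕ → ℚ) → ℚ
    ∑⊆ {k} x F = ∑ (masks k) (λ S → F (select S x) (removed S))

    ∑⊆-∷ : ∀ {k} h (x : Vec (Fin m) k) F → ∑⊆ (h ∷ x) F ≡ ∑⊆ x (λ y t → F (h ∷ y) t) + ∑⊆ x (λ y t → F y (suc t))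
    ∑⊆-∷ h x F = ∑-masks (λ S → F (select S (h ∷ x)) (removed S))

    ∑⊆-+ : ∀ {k} (x : Vec (Fin m) k) F G → ∑⊆ x (λ y t → F y t + G y t) ≡ ∑⊆ x F + ∑⊆ x G
    ∑⊆-+ {k} x F G = ∑-+ (λ S → F (select S x) (removed S)) (λ S → G (select S x) (removed S)) (masks k)

    -- Each subset of the old pigeons comes once with the new pigeon and once without it, in which
    -- case one more pigeon is removed.
    ∑⊆-insertAt : ∀ {k} (x : Vec (Fin m) k) i h F → Respects-↭ F →
                  ∑⊆ (insertAt x i h) F ≡ ∑⊆ x (λ y t → F (h ∷ y) t + F y (suc t))
    ∑⊆-insertAt x       zero    h F resp = trans (∑⊆-∷ h x F) (sym (∑⊆-+ x (λ y t → F (h ∷ y) t) (λ y t → F y (suc t))))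
    ∑⊆-insertAt {suc k} (g ∷ x) (suc i) h F resp = begin
      ∑⊆ (g ∷ insertAt x i h) F
        ≡⟨ ∑⊆-∷ g (insertAt x i h) F ⟩
      ∑⊆ (insertAt x i h) (λ y t → F (g ∷ y) t) + ∑⊆ (insertAt x i h) (λ y t → F y (suc t))
        ≡⟨ cong₂ _+_ (∑⊆-insertAt x i h (λ y t → F (g ∷ y) t) (λ t p → resp t (prep g p)))
                     (∑⊆-insertAt x i h (λ y t → F y (suc t)) (λ t p → resp (suc t) p)) ⟩
      ∑⊆ x (λ y t → F (g ∷ h ∷ y) t + F (g ∷ y) (suc t)) + ∑⊆ x (λ y t → F (h ∷ y) (suc t) + F y (suc (suc t)))
        ≡⟨ cong (_+ ∑⊆ x (λ y t → F (h ∷ y) (suc t) + F y (suc (suc t))))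
                (∑-cong (masks k) (λ S → cong (_+ F (g ∷ select S x) (suc (removed S))) (resp (removed S) (swap g h ↭-refl)))) ⟩
      ∑⊆ x (λ y t → F (h ∷ g ∷ y) t + F (g ∷ y) (suc t)) + ∑⊆ x (λ y t → F (h ∷ y) (suc t) + F y (suc (suc t)))
        ≡⟨ sym (∑⊆-∷ g x (λ y t → F (h ∷ y) t + F y (suc t))) ⟩
      ∑⊆ (g ∷ x) (λ y t → F (h ∷ y) t + F y (suc t)) ∎
      where open ≡-Reasoning

    ∑⊆-full : ∀ {k} (x : Vec (Fin m) k) F → (∀ y t → F y (suc t) ≡ 0ℚ) → ∑⊆ x F ≡ F (toList x) 0
    ∑⊆-full []      F h = ℚ.+-identityʳ (F [] 0)
    ∑⊆-full {suc k} (g ∷ x) F h = trans (∑⊆-∷ g x F)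
      (trans (cong₂ _+_ (∑⊆-full x (λ y t → F (g ∷ y) t) (λ y t → h (g ∷ y) t))
                          (∑-zero (masks k) (λ S → h (select S x) (removed S))))
               (ℚ.+-identityʳ (F (g ∷ toList x) 0)))

    -- Sums over all maps from pigeons to holes

    vectors : ∀ k → List (Vec (Fin m) k)
    vectors zero    = [] ∷ []
    vectors (suc k) = cartesianProductWith _∷_ (allFin m) (vectors k)

    ∑-insertAt : ∀ {k} (i : Fin (suc k)) F →
                 ∑ (vectors (suc k)) F ≡ ∑ (vectors k) (λ x → ∑ (allFin m) (λ h → F (insertAt x i h)))
    ∑-insertAt {k} zero F = trans (∑-cartesian _∷_ F (allFin m) (vectors k))
      (∑-swap (λ h x → F (h ∷ x)) (allFin m) (vectors k))
    ∑-insertAt {suc k} (suc i) F = begin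
      ∑ (vectors (suc (suc k))) F
        ≡⟨ ∑-cartesian _∷_ F (allFin m) (vectors (suc k)) ⟩
      ∑ (allFin m) (λ g → ∑ (vectors (suc k)) (λ x → F (g ∷ x)))
        ≡⟨ ∑-cong (allFin m) (λ g → ∑-insertAt i (λ x → F (g ∷ x))) ⟩
      ∑ (allFin m) (λ g → ∑ (vectors k) (λ x → ∑ (allFin m) (λ h → F (g ∷ insertAt x i h))))
        ≡⟨ sym (∑-cartesian _∷_ (λ x → ∑ (allFin m) (λ h → F (insertAt x (suc i) h))) (allFin m) (vectors k)) ⟩
      ∑ (vectors (suc k)) (λ x → ∑ (allFin m) (λ h → F (insertAt x (suc i) h))) ∎
      where open ≡-Reasoning

    -- Counts the injections [k] → [m], of which there are m!/(m - k)!, with j = m - k in place of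
    -- the division: an injection of k pigeons extends by one pigeon in m - k ways.
    ∑-inj : ∀ k j → k ℕ.+ j ≡ m → ∑ (vectors k) (λ x → inj (toList x)) * ι (j !) ≡ ι (m !)
    ∑-inj zero j refl = e (ι (j !))
      where
      e : ∀ a → (1ℚ + 0ℚ) * a ≡ a
      e = solve-∀ ℚ-ring
    ∑-inj (suc k) j k+j≡m = begin
      ∑ (vectors (suc k)) (λ x → inj (toList x)) * ι (j !)
        ≡⟨ cong (_* ι (j !)) (∑-insertAt zero (λ x → inj (toList x))) ⟩
      ∑ (vectors k) (λ x → ∑ (allFin m) (λ h → fresh h (toList x) * inj (toList x))) * ι (j !)
        ≡⟨ cong (_* ι (j !)) (∑-cong (vectors k) step) ⟩
      ∑ (vectors k) (λ x → inj (toList x) * ι (suc j)) * ι (j !)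
        ≡⟨ cong (_* ι (j !)) (∑-*ʳ (ι (suc j)) (λ x → inj (toList x)) (vectors k)) ⟩
      ∑ (vectors k) (λ x → inj (toList x)) * ι (suc j) * ι (j !)
        ≡⟨ trans (ℚ.*-assoc (∑ (vectors k) (λ x → inj (toList x))) (ι (suc j)) (ι (j !))) (cong (∑ (vectors k) (λ x → inj (toList x)) *_) (sym (ι-* (suc j) (j !)))) ⟩
      ∑ (vectors k) (λ x → inj (toList x)) * ι (suc j !)
        ≡⟨ ∑-inj k (suc j) (trans (ℕ.+-suc k j) k+j≡m) ⟩
      ι (m !) ∎
      where
      open ≡-Reasoning
      length-toList : ∀ {k} (x : Vec (Fin m) k) → length (toList x) ≡ k
      length-toList []      = refl
      length-toList (_ ∷ x) = cong suc (length-toList x)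
      e : ∀ j k → k + j - k ≡ j
      e = solve-∀ ℚ-ring
      step : ∀ x → ∑ (allFin m) (λ h → fresh h (toList x) * inj (toList x)) ≡ inj (toList x) * ι (suc j)
      step x = trans (∑-*ʳ (inj (toList x)) (λ h → fresh h (toList x)) (allFin m))
        (trans (ℚ.*-comm _ (inj (toList x))) (trans (∑-fresh (toList x)) (cong (inj (toList x) *_)
          (trans (cong₂ (λ a b → a - ι b) (trans (cong ι (sym (trans (ℕ.+-suc k j) k+j≡m))) (ι-+ k (suc j))) (length-toList x))
            (e (ι (suc j)) (ι k))))))

  -- The dual functional

  removed-witness : ∀ {k} (S : Vec Bool k) → removed S ≡ 0 ⊎ ∃ λ i → lookup S i ≡ false
  removed-witness []          = inj₁ refl
  removed-witness (false ∷ S) = inj₂ (zero , refl)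
  removed-witness (true ∷ S) with removed-witness S
  ... | inj₁ eq       = inj₁ eq
  ... | inj₂ (i , eq) = inj₂ (suc i , eq)

  select-insertAt : ∀ {m k} (S : Vec Bool (suc k)) i → lookup S i ≡ false →
                    ∀ (x : Vec (Fin m) k) h → select S (insertAt x i h) ≡ select (removeAt S i) x
  select-insertAt (false ∷ S)     zero    eq x       h = refl
  select-insertAt (true ∷ b ∷ S)  (suc i) eq (g ∷ x) h = cong (g ∷_) (select-insertAt (b ∷ S) i eq x h)
  select-insertAt (false ∷ b ∷ S) (suc i) eq (g ∷ x) h = select-insertAt (b ∷ S) i eq x h

  module Functional (m : ℕ) (μ : ℚ) (mμ≡1 : ι m * μ ≡ 1ℚ) where

    -- Explicitly w(t) = (-1)^(t-1) (t-1)!/m^(t-1) for t ≥ 1, with μ = 1/m. The value w(0) = 0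
    -- belongs to the full set of n pigeons, on which no map is injective.
    w : ℕ → ℚ
    w zero          = 0ℚ
    w (suc zero)    = 1ℚ
    w (suc (suc t)) = - (ι (suc t) * μ * w (suc t))

    w-step : ∀ t → ι (suc t) * w (suc t) + ι m * w (suc (suc t)) ≡ 0ℚ
    w-step t = trans (e (ι m) μ (ι (suc t)) (w (suc t)))
      (trans (cong (λ z → (1ℚ - z) * (ι (suc t) * w (suc t))) mμ≡1) (ℚ.*-zeroˡ (ι (suc t) * w (suc t))))
      where
      e : ∀ m μ t w → t * w + m * - (t * μ * w) ≡ (1ℚ - m * μ) * (t * w)
      e = solve-∀ ℚ-ring

    -- By Pascal's rule the increments of `binomialSum k w` in k. Explicitly E k is the alternating
    -- sum of C(k, t) t!/m^t, so its size is not visible term by term.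
    E : ℕ → ℚ
    E k = binomialSum k (λ t → w (suc t))

    -- `w-step` turns m w(t + 2) into - (t + 1) w(t + 1), and absorption turns t C(k + 1, t) into (k
    -- + 1) C(k, t - 1). The result has nonnegative coefficients as long as k + 2 ≤ m, so the
    -- alternating sum can be bounded by induction.
    E-step : ∀ k → ι m * E (suc (suc k)) ≡ (ι m - ι (suc (suc k))) * E (suc k) + ι (suc k) * E k
    E-step k = begin
      ι m * E (suc (suc k))
        ≡⟨ cong (ι m *_) (binomialSum-suc (suc k) (λ t → w (suc t))) ⟩
      ι m * (E (suc k) + E′ (suc k))
        ≡⟨ ℚ.*-distribˡ-+ (ι m) (E (suc k)) (E′ (suc k)) ⟩
      ι m * E (suc k) + ι m * E′ (suc k)
        ≡⟨ cong (ι m * E (suc k) +_) tail ⟩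
      ι m * E (suc k) - (E (suc k) + ι (suc k) * E′ k)
        ≡⟨ cong (λ z → ι m * E (suc k) - (E (suc k) + ι (suc k) * z)) E′≡ ⟩
      ι m * E (suc k) - (E (suc k) + ι (suc k) * (E (suc k) - E k))
        ≡⟨ e₁ (ι m) (ι (suc k)) (E (suc k)) (E k) ⟩
      (ι m - ι (suc (suc k))) * E (suc k) + ι (suc k) * E k ∎
      where
      open ≡-Reasoning
      E′ : ℕ → ℚ
      E′ k = binomialSum k (λ t → w (suc (suc t)))
      e₁ : ∀ m k a b → m * a - (a + k * (a - b)) ≡ (m - (1ℚ + k)) * a + k * b
      e₁ = solve-∀ ℚ-ring
      e₂ : ∀ a b → b ≡ a + b - a
      e₂ = solve-∀ ℚ-ring
      E′≡ : E′ k ≡ E (suc k) - E k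
      E′≡ = trans (e₂ (E k) (E′ k)) (cong (_- E k) (sym (binomialSum-suc k (λ t → w (suc t)))))
      e₃ : ∀ p q t → t * p + q ≡ 0ℚ → q ≡ - t * p
      e₃ p q t h = trans (e₄ p q t) (trans (cong (- t * p +_) h) (ℚ.+-identityʳ _))
        where
        e₄ : ∀ p q t → q ≡ - t * p + (t * p + q)
        e₄ = solve-∀ ℚ-ring
      e₅ : ∀ t p → - (1ℚ + t) * p ≡ - 1ℚ * (p + t * p)
      e₅ = solve-∀ ℚ-ring
      e₆ : ∀ a → - 1ℚ * a ≡ - a
      e₆ = solve-∀ ℚ-ring
      tail : ι m * E′ (suc k) ≡ - (E (suc k) + ι (suc k) * E′ k)
      tail = begin
        ι m * E′ (suc k)
          ≡⟨ sym (∑-*ˡ (ι m) (λ S → w (suc (suc (removed S)))) (masks (suc k))) ⟩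
        binomialSum (suc k) (λ t → ι m * w (suc (suc t)))
          ≡⟨ ∑-cong (masks (suc k)) (λ S → let t = removed S in
               trans (e₃ (w (suc t)) (ι m * w (suc (suc t))) (ι (suc t)) (w-step t)) (e₅ (ι t) (w (suc t)))) ⟩
        binomialSum (suc k) (λ t → - 1ℚ * (w (suc t) + ι t * w (suc t)))
          ≡⟨ ∑-*ˡ (- 1ℚ) (λ S → w (suc (removed S)) + ι (removed S) * w (suc (removed S))) (masks (suc k)) ⟩
        - 1ℚ * binomialSum (suc k) (λ t → w (suc t) + ι t * w (suc t))
          ≡⟨ e₆ _ ⟩
        - binomialSum (suc k) (λ t → w (suc t) + ι t * w (suc t))
          ≡⟨ cong -_ (binomialSum-+ (suc k) (λ t → w (suc t)) (λ t → ι t * w (suc t))) ⟩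
        - (E (suc k) + binomialSum (suc k) (λ t → ι t * w (suc t)))
          ≡⟨ cong (λ z → - (E (suc k) + z)) (binomialSum-absorb k (λ t → w (suc t))) ⟩
        - (E (suc k) + ι (suc k) * E′ k) ∎

    0<m : 0ℚ < ι m
    0<m = ι-pos m mμ≡1
      where
      ι-pos : ∀ l → ι l * μ ≡ 1ℚ → 0ℚ < ι l
      ι-pos zero    eq = contradiction (trans (sym (ℚ.*-zeroˡ μ)) eq) (λ ())
      ι-pos (suc l) _  = 0<ι l

    -- By E-step, m E (k + 2) is a combination of E (k + 1) and E k with
    -- nonnegative weights of sum m - 1.
    E-bounds : ∀ k → suc k ℕ.≤ m → (0ℚ ≤ E k × E k ≤ 1ℚ) × (0ℚ ≤ E (suc k) × E (suc k) ≤ 1ℚ)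
    E-bounds zero 1≤m = (0≤1 , ℚ.≤-refl) , 0≤E₁ , E₁≤1
      where
      E₁≡ : ι m * E 1 ≡ ι m - 1ℚ
      E₁≡ = trans (e (ι m) μ) (cong (λ z → ι m - z) mμ≡1)
        where
        e : ∀ m μ → m * (1ℚ + (- ((1ℚ + 0ℚ) * μ * 1ℚ) + 0ℚ)) ≡ m - m * μ
        e = solve-∀ ℚ-ring
      e₁ : ∀ a → a + 1ℚ - 1ℚ ≡ a
      e₁ = solve-∀ ℚ-ring
      e₂ : ∀ a → a * 1ℚ - (a - 1ℚ) ≡ 1ℚ
      e₂ = solve-∀ ℚ-ring
      e₃ : ∀ a → 1ℚ + a - 1ℚ ≡ a
      e₃ = solve-∀ ℚ-ring
      1≤ιm : 0ℚ ≤ ι m - 1ℚ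
      1≤ιm = subst (λ z → 0ℚ ≤ ι z - 1ℚ) (ℕ.m+[n∸m]≡n 1≤m) (subst (0ℚ ≤_) (sym (e₃ (ι (m ℕ.∸ 1)))) (0≤ι (m ℕ.∸ 1)))
      0≤E₁ : 0ℚ ≤ E 1
      0≤E₁ = ≤-cancelˡ (ι m) 0<m (subst₂ _≤_ (sym (ℚ.*-zeroʳ (ι m))) (sym E₁≡) 1≤ιm)
      E₁≤1 : E 1 ≤ 1ℚ
      E₁≤1 = ≤-cancelˡ (ι m) 0<m (0≤q-p⇒p≤q (subst (λ z → 0ℚ ≤ ι m * 1ℚ - z) (sym E₁≡) (subst (0ℚ ≤_) (sym (e₂ (ι m))) 0≤1)))
    E-bounds (suc k) 2+k≤m with E-bounds k (ℕ.≤-trans (ℕ.n≤1+n (suc k)) 2+k≤m)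
    ... | (0≤a , a≤1) , 0≤b , b≤1 = (0≤b , b≤1) , 0≤c , c≤1
      where
      open ℚ.≤-Reasoning
      d = m ℕ.∸ suc (suc k)
      m-k : ι m - ι (suc (suc k)) ≡ ι d
      m-k = trans (cong (λ z → ι z - ι (suc (suc k))) (sym (ℕ.m+[n∸m]≡n 2+k≤m)))
        (trans (cong (_- ι (suc (suc k))) (ι-+ (suc (suc k)) d)) (e (ι (suc (suc k))) (ι d)))
        where
        e : ∀ a b → a + b - a ≡ b
        e = solve-∀ ℚ-ring
      m≡ : ι m ≡ ι d + ι (suc (suc k))
      m≡ = trans (e (ι m) (ι (suc (suc k)))) (cong (_+ ι (suc (suc k))) m-k)
        where
        e : ∀ a b → a ≡ a - b + b
        e = solve-∀ ℚ-ring
      step : ι m * E (suc (suc k)) ≡ ι d * E (suc k) + ι (suc k) * E k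
      step = trans (E-step k) (cong (λ z → z * E (suc k) + ι (suc k) * E k) m-k)
      0≤c : 0ℚ ≤ E (suc (suc k))
      0≤c = ≤-cancelˡ (ι m) 0<m (subst₂ _≤_ (sym (ℚ.*-zeroʳ (ι m))) (sym step)
        (0≤-+ (0≤-* (0≤ι d) 0≤b) (0≤-* (0≤ι (suc k)) 0≤a)))
      c≤1 : E (suc (suc k)) ≤ 1ℚ
      c≤1 = ≤-cancelˡ (ι m) 0<m (begin
        ι m * E (suc (suc k))                  ≡⟨ step ⟩
        ι d * E (suc k) + ι (suc k) * E k      ≤⟨ ℚ.+-mono-≤ (≤-mulˡ (ι d) (0≤ι d) b≤1) (≤-mulˡ (ι (suc k)) (0≤ι (suc k)) a≤1) ⟩
        ι d * 1ℚ + ι (suc k) * 1ℚ              ≤⟨ ≤-+ʳ (ι d * 1ℚ + ι (suc k) * 1ℚ) 0≤1 ⟩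
        ι d * 1ℚ + ι (suc k) * 1ℚ + 1ℚ         ≡⟨ e (ι d) (ι (suc k)) ⟩
        (ι d + ι (suc (suc k))) * 1ℚ           ≡⟨ cong (_* 1ℚ) (sym m≡) ⟩
        ι m * 1ℚ                               ∎)
        where
        e : ∀ d k → d * 1ℚ + k * 1ℚ + 1ℚ ≡ (d + (1ℚ + k)) * 1ℚ
        e = solve-∀ ℚ-ring

    E≤1 : ∀ k → k ℕ.≤ m → E k ≤ 1ℚ
    E≤1 zero    _     = ℚ.≤-refl
    E≤1 (suc k) 1+k≤m = proj₂ (proj₂ (E-bounds k 1+k≤m))

    -- Starts at w(0) = 0 and adds E k ≤ 1 in each step. The range k ≤ m of `E≤1` reaches exactly
    -- the n = m + 1 pigeons.
    binomialSum-w : ∀ k → k ℕ.≤ suc m → binomialSum k w ≤ ι k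
    binomialSum-w zero    _           = ℚ.≤-refl
    binomialSum-w (suc k) (ℕ.s≤s k≤m) = begin
      binomialSum (suc k) w      ≡⟨ binomialSum-suc k w ⟩
      binomialSum k w + E k      ≤⟨ ℚ.+-mono-≤ (binomialSum-w k (ℕ.m≤n⇒m≤1+n k≤m)) (E≤1 k k≤m) ⟩
      ι k + 1ℚ                   ≡⟨ ℚ.+-comm (ι k) 1ℚ ⟩
      ι (suc k)                  ∎
      where open ℚ.≤-Reasoning

    D : Vec (Fin m) (suc m) → ℚ
    D x = ∑⊆ x (λ y t → w t * inj y)

    -- Let S remove t of the other m pigeons. If the new pigeon joins S, an injective list of m - t
    -- values extends in t ways; if not, its m values are free. So S receives t w(t) + m w(t + 1),
    -- which is 0 for t ≥ 1 and m for t = 0: only injectivity of all of x survives.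
    marginal : ∀ x i → ∑ (allFin m) (λ h → D (insertAt x i h)) ≡ ι m * inj (toList x)
    marginal x i = begin
      ∑ (allFin m) (λ h → D (insertAt x i h))
        ≡⟨ ∑-cong (allFin m) (λ h → ∑⊆-insertAt x i h (λ y t → w t * inj y) (λ t p → cong (w t *_) (inj-↭ p))) ⟩
      ∑ (allFin m) (λ h → ∑⊆ x (λ y t → w t * (fresh h y * inj y) + w (suc t) * inj y))
        ≡⟨ ∑-swap (λ h S → let y = select S x ; t = removed S in w t * (fresh h y * inj y) + w (suc t) * inj y) (allFin m) (masks m) ⟩
      ∑⊆ x (λ y t → ∑ (allFin m) (λ h → w t * (fresh h y * inj y) + w (suc t) * inj y))
        ≡⟨ ∑-cong (masks m) (λ S → inner (select S x) (removed S) (length-select S x)) ⟩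
      ∑⊆ x (λ y t → (ι t * w t + ι m * w (suc t)) * inj y)
        ≡⟨ ∑⊆-full x (λ y t → (ι t * w t + ι m * w (suc t)) * inj y)
             (λ y t → trans (cong (_* inj y) (w-step t)) (ℚ.*-zeroˡ (inj y))) ⟩
      (0ℚ * 0ℚ + ι m * 1ℚ) * inj (toList x)
        ≡⟨ e (ι m) (inj (toList x)) ⟩
      ι m * inj (toList x) ∎
      where
      open ≡-Reasoning
      e : ∀ m i → (0ℚ * 0ℚ + m * 1ℚ) * i ≡ m * i
      e = solve-∀ ℚ-ring
      e₁ : ∀ w f i → w * (f * i) ≡ w * i * f
      e₁ = solve-∀ ℚ-ring
      e₂ : ∀ t l → l + t - l ≡ t
      e₂ = solve-∀ ℚ-ring
      e₃ : ∀ t w m w′ i → w * (i * t) + m * (w′ * i) ≡ (t * w + m * w′) * i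
      e₃ = solve-∀ ℚ-ring
      inner : ∀ y t → length y ℕ.+ t ≡ m →
              ∑ (allFin m) (λ h → w t * (fresh h y * inj y) + w (suc t) * inj y) ≡ (ι t * w t + ι m * w (suc t)) * inj y
      inner y t l+t≡m = begin
        ∑ (allFin m) (λ h → w t * (fresh h y * inj y) + w (suc t) * inj y)
          ≡⟨ ∑-+ (λ h → w t * (fresh h y * inj y)) (λ h → w (suc t) * inj y) (allFin m) ⟩
        ∑ (allFin m) (λ h → w t * (fresh h y * inj y)) + ∑ (allFin m) (λ h → w (suc t) * inj y)
          ≡⟨ cong₂ _+_ (trans (∑-cong (allFin m) (λ h → e₁ (w t) (fresh h y) (inj y))) (∑-*ˡ (w t * inj y) (λ h → fresh h y) (allFin m)))
                       (∑-const m (w (suc t) * inj y)) ⟩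
        w t * inj y * ∑ (allFin m) (λ h → fresh h y) + ι m * (w (suc t) * inj y)
          ≡⟨ cong (_+ ι m * (w (suc t) * inj y)) (trans (ℚ.*-assoc (w t) (inj y) _) (cong (w t *_) (∑-fresh y))) ⟩
        w t * (inj y * (ι m - ι (length y))) + ι m * (w (suc t) * inj y)
          ≡⟨ cong (λ z → w t * (inj y * z) + ι m * (w (suc t) * inj y))
               (trans (cong (_- ι (length y)) (trans (cong ι (sym l+t≡m)) (ι-+ (length y) t))) (e₂ (ι t) (ι (length y)))) ⟩
        w t * (inj y * ι t) + ι m * (w (suc t) * inj y)
          ≡⟨ e₃ (ι t) (w t) (ι m) (w (suc t)) (inj y) ⟩
        (ι t * w t + ι m * w (suc t)) * inj y ∎

    -- A function that ignores pigeon i sees D only through its marginal, which is supported on the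
    -- bijections of the other pigeons.
    ∑-D-insertAt : ∀ i (F : Vec (Fin m) m → ℚ) (G : Vec (Fin m) (suc m) → ℚ) → (∀ x h → G (insertAt x i h) ≡ F x) →
                   ∑ (vectors (suc m)) (λ x → D x * G x) ≡ ∑ (vectors m) (λ x → ι m * inj (toList x) * F x)
    ∑-D-insertAt i F G G≡F = trans (∑-insertAt i (λ x → D x * G x))
      (∑-cong (vectors m) (λ x → trans (∑-cong (allFin m) (λ h → cong (D (insertAt x i h) *_) (G≡F x h)))
        (trans (∑-*ʳ (F x) (λ h → D (insertAt x i h)) (allFin m)) (cong (_* F x) (marginal x i)))))

    Z : ℚ
    Z = ∑ (vectors (suc m)) D

    Z≡∑-inj : Z ≡ ∑ (vectors m) (λ x → ι m * inj (toList x) * 1ℚ)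
    Z≡∑-inj = trans (∑-cong (vectors (suc m)) (λ x → sym (ℚ.*-identityʳ (D x))))
      (∑-D-insertAt zero (λ _ → 1ℚ) (λ _ → 1ℚ) (λ _ _ → refl))

    Z≡m*m! : Z ≡ ι m * ι (m !)
    Z≡m*m! = begin
      Z                                                ≡⟨ Z≡∑-inj ⟩
      ∑ (vectors m) (λ x → ι m * inj (toList x) * 1ℚ)  ≡⟨ ∑-*ʳ 1ℚ (λ x → ι m * inj (toList x)) (vectors m) ⟩
      ∑ (vectors m) (λ x → ι m * inj (toList x)) * 1ℚ  ≡⟨ cong (_* 1ℚ) (∑-*ˡ (ι m) (λ x → inj (toList x)) (vectors m)) ⟩
      ι m * ∑ (vectors m) (λ x → inj (toList x)) * 1ℚ  ≡⟨ ℚ.*-assoc (ι m) (∑ (vectors m) (λ x → inj (toList x))) 1ℚ ⟩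
      ι m * (∑ (vectors m) (λ x → inj (toList x)) * 1ℚ) ≡⟨ cong (ι m *_) (∑-inj {m} m 0 (ℕ.+-identityʳ m)) ⟩
      ι m * ι (m !)                                    ∎
      where open ≡-Reasoning

    -- If S misses a pigeon, summing that pigeon out leaves bijections, on which the indicator of S
    -- is 1. If S is full, both sides vanish by w(0) = 0.
    ∑-D-inj : ∀ S → w (removed S) * ∑ (vectors (suc m)) (λ x → D x * inj (select S x)) ≡ w (removed S) * Z
    ∑-D-inj S with removed-witness S
    ... | inj₁ eq       = annihilate eq (∑ (vectors (suc m)) (λ x → D x * inj (select S x))) Z
      where
      annihilate : ∀ {t} → t ≡ 0 → ∀ p q → w t * p ≡ w t * q
      annihilate refl p q = trans (ℚ.*-zeroˡ p) (sym (ℚ.*-zeroˡ q))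
    ... | inj₂ (i , eq) = cong (w (removed S) *_) (trans
      (∑-D-insertAt i (λ x → inj (select (removeAt S i) x)) (λ x → inj (select S x)) (λ x h → cong inj (select-insertAt S i eq x h)))
      (trans (∑-cong (vectors m) (λ x → trans (ℚ.*-assoc (ι m) (inj (toList x)) (inj (select (removeAt S i) x)))
        (trans (cong (ι m *_) (inj-select (removeAt S i) x)) (sym (ℚ.*-identityʳ (ι m * inj (toList x))))))) (sym Z≡∑-inj)))

    -- Only one of the two factors D is expanded; the other integrates each indicator in the
    -- expansion to Z.
    ∑-D² : ∑ (vectors (suc m)) (λ x → D x * D x) ≡ Z * binomialSum (suc m) w
    ∑-D² = begin
      ∑ V (λ x → D x * D x)
        ≡⟨ ∑-cong V (λ x → sym (∑-*ˡ (D x) (λ S → w (removed S) * inj (select S x)) M)) ⟩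
      ∑ V (λ x → ∑ M (λ S → D x * (w (removed S) * inj (select S x))))
        ≡⟨ ∑-swap (λ x S → D x * (w (removed S) * inj (select S x))) V M ⟩
      ∑ M (λ S → ∑ V (λ x → D x * (w (removed S) * inj (select S x))))
        ≡⟨ ∑-cong M (λ S → trans (∑-cong V (λ x → e (D x) (w (removed S)) (inj (select S x))))
                            (trans (∑-*ˡ (w (removed S)) (λ x → D x * inj (select S x)) V)
                            (trans (∑-D-inj S) (ℚ.*-comm (w (removed S)) Z)))) ⟩
      ∑ M (λ S → Z * w (removed S))
        ≡⟨ ∑-*ˡ Z (λ S → w (removed S)) M ⟩
      Z * binomialSum (suc m) w ∎
      where
      open ≡-Reasoning
      V = vectors {m} (suc m)
      M = masks (suc m)
      e : ∀ d w i → d * (w * i) ≡ w * (d * i)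
      e = solve-∀ ℚ-ring

    0<Z : 0ℚ < Z
    0<Z = subst (0ℚ <_) (sym Z≡m*m!) (pos-* 0<m (0<ι! m))

    ∑-D²≤ : ∑ (vectors (suc m)) (λ x → D x * D x) ≤ Z * ι (suc m)
    ∑-D²≤ = subst (_≤ Z * ι (suc m)) (sym ∑-D²) (≤-mulˡ Z (ℚ.<⇒≤ 0<Z) (binomialSum-w (suc m) ℕ.≤-refl))

  -- Cubes

  module _ {m : ℕ} where

    ∏ : ∀ {k} → (Fin k → Fin m → ℚ) → Vec (Fin m) k → ℚ
    ∏ φ []      = 1ℚ
    ∏ φ (h ∷ x) = φ zero h * ∏ (λ i → φ (suc i)) x

    ∏-cong : ∀ {k} {φ ψ : Fin k → Fin m → ℚ} → (∀ i h → φ i h ≡ ψ i h) → ∀ x → ∏ φ x ≡ ∏ ψ x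
    ∏-cong eq []      = refl
    ∏-cong eq (h ∷ x) = cong₂ _*_ (eq zero h) (∏-cong (λ i → eq (suc i)) x)

    ∏-* : ∀ {k} (φ ψ : Fin k → Fin m → ℚ) x → ∏ (λ i h → φ i h * ψ i h) x ≡ ∏ φ x * ∏ ψ x
    ∏-* φ ψ []      = refl
    ∏-* φ ψ (h ∷ x) = trans (cong (φ zero h * ψ zero h *_) (∏-* (λ i → φ (suc i)) (λ i → ψ (suc i)) x))
      (e (φ zero h) (ψ zero h) (∏ (λ i → φ (suc i)) x) (∏ (λ i → ψ (suc i)) x))
      where
      e : ∀ a b c d → a * b * (c * d) ≡ a * c * (b * d)
      e = solve-∀ ℚ-ring

    ∏-one : ∀ {k} (x : Vec (Fin m) k) → ∏ (λ _ _ → 1ℚ) x ≡ 1ℚ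
    ∏-one []      = refl
    ∏-one (_ ∷ x) = trans (ℚ.*-identityˡ _) (∏-one x)

    ∏-zero : ∀ {k} (φ : Fin k → Fin m → ℚ) x i → φ i (lookup x i) ≡ 0ℚ → ∏ φ x ≡ 0ℚ
    ∏-zero φ (h ∷ x) zero    eq = trans (cong (_* ∏ (λ i → φ (suc i)) x) eq) (ℚ.*-zeroˡ (∏ (λ i → φ (suc i)) x))
    ∏-zero φ (h ∷ x) (suc i) eq = trans (cong (φ zero h *_) (∏-zero (λ i → φ (suc i)) x i eq)) (ℚ.*-zeroʳ (φ zero h))

    ∏-insertAt : ∀ {k} (φ : Fin (suc k) → Fin m → ℚ) x i h →
                 ∏ φ (insertAt x i h) ≡ φ i h * ∏ (λ i′ → φ (punchIn i i′)) x
    ∏-insertAt φ x       zero    h = refl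
    ∏-insertAt φ (g ∷ x) (suc i) h = trans (cong (φ zero g *_) (∏-insertAt (λ i → φ (suc i)) x i h))
      (e (φ zero g) (φ (suc i) h) (∏ (λ i′ → φ (suc (punchIn i i′))) x))
      where
      e : ∀ a b c → a * (b * c) ≡ b * (a * c)
      e = solve-∀ ℚ-ring

    only : ∀ {k} → Fin k → (Fin m → ℚ) → Fin k → Fin m → ℚ
    only i g i′ h = if does (i′ Fin.≟ i) then g h else 1ℚ

    ∏-only : ∀ {k} (i : Fin k) g x → ∏ (only i g) x ≡ g (lookup x i)
    ∏-only zero    g (h ∷ x) = trans (cong (g h *_) (∏-one x)) (ℚ.*-identityʳ (g h))
    ∏-only (suc i) g (h ∷ x) = trans (ℚ.*-identityˡ _) (∏-only i g x)

  ∏ᶠ : ∀ {k} → (Fin k → ℚ) → ℚ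
  ∏ᶠ {zero}  κ = 1ℚ
  ∏ᶠ {suc k} κ = κ zero * ∏ᶠ (λ i → κ (suc i))

  ∏ᶠ-nonNeg : ∀ {k} {κ : Fin k → ℚ} → (∀ i → 0ℚ ≤ κ i) → 0ℚ ≤ ∏ᶠ κ
  ∏ᶠ-nonNeg {zero}  0≤κ = 0≤1
  ∏ᶠ-nonNeg {suc k} 0≤κ = 0≤-* (0≤κ zero) (∏ᶠ-nonNeg (λ i → 0≤κ (suc i)))

  ∏ᶠ-mono : ∀ {k} {κ ν : Fin k → ℚ} → (∀ i → 0ℚ ≤ κ i) → (∀ i → κ i ≤ ν i) → ∏ᶠ κ ≤ ∏ᶠ ν
  ∏ᶠ-mono {zero}  0≤κ κ≤ν = ℚ.≤-refl
  ∏ᶠ-mono {suc k} 0≤κ κ≤ν = *-mono-≤ (0≤κ zero) (∏ᶠ-nonNeg (λ i → 0≤κ (suc i))) (κ≤ν zero)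
    (∏ᶠ-mono (λ i → 0≤κ (suc i)) (λ i → κ≤ν (suc i)))

  ∏ᶠ-const : ∀ k q → ∏ᶠ {k} (λ _ → q) ≡ q ^ k
  ∏ᶠ-const zero    q = refl
  ∏ᶠ-const (suc k) q = cong (q *_) (∏ᶠ-const k q)

  except : ∀ {k} → Fin k → ℚ → (Fin k → ℚ) → Fin k → ℚ
  except i c κ i′ = if does (i′ Fin.≟ i) then c else κ i′

  -- Division of the product by `κ i`, in multiplicative form.
  ∏ᶠ-except : ∀ {k} (i : Fin k) κ → ∏ᶠ (except i 1ℚ κ) * κ i ≡ ∏ᶠ κ
  ∏ᶠ-except zero    κ = e (κ zero) (∏ᶠ (λ i → κ (suc i)))
    where
    e : ∀ a b → 1ℚ * b * a ≡ a * b
    e = solve-∀ ℚ-ring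
  ∏ᶠ-except (suc i) κ = trans (ℚ.*-assoc (κ zero) (∏ᶠ (λ i′ → except i 1ℚ (λ i → κ (suc i)) i′)) (κ (suc i)))
    (cong (κ zero *_) (∏ᶠ-except i (λ i → κ (suc i))))

  ∑-∏ : ∀ {m} k (φ : Fin k → Fin m → ℚ) → ∑ (vectors k) (∏ φ) ≡ ∏ᶠ (λ i → ∑ (allFin m) (φ i))
  ∑-∏ zero φ = refl
  ∑-∏ {m} (suc k) φ = begin
    ∑ (vectors (suc k)) (∏ φ)
      ≡⟨ ∑-cartesian _∷_ (∏ φ) (allFin m) (vectors k) ⟩
    ∑ (allFin m) (λ h → ∑ (vectors k) (λ x → φ zero h * ∏ (λ i → φ (suc i)) x))
      ≡⟨ ∑-cong (allFin m) (λ h → ∑-*ˡ (φ zero h) (∏ (λ i → φ (suc i))) (vectors k)) ⟩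
    ∑ (allFin m) (λ h → φ zero h * ∑ (vectors k) (∏ (λ i → φ (suc i))))
      ≡⟨ ∑-*ʳ _ (φ zero) (allFin m) ⟩
    ∑ (allFin m) (φ zero) * ∑ (vectors k) (∏ (λ i → φ (suc i)))
      ≡⟨ cong (∑ (allFin m) (φ zero) *_) (∑-∏ k (λ i → φ (suc i))) ⟩
    ∏ᶠ (λ i → ∑ (allFin m) (φ i)) ∎
    where open ≡-Reasoning

  -- How 0/1-valued factors are recognised: the equation is stable under products, implies q ≤ 1 and
  -- makes (q - ½)² constant.
  Idempotent : ℚ → Set
  Idempotent q = q * q ≡ q

  idem-* : ∀ p q → Idempotent p → Idempotent q → Idempotent (p * q)
  idem-* p q p² q² = trans (e p q) (cong₂ _*_ p² q²)
    where
    e : ∀ p q → p * q * (p * q) ≡ p * p * (q * q)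
    e = solve-∀ ℚ-ring

  idem-≤1 : ∀ {q} → Idempotent q → q ≤ 1ℚ
  idem-≤1 {q} q² = 0≤q-p⇒p≤q (subst (0ℚ ≤_) (trans (e₁ q) (trans (cong (1ℚ - q - q +_) q²) (e₂ q))) (0≤-² (1ℚ - q)))
    where
    e₁ : ∀ q → (1ℚ - q) * (1ℚ - q) ≡ 1ℚ - q - q + q * q
    e₁ = solve-∀ ℚ-ring
    e₂ : ∀ q → 1ℚ - q - q + q ≡ 1ℚ - q
    e₂ = solve-∀ ℚ-ring

  -- Shifting the factors of a cube, and the bound for one cube

  module CubeBound (m : ℕ) (μ : ℚ) (mμ≡1 : ι m * μ ≡ 1ℚ) where

    open Functional m μ mμ≡1

    n = suc m

    L : (Vec (Fin m) n → ℚ) → ℚ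
    L G = ∑ (vectors n) (λ x → D x * G x)

    shift : (Fin n → Fin m → ℚ) → (Fin n → ℚ) → Fin n → Fin m → ℚ
    shift φ θ i h = φ i h - θ i

    module _ {i₁ i₂ : Fin n} (i₁≢i₂ : i₁ ≢ i₂) (j : Fin m) (φ : Fin n → Fin m → ℚ)
             (φ₁ : ∀ {h} → j ≢ h → φ i₁ h ≡ 0ℚ) (φ₂ : ∀ {h} → j ≢ h → φ i₂ h ≡ 0ℚ) where

      private
        rest : Fin n → (Fin n → ℚ) → Vec (Fin m) m → ℚ
        rest i θ = ∏ (λ i′ → shift φ θ (punchIn i i′))

      -- With i removed, i₁ and i₂ are still present. Either one of them avoids hole j and its
      -- unshifted factor vanishes, or both lie in hole j and x is not injective.
      rest-collision : ∀ i θ → i ≢ i₁ → i ≢ i₂ → θ i₁ ≡ 0ℚ → θ i₂ ≡ 0ℚ →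
                       ∀ x → inj (toList x) * rest i θ x ≡ 0ℚ
      rest-collision i θ i≢i₁ i≢i₂ θ₁ θ₂ x with j Fin.≟ lookup x k₁ | j Fin.≟ lookup x k₂
        where
        k₁ = Fin.punchOut i≢i₁
        k₂ = Fin.punchOut i≢i₂
      ... | yes e₁ | yes e₂ = trans (cong (_* rest i θ x) (inj-collision x
              (λ eq → i₁≢i₂ (Fin.punchOut-injective i≢i₁ i≢i₂ eq)) (trans (sym e₁) e₂))) (ℚ.*-zeroˡ (rest i θ x))
      ... | no ne | _ = trans (cong (inj (toList x) *_) (∏-zero (λ i′ → shift φ θ (punchIn i i′)) x k₁ z)) (ℚ.*-zeroʳ (inj (toList x)))
        where
        k₁ = Fin.punchOut i≢i₁
        z : shift φ θ (punchIn i k₁) (lookup x k₁) ≡ 0ℚ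
        z = trans (cong (λ i′ → shift φ θ i′ (lookup x k₁)) (Fin.punchIn-punchOut i≢i₁)) (cong₂ _-_ (φ₁ ne) θ₁)
      ... | yes _ | no ne = trans (cong (inj (toList x) *_) (∏-zero (λ i′ → shift φ θ (punchIn i i′)) x k₂ z)) (ℚ.*-zeroʳ (inj (toList x)))
        where
        k₂ = Fin.punchOut i≢i₂
        z : shift φ θ (punchIn i k₂) (lookup x k₂) ≡ 0ℚ
        z = trans (cong (λ i′ → shift φ θ i′ (lookup x k₂)) (Fin.punchIn-punchOut i≢i₂)) (cong₂ _-_ (φ₂ ne) θ₂)

      -- Summing out coordinate i forces the other pigeons into distinct holes,
      -- so a factor constant in x i meets the collision of i₁ and i₂ and dies.
      L-drop : ∀ i θ → i ≢ i₁ → i ≢ i₂ → θ i₁ ≡ 0ℚ → θ i₂ ≡ 0ℚ →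
               L (∏ (shift φ θ)) ≡ ∑ (vectors m) (λ x → ∑ (allFin m) (λ h → D (insertAt x i h) * φ i h) * rest i θ x)
      L-drop i θ i≢i₁ i≢i₂ θ₁ θ₂ = trans (∑-insertAt i (λ x → D x * ∏ (shift φ θ) x)) (∑-cong (vectors m) inner)
        where
        open ≡-Reasoning
        e₁ : ∀ d f t r → d * ((f - t) * r) ≡ d * f * r + d * (- t * r)
        e₁ = solve-∀ ℚ-ring
        e₂ : ∀ m i t r → m * i * (- t * r) ≡ - (m * t) * (i * r)
        e₂ = solve-∀ ℚ-ring
        inner : ∀ x → ∑ (allFin m) (λ h → D (insertAt x i h) * ∏ (shift φ θ) (insertAt x i h))
                    ≡ ∑ (allFin m) (λ h → D (insertAt x i h) * φ i h) * rest i θ x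
        inner x = begin
          ∑ (allFin m) (λ h → D (insertAt x i h) * ∏ (shift φ θ) (insertAt x i h))
            ≡⟨ ∑-cong (allFin m) (λ h → trans (cong (D (insertAt x i h) *_) (∏-insertAt (shift φ θ) x i h))
                                                (e₁ (D (insertAt x i h)) (φ i h) (θ i) r)) ⟩
          ∑ (allFin m) (λ h → D (insertAt x i h) * φ i h * r + D (insertAt x i h) * (- θ i * r))
            ≡⟨ ∑-+ (λ h → D (insertAt x i h) * φ i h * r) (λ h → D (insertAt x i h) * (- θ i * r)) (allFin m) ⟩
          ∑ (allFin m) (λ h → D (insertAt x i h) * φ i h * r) + ∑ (allFin m) (λ h → D (insertAt x i h) * (- θ i * r))
            ≡⟨ cong₂ _+_ (∑-*ʳ r (λ h → D (insertAt x i h) * φ i h) (allFin m)) vanish ⟩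
          ∑ (allFin m) (λ h → D (insertAt x i h) * φ i h) * r + 0ℚ
            ≡⟨ ℚ.+-identityʳ _ ⟩
          ∑ (allFin m) (λ h → D (insertAt x i h) * φ i h) * r ∎
          where
          r = rest i θ x
          vanish : ∑ (allFin m) (λ h → D (insertAt x i h) * (- θ i * r)) ≡ 0ℚ
          vanish = begin
            ∑ (allFin m) (λ h → D (insertAt x i h) * (- θ i * r))  ≡⟨ ∑-*ʳ (- θ i * r) (λ h → D (insertAt x i h)) (allFin m) ⟩
            ∑ (allFin m) (λ h → D (insertAt x i h)) * (- θ i * r)  ≡⟨ cong (_* (- θ i * r)) (marginal x i) ⟩
            ι m * inj (toList x) * (- θ i * r)                     ≡⟨ e₂ (ι m) (inj (toList x)) (θ i) r ⟩
            - (ι m * θ i) * (inj (toList x) * r)                   ≡⟨ cong (- (ι m * θ i) *_) (rest-collision i θ i≢i₁ i≢i₂ θ₁ θ₂ x) ⟩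
            - (ι m * θ i) * 0ℚ                                     ≡⟨ ℚ.*-zeroʳ (- (ι m * θ i)) ⟩
            0ℚ                                                     ∎

      module _ (θ : Fin n → ℚ) (θ₁ : θ i₁ ≡ 0ℚ) (θ₂ : θ i₂ ≡ 0ℚ) where

        private
          -- Interpolates between no shift and the full shift θ, one coordinate at a time.
          upTo : ℕ → Fin n → ℚ
          upTo t i = if toℕ i ℕ.<ᵇ t then θ i else 0ℚ

          upTo-zero : ∀ t {i} → θ i ≡ 0ℚ → upTo t i ≡ 0ℚ
          upTo-zero t {i} eq with toℕ i ℕ.<ᵇ t
          ... | true  = eq
          ... | false = refl

          upTo-suc : ∀ t i → toℕ i ≢ t → upTo (suc t) i ≡ upTo t i
          upTo-suc t i i≢t = cong (λ b → if b then θ i else 0ℚ) (<ᵇ-suc (toℕ i) t i≢t)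
            where
            <ᵇ-suc : ∀ a t → a ≢ t → (a ℕ.<ᵇ suc t) ≡ (a ℕ.<ᵇ t)
            <ᵇ-suc zero    zero    a≢t = contradiction refl a≢t
            <ᵇ-suc zero    (suc t) a≢t = refl
            <ᵇ-suc (suc a) zero    a≢t = refl
            <ᵇ-suc (suc a) (suc t) a≢t = <ᵇ-suc a t (λ a≡t → a≢t (cong suc a≡t))

          upTo-all : ∀ i → upTo n i ≡ θ i
          upTo-all i with toℕ i ℕ.<ᵇ n | ℕ.<⇒<ᵇ (Fin.toℕ<n i)
          ... | true | _ = refl

          L-cong : ∀ {ψ χ : Fin n → Fin m → ℚ} → (∀ i h → ψ i h ≡ χ i h) → L (∏ ψ) ≡ L (∏ χ)
          L-cong eq = ∑-cong (vectors n) (λ x → cong (D x *_) (∏-cong eq x))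

          stay : ∀ t i → toℕ i ≡ t → θ i ≡ 0ℚ → L (∏ (shift φ (upTo (suc t)))) ≡ L (∏ (shift φ (upTo t)))
          stay t i i≡t θi≡0 = L-cong (λ i′ h → cong (λ z → φ i′ h - z) (same i′))
            where
            same : ∀ i′ → upTo (suc t) i′ ≡ upTo t i′
            same i′ with toℕ i′ ℕ.≟ t
            ... | no  i′≢t = upTo-suc t i′ i′≢t
            ... | yes i′≡t = trans (upTo-zero (suc t) θi′≡0) (sym (upTo-zero t θi′≡0))
              where
              θi′≡0 : θ i′ ≡ 0ℚ
              θi′≡0 = subst (λ i → θ i ≡ 0ℚ) (Fin.toℕ-injective (trans i≡t (sym i′≡t))) θi≡0

          step : ∀ t i → toℕ i ≡ t → L (∏ (shift φ (upTo (suc t)))) ≡ L (∏ (shift φ (upTo t)))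
          step t i i≡t with i Fin.≟ i₁ | i Fin.≟ i₂
          ... | yes i≡i₁ | _        = stay t i i≡t (subst (λ i → θ i ≡ 0ℚ) (sym i≡i₁) θ₁)
          ... | no _     | yes i≡i₂ = stay t i i≡t (subst (λ i → θ i ≡ 0ℚ) (sym i≡i₂) θ₂)
          -- `L-drop` at i removes the shift of coordinate i from both sides, and all other shifts
          -- agree at t and t + 1.
          ... | no i≢i₁  | no i≢i₂  = trans (L-drop i (upTo (suc t)) i≢i₁ i≢i₂ (upTo-zero (suc t) θ₁) (upTo-zero (suc t) θ₂))
            (trans (∑-cong (vectors m) (λ x → cong (∑ (allFin m) (λ h → D (insertAt x i h) * φ i h) *_)
                       (∏-cong (λ i′ h → cong (λ z → φ (punchIn i i′) h - z) (upTo-suc t (punchIn i i′) (other i′))) x)))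
                     (sym (L-drop i (upTo t) i≢i₁ i≢i₂ (upTo-zero t θ₁) (upTo-zero t θ₂))))
            where
            other : ∀ i′ → toℕ (punchIn i i′) ≢ t
            other i′ eq = Fin.punchInᵢ≢i i i′ (Fin.toℕ-injective (trans eq (sym i≡t)))

          steps : ∀ t → t ℕ.≤ n → L (∏ (shift φ (upTo t))) ≡ L (∏ φ)
          steps zero    _   = L-cong (λ i h → ℚ.+-identityʳ (φ i h))
          steps (suc t) t<n = trans (step t (Fin.fromℕ< t<n) (Fin.toℕ-fromℕ< t<n)) (steps t (ℕ.<⇒≤ t<n))

        L-shift : L (∏ (shift φ θ)) ≡ L (∏ φ)
        L-shift = trans (L-cong (λ i h → cong (λ z → φ i h - z) (sym (upTo-all i)))) (steps n ℕ.≤-refl)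

    module _ {i₁ i₂ : Fin n} (i₁≢i₂ : i₁ ≢ i₂) (j : Fin m) (a : Fin n → Fin m → ℚ) (a-idem : ∀ i h → Idempotent (a i h)) where

      private
        φ : Fin n → Fin m → ℚ
        φ i h = only i₁ (δ j) i h * (only i₂ (δ j) i h * a i h)

        -- The value ½ makes the square of every shifted 0/1 factor equal to ¼. At i₁ and i₂ there
        -- is no shift, so that these factors still vanish off hole j.
        θ : Fin n → ℚ
        θ = except i₁ 0ℚ (except i₂ 0ℚ (λ _ → ½))

        q : ℚ
        q = ι m * (½ * ½)

        -- Bounds the square sum of each pigeon's factor: 1 for the two pigeons pinned to hole j,
        -- m/4 for every other one.
        K : Fin n → ℚ
        K = except i₁ 1ℚ (except i₂ 1ℚ (λ _ → q))

        except-refl : ∀ (i : Fin n) c κ → except i c κ i ≡ c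
        except-refl i c κ with i Fin.≟ i
        ... | yes _   = refl
        ... | no  i≢i = contradiction refl i≢i

        except-≢ : ∀ {i i′ : Fin n} c κ → i′ ≢ i → except i c κ i′ ≡ κ i′
        except-≢ {i} {i′} c κ i′≢i with i′ Fin.≟ i
        ... | yes i′≡i = contradiction i′≡i i′≢i
        ... | no  _    = refl

        only-refl : ∀ (i : Fin n) h → only i (δ j) i h ≡ δ j h
        only-refl i h = except-refl i (δ j h) (λ _ → 1ℚ)

        only-idem : ∀ (i i′ : Fin n) h → Idempotent (only i (δ j) i′ h)
        only-idem i i′ h with does (i′ Fin.≟ i)
        ... | true  = δ-idem j h
        ... | false = refl

        φ-idem : ∀ i h → Idempotent (φ i h)
        φ-idem i h = idem-* (only i₁ (δ j) i h) _ (only-idem i₁ i h) (idem-* (only i₂ (δ j) i h) (a i h) (only-idem i₂ i h) (a-idem i h))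

        φ₁ : ∀ h → φ i₁ h ≡ δ j h * (only i₂ (δ j) i₁ h * a i₁ h)
        φ₁ h = cong (_* (only i₂ (δ j) i₁ h * a i₁ h)) (only-refl i₁ h)

        φ₂ : ∀ h → φ i₂ h ≡ δ j h * (only i₁ (δ j) i₂ h * a i₂ h)
        φ₂ h = trans (cong (λ d → only i₁ (δ j) i₂ h * (d * a i₂ h)) (only-refl i₂ h)) (e (only i₁ (δ j) i₂ h) (δ j h) (a i₂ h))
          where
          e : ∀ a b c → a * (b * c) ≡ b * (a * c)
          e = solve-∀ ℚ-ring

        δ-vanish : ∀ {h p r} → p ≡ δ j h * r → j ≢ h → p ≡ 0ℚ
        δ-vanish {h} {r = r} eq j≢h = trans eq (trans (cong (_* r) (δ-≢ j≢h)) (ℚ.*-zeroˡ r))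

        θ₁ : θ i₁ ≡ 0ℚ
        θ₁ = except-refl i₁ 0ℚ (except i₂ 0ℚ (λ _ → ½))

        θ₂ : θ i₂ ≡ 0ℚ
        θ₂ = trans (except-≢ 0ℚ (except i₂ 0ℚ (λ _ → ½)) (λ eq → i₁≢i₂ (sym eq))) (except-refl i₂ 0ℚ (λ _ → ½))

        ψ : Fin n → Fin m → ℚ
        ψ = shift φ θ

        half-square : ∀ {p} → Idempotent p → (p - ½) * (p - ½) ≡ ½ * ½
        half-square {p} p² = trans (e₁ p) (trans (cong (λ z → z - p + ½ * ½) p²) (e₂ p))
          where
          e₁ : ∀ p → (p - ½) * (p - ½) ≡ p * p - p + ½ * ½
          e₁ = solve-∀ ℚ-ring
          e₂ : ∀ p → p - p + ½ * ½ ≡ ½ * ½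
          e₂ = solve-∀ ℚ-ring

        collided : ∀ (r : Fin m → ℚ) → (∀ h → Idempotent (r h)) → (f : Fin m → ℚ) → (∀ h → f h ≡ δ j h * r h) →
                   ∑ (allFin m) (λ h → f h * f h) ≤ 1ℚ
        collided r r² f f≡ = subst (_≤ 1ℚ) (sym (trans
          (∑-cong (allFin m) (λ h → trans (cong₂ _*_ (f≡ h) (f≡ h)) (idem-* (δ j h) (r h) (δ-idem j h) (r² h)))) (∑-δ-* r j))) (idem-≤1 (r² j))

        ψ²≤K : ∀ i → ∑ (allFin m) (λ h → ψ i h * ψ i h) ≤ K i
        ψ²≤K i = go (i Fin.≟ i₁) (i Fin.≟ i₂)
          where
          open ℚ.≤-Reasoning
          unshifted : ∀ i → θ i ≡ 0ℚ → ∀ h → ψ i h ≡ φ i h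
          unshifted i eq h = trans (cong (λ z → φ i h - z) eq) (ℚ.+-identityʳ (φ i h))
          go : Dec (i ≡ i₁) → Dec (i ≡ i₂) → ∑ (allFin m) (λ h → ψ i h * ψ i h) ≤ K i
          go (yes refl) _ = begin
            ∑ (allFin m) (λ h → ψ i₁ h * ψ i₁ h)
              ≤⟨ collided (λ h → only i₂ (δ j) i₁ h * a i₁ h)
                   (λ h → idem-* (only i₂ (δ j) i₁ h) (a i₁ h) (only-idem i₂ i₁ h) (a-idem i₁ h))
                   (ψ i₁) (λ h → trans (unshifted i₁ θ₁ h) (φ₁ h)) ⟩
            1ℚ    ≡⟨ sym (except-refl i₁ 1ℚ (except i₂ 1ℚ (λ _ → q))) ⟩
            K i₁  ∎
          go (no i≢i₁) (yes refl) = begin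
            ∑ (allFin m) (λ h → ψ i₂ h * ψ i₂ h)
              ≤⟨ collided (λ h → only i₁ (δ j) i₂ h * a i₂ h)
                   (λ h → idem-* (only i₁ (δ j) i₂ h) (a i₂ h) (only-idem i₁ i₂ h) (a-idem i₂ h))
                   (ψ i₂) (λ h → trans (unshifted i₂ θ₂ h) (φ₂ h)) ⟩
            1ℚ    ≡⟨ sym (trans (except-≢ 1ℚ (except i₂ 1ℚ (λ _ → q)) i≢i₁) (except-refl i₂ 1ℚ (λ _ → q))) ⟩
            K i₂  ∎
          go (no i≢i₁) (no i≢i₂) = begin
            ∑ (allFin m) (λ h → ψ i h * ψ i h)
              ≡⟨ ∑-cong (allFin m) (λ h → trans (cong (λ z → (φ i h - z) * (φ i h - z)) θ≡½) (half-square (φ-idem i h))) ⟩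
            ∑ (allFin m) (λ h → ½ * ½)
              ≡⟨ ∑-const m (½ * ½) ⟩
            q     ≡⟨ sym (trans (except-≢ 1ℚ (except i₂ 1ℚ (λ _ → q)) i≢i₁) (except-≢ 1ℚ (λ _ → q) i≢i₂)) ⟩
            K i   ∎
            where
            θ≡½ : θ i ≡ ½
            θ≡½ = trans (except-≢ 0ℚ (except i₂ 0ℚ (λ _ → ½)) i≢i₁) (except-≢ 0ℚ (λ _ → ½) i≢i₂)

        -- K has two entries 1 and n - 2 entries q; the factor q² stands for the division in q ^ n /
        -- q².
        ∏ᶠK : ∏ᶠ K * (q * q) ≡ q ^ n
        ∏ᶠK = begin
          ∏ᶠ K * (q * q)                                  ≡⟨ sym (ℚ.*-assoc (∏ᶠ K) q q) ⟩
          ∏ᶠ K * q * q                                    ≡⟨ cong (λ z → ∏ᶠ K * z * q) (sym (except-≢ 1ℚ (λ _ → q) i₁≢i₂)) ⟩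
          ∏ᶠ K * except i₂ 1ℚ (λ _ → q) i₁ * q            ≡⟨ cong (_* q) (∏ᶠ-except i₁ (except i₂ 1ℚ (λ _ → q))) ⟩
          ∏ᶠ (except i₂ 1ℚ (λ _ → q)) * q                 ≡⟨ ∏ᶠ-except i₂ (λ _ → q) ⟩
          ∏ᶠ {n} (λ _ → q)                                ≡⟨ ∏ᶠ-const n q ⟩
          q ^ n                                           ∎
          where open ≡-Reasoning

        ∑-ψ² : ∑ (vectors n) (λ x → ∏ ψ x * ∏ ψ x) ≤ ∏ᶠ K
        ∑-ψ² = begin
          ∑ (vectors n) (λ x → ∏ ψ x * ∏ ψ x)             ≡⟨ ∑-cong (vectors n) (λ x → sym (∏-* ψ ψ x)) ⟩
          ∑ (vectors n) (∏ (λ i h → ψ i h * ψ i h))       ≡⟨ ∑-∏ n (λ i h → ψ i h * ψ i h) ⟩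
          ∏ᶠ (λ i → ∑ (allFin m) (λ h → ψ i h * ψ i h))   ≤⟨ ∏ᶠ-mono (λ i → ∑-nonNeg (allFin m) (λ h → 0≤-² (ψ i h))) ψ²≤K ⟩
          ∏ᶠ K                                            ∎
          where open ℚ.≤-Reasoning

      L-cube : L (λ x → δ j (lookup x i₁) * δ j (lookup x i₂) * ∏ a x) ≡ L (∏ ψ)
      L-cube = begin
        L (λ x → δ j (lookup x i₁) * δ j (lookup x i₂) * ∏ a x)
          ≡⟨ ∑-cong (vectors n) (λ x → cong (D x *_) (product x)) ⟩
        L (∏ φ)
          ≡⟨ sym (L-shift i₁≢i₂ j φ (λ {h} → δ-vanish (φ₁ h)) (λ {h} → δ-vanish (φ₂ h)) θ θ₁ θ₂) ⟩
        L (∏ ψ) ∎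
        where
        open ≡-Reasoning
        product : ∀ x → δ j (lookup x i₁) * δ j (lookup x i₂) * ∏ a x ≡ ∏ φ x
        product x = begin
          δ j (lookup x i₁) * δ j (lookup x i₂) * ∏ a x           ≡⟨ cong₂ (λ p r → p * r * ∏ a x) (sym (∏-only i₁ (δ j) x)) (sym (∏-only i₂ (δ j) x)) ⟩
          ∏ (only i₁ (δ j)) x * ∏ (only i₂ (δ j)) x * ∏ a x       ≡⟨ ℚ.*-assoc (∏ (only i₁ (δ j)) x) (∏ (only i₂ (δ j)) x) (∏ a x) ⟩
          ∏ (only i₁ (δ j)) x * (∏ (only i₂ (δ j)) x * ∏ a x)     ≡⟨ cong (∏ (only i₁ (δ j)) x *_) (sym (∏-* (only i₂ (δ j)) a x)) ⟩
          ∏ (only i₁ (δ j)) x * ∏ (λ i h → only i₂ (δ j) i h * a i h) x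
                                                                  ≡⟨ sym (∏-* (only i₁ (δ j)) (λ i h → only i₂ (δ j) i h * a i h) x) ⟩
          ∏ φ x                                                   ∎

      -- Cauchy-Schwarz between D and the shifted product, whose square sum factorises over the
      -- pigeons. The q² on the left makes up for the two pinned pigeons, which contribute 1 in
      -- place of q.
      cube-bound : let c = L (λ x → δ j (lookup x i₁) * δ j (lookup x i₂) * ∏ a x)
                       q = ι m * (½ * ½) in
                   c * c * (q * q) ≤ Z * ι n * q ^ n
      cube-bound = begin
        c * c * (q * q)                      ≡⟨ cong (λ z → z * z * (q * q)) L-cube ⟩
        L (∏ ψ) * L (∏ ψ) * (q * q)          ≤⟨ ≤-mulʳ (q * q) (0≤-² q) (cauchy-schwarz D (∏ ψ) (vectors n) (Z * ι n) (pos-* 0<Z (0<ι m)) ∑-D²≤) ⟩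
        Z * ι n * ∑ (vectors n) (λ x → ∏ ψ x * ∏ ψ x) * (q * q)
                                             ≤⟨ ≤-mulʳ (q * q) (0≤-² q) (≤-mulˡ (Z * ι n) (0≤-* (ℚ.<⇒≤ 0<Z) (0≤ι n)) ∑-ψ²) ⟩
        Z * ι n * ∏ᶠ K * (q * q)             ≡⟨ trans (ℚ.*-assoc (Z * ι n) (∏ᶠ K) (q * q)) (cong (Z * ι n *_) ∏ᶠK) ⟩
        Z * ι n * q ^ n                      ∎
        where
        open ℚ.≤-Reasoning
        c = L (λ x → δ j (lookup x i₁) * δ j (lookup x i₂) * ∏ a x)

  -- Evaluation of polynomials

  -- What `≈` between two coefficients says about the difference of their k-th approximations.
  Null : (ℕ → ℚ) → Set
  Null a = ∀ ε → 0ℚ < ε → ∃ λ K → ∀ k → K ℕ.≤ k → ∣ a k ∣ < ε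

  Null-zero : Null (λ _ → 0ℚ)
  Null-zero ε 0<ε = 0 , λ _ _ → 0<ε

  Null-cong : ∀ {a b} → (∀ k → a k ≡ b k) → Null a → Null b
  Null-cong a≡b null ε 0<ε = let K , f = null ε 0<ε in K , λ k K≤k → subst (λ z → ∣ z ∣ < ε) (a≡b k) (f k K≤k)

  Null-+ : ∀ {a b} → Null a → Null b → Null (λ k → a k + b k)
  Null-+ {a} {b} na nb ε 0<ε =
    let K , f = na (½ * ε) (½-pos 0<ε)
        L , g = nb (½ * ε) (½-pos 0<ε)
    in K ℕ.⊔ L , λ k h → ℚ.≤-<-trans (ℚ.∣p+q∣≤∣p∣+∣q∣ (a k) (b k))
         (subst (∣ a k ∣ + ∣ b k ∣ <_) (½+½ ε) (ℚ.+-mono-< (f k (ℕ.m⊔n≤o⇒m≤o K L h)) (g k (ℕ.m⊔n≤o⇒n≤o K L h))))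

  Null-* : ∀ c {a} → Null a → Null (λ k → c * a k)
  Null-* c {a} na ε 0<ε =
    let b = ∣ c ∣ + 1ℚ
        0<b : 0ℚ < b
        0<b = ℚ.+-mono-≤-< (ℚ.0≤∣p∣ c) (ℚ.positive⁻¹ 1ℚ)
        η , 0<η , bη≡ε = quotient 0<ε 0<b
        K , f = na η 0<η
    in K , λ k K≤k → begin-strict
         ∣ c * a k ∣       ≡⟨ ℚ.∣p*q∣≡∣p∣*∣q∣ c (a k) ⟩
         ∣ c ∣ * ∣ a k ∣   ≤⟨ ≤-mulʳ ∣ a k ∣ (ℚ.0≤∣p∣ (a k)) (≤-+ʳ ∣ c ∣ 0≤1) ⟩
         b * ∣ a k ∣       <⟨ ℚ.*-monoʳ-<-pos b {{positive 0<b}} (f k K≤k) ⟩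
         b * η             ≡⟨ bη≡ε ⟩
         ε                 ∎
    where open ℚ.≤-Reasoning

  Null-∑ : ∀ {A : Set} (xs : List A) {a : ℕ → A → ℚ} → (∀ x → Null (λ k → a k x)) → Null (λ k → ∑ xs (a k))
  Null-∑ []       h = Null-zero
  Null-∑ (x ∷ xs) h = Null-+ (h x) (Null-∑ xs h)

  module _ {N : ℕ} where

    power : ∀ {N} → (Fin N → ℚ) → Vec ℕ N → ℚ
    power X []      = 1ℚ
    power X (d ∷ v) = X zero ^ d * power (λ a → X (suc a)) v

    power-replicate : ∀ N (X : Fin N → ℚ) → power X (replicate N 0) ≡ 1ℚ
    power-replicate zero    X = refl
    power-replicate (suc N) X = trans (ℚ.*-identityˡ (power (λ a → X (suc a)) (replicate N 0))) (power-replicate N (λ a → X (suc a)))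

    power-var : ∀ {N} (X : Fin N → ℚ) a → power X (replicate N 0 [ a ]≔ 1) ≡ X a
    power-var {suc N} X zero    = trans (cong (X zero * 1ℚ *_) (power-replicate N (λ a → X (suc a)))) (e (X zero))
      where
      e : ∀ x → x * 1ℚ * 1ℚ ≡ x
      e = solve-∀ ℚ-ring
    power-var {suc N} X (suc a) = trans (ℚ.*-identityˡ (power (λ a → X (suc a)) (replicate N 0 [ a ]≔ 1))) (power-var (λ a → X (suc a)) a)

    power-+ : ∀ {N} (X : Fin N → ℚ) u v → power X (zipWith ℕ._+_ u v) ≡ power X u * power X v
    power-+ X []      []      = refl
    power-+ X (c ∷ u) (d ∷ v) = trans (cong₂ _*_ (^-homo-* (X zero) c d) (power-+ (λ a → X (suc a)) u v))
      (e (X zero ^ c) (X zero ^ d) (power (λ a → X (suc a)) u) (power (λ a → X (suc a)) v))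
      where
      e : ∀ a b c d → a * b * (c * d) ≡ a * c * (b * d)
      e = solve-∀ ℚ-ring

    -- The value at X of the polynomial whose coefficients are the k-th rational
    -- approximations of those of p.
    eval : ℕ → (Fin N → ℚ) → Poly N → ℚ
    eval k X p = ∑ p (λ (c , v) → seq c k * power X v)

    module _ (k : ℕ) (X : Fin N → ℚ) where

      eval-⊕ : ∀ p q → eval k X (p ⊕ q) ≡ eval k X p + eval k X q
      eval-⊕ = ∑-++ (λ (c , v) → seq c k * power X v)

      eval-⊗ : ∀ p q → eval k X (p ⊗ q) ≡ eval k X p * eval k X q
      eval-⊗ p q = begin
        eval k X (p ⊗ q)
          ≡⟨ ∑-cartesian (λ (c , u) (d , v) → c ℝ.* d , zipWith ℕ._+_ u v) (λ (c , v) → seq c k * power X v) p q ⟩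
        ∑ p (λ (c , u) → ∑ q (λ (d , v) → seq c k * seq d k * power X (zipWith ℕ._+_ u v)))
          ≡⟨ ∑-cong p (λ (c , u) → trans
               (∑-cong q (λ (d , v) → trans (cong (seq c k * seq d k *_) (power-+ X u v)) (e (seq c k) (seq d k) (power X u) (power X v))))
               (∑-*ˡ (seq c k * power X u) (λ (d , v) → seq d k * power X v) q)) ⟩
        ∑ p (λ (c , u) → seq c k * power X u * eval k X q)
          ≡⟨ ∑-*ʳ (eval k X q) (λ (c , u) → seq c k * power X u) p ⟩
        eval k X p * eval k X q ∎
        where
        open ≡-Reasoning
        e : ∀ a b c d → a * b * (c * d) ≡ a * c * (b * d)
        e = solve-∀ ℚ-ring

      eval-constant : ∀ c → eval k X (constant c) ≡ seq c k
      eval-constant c = trans (cong (λ z → seq c k * z + 0ℚ) (power-replicate N X)) (e (seq c k))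
        where
        e : ∀ c → c * 1ℚ + 0ℚ ≡ c
        e = solve-∀ ℚ-ring

      eval-var : ∀ a → eval k X (var a) ≡ X a
      eval-var a = trans (cong (λ z → 1ℚ * z + 0ℚ) (power-var X a)) (e (X a))
        where
        e : ∀ c → 1ℚ * c + 0ℚ ≡ c
        e = solve-∀ ℚ-ring

      eval-⊖ : ∀ p q → eval k X (p ⊖ q) ≡ eval k X p - eval k X q
      eval-⊖ p q = trans (eval-⊕ p (constant (ℝ.- 1ℝ) ⊗ q)) (cong (eval k X p +_)
        (trans (eval-⊗ (constant (ℝ.- 1ℝ)) q) (trans (cong (_* eval k X q) (eval-constant (ℝ.- 1ℝ))) (e (eval k X q)))))
        where
        e : ∀ a → - 1ℚ * a ≡ - a
        e = solve-∀ ℚ-ring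

      eval-var̄ : ∀ a → eval k X (var̄ a) ≡ 1ℚ - X a
      eval-var̄ a = trans (eval-⊖ (constant 1ℝ) (var a)) (cong₂ _-_ (eval-constant 1ℝ) (eval-var a))

      eval-sumP : ∀ {A : Set} (f : A → Poly N) xs → eval k X (sumP (map f xs)) ≡ ∑ xs (λ x → eval k X (f x))
      eval-sumP f []       = eval-constant 0ℝ
      eval-sumP f (x ∷ xs) = trans (eval-⊕ (f x) (sumP (map f xs))) (cong (eval k X (f x) +_) (eval-sumP f xs))

      eval-productP-zero : ∀ {A : Set} (f : A → Poly N) {x} xs → x ∈ xs → eval k X (f x) ≡ 0ℚ → eval k X (productP (map f xs)) ≡ 0ℚ
      eval-productP-zero f (y ∷ xs) x∈ eq = trans (eval-⊗ (f y) (productP (map f xs))) (zero-factor x∈)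
        where
        zero-factor : _ ∈ y ∷ xs → eval k X (f y) * eval k X (productP (map f xs)) ≡ 0ℚ
        zero-factor (here refl) = trans (cong (_* eval k X (productP (map f xs))) eq) (ℚ.*-zeroˡ (eval k X (productP (map f xs))))
        zero-factor (there x∈)  = trans (cong (eval k X (f y) *_) (eval-productP-zero f xs x∈ eq)) (ℚ.*-zeroʳ (eval k X (f y)))

    private
      _≟ᵛ_ = Vec.≡-dec {n = N} ℕ._≟_

    seq-coeff-∷ : ∀ k c v p u → seq (coeff ((c , v) ∷ p) u) k ≡ (if does (v ≟ᵛ u) then seq c k else 0ℚ) + seq (coeff p u) k
    seq-coeff-∷ k c v p u with does (v ≟ᵛ u)
    ... | true  = refl
    ... | false = sym (ℚ.+-identityˡ (seq (coeff p u) k))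

    private
      exponents : Poly N → List (Vec ℕ N)
      exponents = map proj₂

    ∑-indicator : ∀ (c : ℚ) (f : Vec ℕ N → ℚ) v {U} → Unique U → v ∈ U →
                  ∑ U (λ u → (if does (v ≟ᵛ u) then c else 0ℚ) * f u) ≡ c * f v
    ∑-indicator c f v {u ∷ U} (u∉U ∷ _) (here refl) = trans (cong₂ _+_ head (tail U u∉U)) (ℚ.+-identityʳ (c * f v))
      where
      head : (if does (v ≟ᵛ v) then c else 0ℚ) * f v ≡ c * f v
      head with v ≟ᵛ v
      ... | yes _   = refl
      ... | no  v≢v = contradiction refl v≢v
      tail : ∀ U → All (v ≢_) U → ∑ U (λ u → (if does (v ≟ᵛ u) then c else 0ℚ) * f u) ≡ 0ℚ
      tail []      []           = refl
      tail (u ∷ U) (v≢u ∷ v∉U) = cong₂ _+_ off (tail U v∉U)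
        where
        off : (if does (v ≟ᵛ u) then c else 0ℚ) * f u ≡ 0ℚ
        off with v ≟ᵛ u
        ... | yes v≡u = contradiction v≡u v≢u
        ... | no  _   = ℚ.*-zeroˡ (f u)
    ∑-indicator c f v {u ∷ U} (u∉U ∷ unique) (there v∈U) = trans (cong₂ _+_ off (∑-indicator c f v unique v∈U)) (ℚ.+-identityˡ (c * f v))
      where
      off : (if does (v ≟ᵛ u) then c else 0ℚ) * f u ≡ 0ℚ
      off with v ≟ᵛ u
      ... | yes refl = contradiction refl (All.lookup u∉U v∈U)
      ... | no  _    = ℚ.*-zeroˡ (f u)

    -- Collects terms with repeated exponents. U may be larger than the support of p, so that two
    -- polynomials can be expanded over the same list.
    eval-coeff : ∀ k X {U} → Unique U → ∀ p → (∀ {v} → v ∈ exponents p → v ∈ U) →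
                 eval k X p ≡ ∑ U (λ u → seq (coeff p u) k * power X u)
    eval-coeff k X {U} unique []            p⊆U = sym (∑-zero U (λ u → ℚ.*-zeroˡ (power X u)))
    eval-coeff k X {U} unique ((c , v) ∷ p) p⊆U = begin
      seq c k * power X v + eval k X p
        ≡⟨ cong₂ _+_ (sym (∑-indicator (seq c k) (power X) v unique (p⊆U (here refl)))) (eval-coeff k X unique p (λ v∈ → p⊆U (there v∈))) ⟩
      ∑ U (λ u → (if does (v ≟ᵛ u) then seq c k else 0ℚ) * power X u) + ∑ U (λ u → seq (coeff p u) k * power X u)
        ≡⟨ sym (∑-+ _ _ U) ⟩
      ∑ U (λ u → (if does (v ≟ᵛ u) then seq c k else 0ℚ) * power X u + seq (coeff p u) k * power X u)
        ≡⟨ ∑-cong U (λ u → trans (sym (ℚ.*-distribʳ-+ (power X u) (if does (v ≟ᵛ u) then seq c k else 0ℚ) (seq (coeff p u) k)))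
                                 (cong (_* power X u) (sym (seq-coeff-∷ k c v p u)))) ⟩
      ∑ U (λ u → seq (coeff ((c , v) ∷ p) u) k * power X u) ∎
      where open ≡-Reasoning

    -- Over a common finite list of exponents the difference is a fixed linear combination of null
    -- sequences, the weights `power X u` being independent of k.
    ≋⇒Null : ∀ {p q : Poly N} → p ≋ q → ∀ X → Null (λ k → eval k X p - eval k X q)
    ≋⇒Null {p} {q} (mk≋ p≈q) X = Null-cong eq (Null-∑ U (λ u → Null-cong (λ k → ℚ.*-comm (power X u) _) (Null-* (power X u) (ℝ._≈_.close (p≈q u)))))
      where
      U = deduplicate _≟ᵛ_ (exponents p ++ exponents q)
      unique : Unique U
      unique = deduplicate-! _≟ᵛ_ (exponents p ++ exponents q)
      e : ∀ a b x → (a - b) * x ≡ a * x + - 1ℚ * (b * x)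
      e = solve-∀ ℚ-ring
      e′ : ∀ a b → a + - 1ℚ * b ≡ a - b
      e′ = solve-∀ ℚ-ring
      eq : ∀ k → ∑ U (λ u → (seq (coeff p u) k - seq (coeff q u) k) * power X u) ≡ eval k X p - eval k X q
      eq k = trans (∑-cong U (λ u → e (seq (coeff p u) k) (seq (coeff q u) k) (power X u)))
        (trans (∑-+ (λ u → seq (coeff p u) k * power X u) (λ u → - 1ℚ * (seq (coeff q u) k * power X u)) U)
        (trans (cong₂ _+_ (sym (eval-coeff k X unique p (λ v∈ → ∈-deduplicate⁺ _≟ᵛ_ (∈-++⁺ˡ v∈))))
                          (trans (∑-*ˡ (- 1ℚ) (λ u → seq (coeff q u) k * power X u) U)
                                 (cong (- 1ℚ *_) (sym (eval-coeff k X unique q (λ v∈ → ∈-deduplicate⁺ _≟ᵛ_ (∈-++⁺ʳ (exponents p) v∈)))))))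
               (e′ (eval k X p) (eval k X q))))

  -- The rational lower bound

  square-∣∣ : ∀ c → ∣ c ∣ * ∣ c ∣ ≡ c * c
  square-∣∣ c with ℚ.∣p∣≡p∨∣p∣≡-p c
  ... | inj₁ eq = cong₂ _*_ eq eq
  ... | inj₂ eq = trans (cong₂ _*_ eq eq) (square-neg c)
    where
    square-neg : ∀ p → - p * - p ≡ p * p
    square-neg = solve-∀ ℚ-ring

  -- ∣ v ∣ ≤ s √b, stated without the square root.
  record Bounded (b v s : ℚ) : Set where
    constructor bounded
    field
      scale≥0 : 0ℚ ≤ s
      square≤ : v * v ≤ s * s * b

  module _ {b : ℚ} (0≤b : 0ℚ ≤ b) where

    Bounded-+ : ∀ {v s v′ s′} → Bounded b v s → Bounded b v′ s′ → Bounded b (v + v′) (s + s′)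
    Bounded-+ {v} {s} {v′} {s′} (bounded 0≤s v²≤) (bounded 0≤s′ v′²≤) = bounded (0≤-+ 0≤s 0≤s′) (begin
      (v + v′) * (v + v′)                           ≡⟨ e₁ v v′ ⟩
      v * v + v′ * v′ + (v * v′ + v * v′)           ≤⟨ ℚ.+-mono-≤ (ℚ.+-mono-≤ v²≤ v′²≤) (ℚ.+-mono-≤ cross cross) ⟩
      s * s * b + s′ * s′ * b + (s * s′ * b + s * s′ * b)  ≡⟨ e₂ s s′ b ⟩
      (s + s′) * (s + s′) * b                       ∎)
      where
      open ℚ.≤-Reasoning
      e₁ : ∀ v v′ → (v + v′) * (v + v′) ≡ v * v + v′ * v′ + (v * v′ + v * v′)
      e₁ = solve-∀ ℚ-ring
      e₂ : ∀ s s′ b → s * s * b + s′ * s′ * b + (s * s′ * b + s * s′ * b) ≡ (s + s′) * (s + s′) * b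
      e₂ = solve-∀ ℚ-ring
      e₃ : ∀ v v′ → v * v′ * (v * v′) ≡ v * v * (v′ * v′)
      e₃ = solve-∀ ℚ-ring
      e₄ : ∀ s s′ b → s * s * b * (s′ * s′ * b) ≡ s * s′ * b * (s * s′ * b)
      e₄ = solve-∀ ℚ-ring
      -- Multiplying the two square bounds gives the square of the rational s s′ b, so here a root
      -- can be taken within ℚ.
      cross : v * v′ ≤ s * s′ * b
      cross = square-cancel-≤ (0≤-* (0≤-* 0≤s 0≤s′) 0≤b)
        (subst₂ _≤_ (sym (e₃ v v′)) (e₄ s s′ b) (*-mono-≤ (0≤-² v) (0≤-² v′) v²≤ v′²≤))

    Bounded-∑ : ∀ {A : Set} (f s : A → ℚ) xs → (∀ x → Bounded b (f x) (s x)) → Bounded b (∑ xs f) (∑ xs s)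
    Bounded-∑ f s []       h = bounded ℚ.≤-refl (ℚ.≤-reflexive (sym (ℚ.*-zeroˡ b)))
    Bounded-∑ f s (x ∷ xs) h = Bounded-+ (h x) (Bounded-∑ f s xs h)

  Bounded-scale : ∀ {b} c v → v * v ≤ b → Bounded b (c * v) ∣ c ∣
  Bounded-scale {b} c v v²≤b = bounded (ℚ.0≤∣p∣ c) (begin
    c * v * (c * v)      ≡⟨ e₁ c v ⟩
    c * c * (v * v)      ≤⟨ ≤-mulˡ (c * c) (0≤-² c) v²≤b ⟩
    c * c * b            ≡⟨ cong (_* b) (sym (square-∣∣ c)) ⟩
    ∣ c ∣ * ∣ c ∣ * b    ∎)
    where
    open ℚ.≤-Reasoning
    e₁ : ∀ c v → c * v * (c * v) ≡ c * c * (v * v)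
    e₁ = solve-∀ ℚ-ring

  seq-sumℝ : ∀ {A : Set} (f : A → ℝ) xs k → seq (sumℝ (map f xs)) k ≡ ∑ xs (λ x → seq (f x) k)
  seq-sumℝ f []       k = refl
  seq-sumℝ f (x ∷ xs) k = cong (seq (f x) k +_) (seq-sumℝ f xs k)

  -- The indicators of cubes: products of 0/1 functions of one pigeon each, the shape to which
  -- `cube-bound` applies.
  record Factorable {m n} (F : Vec (Fin m) n → ℚ) : Set where
    constructor factorable
    field
      factor  : Fin n → Fin m → ℚ
      idem    : ∀ i h → Idempotent (factor i h)
      product : ∀ x → F x ≡ ∏ factor x

  Factorable-one : ∀ {m n} {F : Vec (Fin m) n → ℚ} → (∀ x → F x ≡ 1ℚ) → Factorable F
  Factorable-one eq = factorable (λ _ _ → 1ℚ) (λ _ _ → refl) (λ x → trans (eq x) (sym (∏-one x)))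

  Factorable-* : ∀ {m n} {F G H : Vec (Fin m) n → ℚ} → (∀ x → H x ≡ F x * G x) → Factorable F → Factorable G → Factorable H
  Factorable-* eq (factorable a a² F≡) (factorable b b² G≡) = factorable (λ i h → a i h * b i h)
    (λ i h → idem-* (a i h) (b i h) (a² i h) (b² i h))
    (λ x → trans (eq x) (trans (cong₂ _*_ (F≡ x) (G≡ x)) (sym (∏-* a b x))))

  Factorable-only : ∀ {m n} (i : Fin n) (g : Fin m → ℚ) → (∀ h → Idempotent (g h)) →
                    ∀ {F} → (∀ x → F x ≡ g (lookup x i)) → Factorable F
  Factorable-only {m} {n} i g g² eq = factorable (only i g) idem (λ x → trans (eq x) (sym (∏-only i g x)))
    where
    idem : ∀ i′ h → Idempotent (only i g i′ h)
    idem i′ h with does (i′ Fin.≟ i)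
    ... | true  = g² h
    ... | false = refl

  δ̄-idem : ∀ {m} (j h : Fin m) → Idempotent (1ℚ - δ j h)
  δ̄-idem j h = trans (e₁ (δ j h)) (trans (cong (λ z → 1ℚ - δ j h - δ j h + z) (δ-idem j h)) (e₂ (δ j h)))
    where
    e₁ : ∀ d → (1ℚ - d) * (1ℚ - d) ≡ 1ℚ - d - d + d * d
    e₁ = solve-∀ ℚ-ring
    e₂ : ∀ d → 1ℚ - d - d + d ≡ 1ℚ - d
    e₂ = solve-∀ ℚ-ring

  -- The two shapes of axiom, with i₁ < i₂ turned into i₁ ≢ i₂, the form in which the collision
  -- argument uses it.
  data IsPHPAxiom (n : ℕ) : Poly (n ℕ.* (n ℕ.∸ 1)) → Set where
    pigeon : ∀ i → IsPHPAxiom n (pigeonAxiom n i)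
    hole   : ∀ {i₁ i₂} → i₁ ≢ i₂ → ∀ j → IsPHPAxiom n (holeAxiom n i₁ i₂ j)

  isPHPAxiom : ∀ n {p} → p ∈ PHP n → IsPHPAxiom n p
  isPHPAxiom n p∈ with ∈-++⁻ (map (pigeonAxiom n) (allFin n)) p∈
  ... | inj₁ p∈pigeon with ∈-map⁻ (pigeonAxiom n) p∈pigeon
  ...   | i , _ , refl = pigeon i
  isPHPAxiom n p∈ | inj₂ p∈hole
    with ∈-cartesianProductWith⁻ (λ (i₁ , i₂) j → holeAxiom n i₁ i₂ j) (pigeonPairs n) (allFin (n ℕ.∸ 1)) p∈hole
  ... | (i₁ , i₂) , j , i∈ , _ , refl = hole (Fin.<⇒≢ (proj₂ (∈-filter⁻ (λ (i₁ , i₂) → i₁ Fin.<? i₂) {xs = cartesianProduct (allFin n) (allFin n)} i∈))) j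

  -- The dual functional on polynomials, at a fixed index of approximation

  module Pigeonhole (l : ℕ) (μ : ℚ) (mμ≡1 : ι (suc l) * μ ≡ 1ℚ) where

    m = suc l

    open Functional m μ mμ≡1
    open CubeBound m μ mμ≡1

    N = n ℕ.* m

    -- The Boolean assignment x_{i,j} = [x i = j] belonging to a map x; `remQuot` decodes the index
    -- of a variable.
    point : Vec (Fin m) n → Fin N → ℚ
    point x a = δ (proj₂ (remQuot {n} m a)) (lookup x (proj₁ (remQuot {n} m a)))

    point-combine : ∀ x i j → point x (combine i j) ≡ δ j (lookup x i)
    point-combine x i j = cong (λ (i , j) → δ j (lookup x i)) (Fin.remQuot-combine i j)

    module _ (k : ℕ) where

      Factorable-productP : ∀ {A : Set} (f : A → Poly N) → (∀ a → Factorable (λ x → eval k (point x) (f a))) →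
                            ∀ as → Factorable (λ x → eval k (point x) (productP (map f as)))
      Factorable-productP f h []       = Factorable-one (λ x → eval-constant k (point x) 1ℝ)
      Factorable-productP f h (a ∷ as) = Factorable-* (λ x → eval-⊗ k (point x) (f a) (productP (map f as))) (h a) (Factorable-productP f h as)

      -- Each literal depends on the hole of a single pigeon only.
      Factorable-monomial : ∀ r → Factorable (λ x → eval k (point x) (monomialPoly r))
      Factorable-monomial r = Factorable-* (λ x → eval-⊗ k (point x) (productP (map var (members (S r)))) (productP (map var̄ (members (T r)))))
        (Factorable-productP var positive-literal (members (S r)))
        (Factorable-productP var̄ negative-literal (members (T r)))
        where
        members : Subset N → List (Fin N)
        members U = filter (_∈? U) (allFin N)
        pigeonOf : Fin N → Fin n
        pigeonOf a = proj₁ (remQuot {n} m a)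
        holeOf : Fin N → Fin m
        holeOf a = proj₂ (remQuot {n} m a)
        positive-literal : ∀ a → Factorable (λ x → eval k (point x) (var a))
        positive-literal a = Factorable-only (pigeonOf a) (δ (holeOf a)) (δ-idem (holeOf a)) (λ x → eval-var k (point x) a)
        negative-literal : ∀ a → Factorable (λ x → eval k (point x) (var̄ a))
        negative-literal a = Factorable-only (pigeonOf a) (λ h → 1ℚ - δ (holeOf a) h) (δ̄-idem (holeOf a)) (λ x → eval-var̄ k (point x) a)

      Λ : Poly N → ℚ
      Λ p = L (λ x → eval k (point x) p)

      L-∑ : ∀ {A : Set} (G : A → Vec (Fin m) n → ℚ) as → L (λ x → ∑ as (λ a → G a x)) ≡ ∑ as (λ a → L (G a))
      L-∑ G as = trans (∑-cong (vectors n) (λ x → sym (∑-*ˡ (D x) (λ a → G a x) as))) (∑-swap (λ x a → D x * G a x) (vectors n) as)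

      L-*ˡ : ∀ c G → L (λ x → c * G x) ≡ c * L G
      L-*ˡ c G = trans (∑-cong (vectors n) (λ x → e (D x) c (G x))) (∑-*ˡ c (λ x → D x * G x) (vectors n))
        where
        e : ∀ d c g → d * (c * g) ≡ c * (d * g)
        e = solve-∀ ℚ-ring

      L-cong : ∀ {F G} → (∀ x → F x ≡ G x) → L F ≡ L G
      L-cong eq = ∑-cong (vectors n) (λ x → cong (D x *_) (eq x))

      q : ℚ
      q = ι m * (½ * ½)

      0<q : 0ℚ < q
      0<q = pos-* (0<ι l) (ℚ.positive⁻¹ (½ * ½))

      b : ℚ
      b = Z * ι n * q ^ l

      0≤b : 0ℚ ≤ b
      0≤b = 0≤-* (0≤-* (ℚ.<⇒≤ 0<Z) (0≤ι n)) (^-nonNeg l (ℚ.<⇒≤ 0<q))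

      pigeon-vanish : ∀ i x → eval k (point x) (pigeonAxiom n i) ≡ 0ℚ
      pigeon-vanish i x = eval-productP-zero k (point x) (λ j → var̄ (pigeonVar n i j)) (allFin m) (∈-allFin (lookup x i))
        (trans (eval-var̄ k (point x) (pigeonVar n i (lookup x i)))
          (cong (λ z → 1ℚ - z) (trans (point-combine x i (lookup x i)) (δ-refl (lookup x i)))))

      hole-value : ∀ i₁ i₂ j x → eval k (point x) (holeAxiom n i₁ i₂ j) ≡ δ j (lookup x i₁) * δ j (lookup x i₂)
      hole-value i₁ i₂ j x = trans (eval-⊗ k (point x) (var (pigeonVar n i₁ j)) (var (pigeonVar n i₂ j)))
        (cong₂ _*_ (trans (eval-var k (point x) (pigeonVar n i₁ j)) (point-combine x i₁ j))
                   (trans (eval-var k (point x) (pigeonVar n i₂ j)) (point-combine x i₂ j)))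

      -- A pigeon axiom vanishes at every point, since x i is some hole. For a hole axiom, q² is
      -- cancelled from `cube-bound`, where q ^ n = q² q ^ l.
      axiom-bound : ∀ {p} → IsPHPAxiom n p → ∀ r → let v = L (λ x → eval k (point x) p * eval k (point x) (monomialPoly r)) in v * v ≤ b
      axiom-bound (pigeon i) r = subst (λ v → v * v ≤ b) (sym v≡0) 0≤b
        where
        v≡0 : L (λ x → eval k (point x) (pigeonAxiom n i) * eval k (point x) (monomialPoly r)) ≡ 0ℚ
        v≡0 = ∑-zero (vectors n) (λ x → trans
          (cong (λ z → D x * (z * eval k (point x) (monomialPoly r))) (pigeon-vanish i x))
          (trans (cong (D x *_) (ℚ.*-zeroˡ (eval k (point x) (monomialPoly r)))) (ℚ.*-zeroʳ (D x))))
      axiom-bound (hole {i₁} {i₂} i₁≢i₂ j) r = subst (λ v → v * v ≤ b) (sym v≡) (≤-cancelˡ (q * q) (pos-* 0<q 0<q) (begin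
        q * q * (c * c)          ≡⟨ ℚ.*-comm (q * q) (c * c) ⟩
        c * c * (q * q)          ≤⟨ cube-bound i₁≢i₂ j factor idem ⟩
        Z * ι n * q ^ n          ≡⟨ e (Z * ι n) q (q ^ l) ⟩
        q * q * b                ∎))
        where
        open ℚ.≤-Reasoning
        open Factorable (Factorable-monomial r)
        c = L (λ x → δ j (lookup x i₁) * δ j (lookup x i₂) * ∏ factor x)
        e : ∀ z q p → z * (q * (q * p)) ≡ q * q * (z * p)
        e = solve-∀ ℚ-ring
        v≡ : L (λ x → eval k (point x) (holeAxiom n i₁ i₂ j) * eval k (point x) (monomialPoly r)) ≡ c
        v≡ = L-cong (λ x → cong₂ _*_ (hole-value i₁ i₂ j x) (product x))

      -- The triangle inequality of the duality argument: each monomial contributes at most the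
      -- absolute value of its coefficient times √b, and those absolute values add up to the size.
      combination-bound : ∀ {p} → IsPHPAxiom n p → ∀ c → Bounded b (Λ (p ⊗ combinationPoly c)) (seq (coefficientSize c) k)
      combination-bound {p} ax c = subst₂ (Bounded b) (sym v≡) (sym (seq-sumℝ (λ (a , _) → ℝ.∣ a ∣) (terms c) k))
        (Bounded-∑ 0≤b _ (λ (a , _) → ∣ seq a k ∣) (terms c) (λ (a , r) → Bounded-scale (seq a k) _ (axiom-bound ax r)))
        where
        e : ∀ p a r → p * (a * r) ≡ a * (p * r)
        e = solve-∀ ℚ-ring
        v≡ : Λ (p ⊗ combinationPoly c)
           ≡ ∑ (terms c) (λ (a , r) → seq a k * L (λ x → eval k (point x) p * eval k (point x) (monomialPoly r)))
        v≡ = trans (L-cong (λ x → trans (eval-⊗ k (point x) p (combinationPoly c))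
               (trans (cong (eval k (point x) p *_) (eval-sumP k (point x) (λ (a , r) → constant a ⊗ monomialPoly r) (terms c)))
               (trans (sym (∑-*ˡ (eval k (point x) p) (λ (a , r) → eval k (point x) (constant a ⊗ monomialPoly r)) (terms c)))
                      (∑-cong (terms c) (λ (a , r) → trans (cong (eval k (point x) p *_)
                         (trans (eval-⊗ k (point x) (constant a) (monomialPoly r)) (cong (_* eval k (point x) (monomialPoly r)) (eval-constant k (point x) a))))
                         (e (eval k (point x) p) (seq a k) (eval k (point x) (monomialPoly r)))))))))
          (trans (L-∑ (λ (a , r) x → seq a k * (eval k (point x) p * eval k (point x) (monomialPoly r))) (terms c))
                 (∑-cong (terms c) (λ (a , r) → L-*ˡ (seq a k) (λ x → eval k (point x) p * eval k (point x) (monomialPoly r)))))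

      boolean-vanish : ∀ g a x → eval k (point x) (g ⊗ (var a ⊗ var a ⊖ var a)) ≡ 0ℚ
      boolean-vanish g a x = trans (eval-⊗ k (point x) g (var a ⊗ var a ⊖ var a)) (trans (cong (eval k (point x) g *_)
        (trans (eval-⊖ k (point x) (var a ⊗ var a) (var a)) (trans (cong₂ _-_ (trans (eval-⊗ k (point x) (var a) (var a))
          (trans (cong₂ _*_ v v) (δ-idem (proj₂ (remQuot {n} m a)) (lookup x (proj₁ (remQuot {n} m a)))))) v) (ℚ.+-inverseʳ (point x a)))))
        (ℚ.*-zeroʳ (eval k (point x) g)))
        where
        v = eval-var k (point x) a

      certificate-bound : ∀ {axioms : List (Poly N)} → (∀ {p} → p ∈ axioms → IsPHPAxiom n p) → (π : NullstellensatzProof axioms) →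
                          Bounded b (Λ (certificate axioms (NullstellensatzProof.q π) (NullstellensatzProof.g π))) (seq (totalCoefficientSize π) k)
      certificate-bound {axioms} isAxiom π = subst₂ (Bounded b) (sym v≡) (sym (seq-sumℝ (λ i → coefficientSize (comb i)) is k))
        (Bounded-∑ 0≤b (λ i → Λ (f i)) (λ i → seq (coefficientSize (comb i)) k) is
          (λ i → combination-bound (isAxiom (∈-lookup {xs = axioms} i)) (comb i)))
        where
        comb = NullstellensatzProof.q π
        g    = NullstellensatzProof.g π
        is = allFin (length axioms)
        f : Fin (length axioms) → Poly N
        f i = List.lookup axioms i ⊗ combinationPoly (comb i)
        boolean : Fin N → Poly N
        boolean a = g a ⊗ (var a ⊗ var a ⊖ var a)
        v≡ : Λ (certificate axioms comb g) ≡ ∑ is (λ i → Λ (f i))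
        v≡ = trans (L-cong (λ x → trans (eval-⊕ k (point x) (sumP (map f is)) (sumP (map boolean (allFin N))))
               (trans (cong₂ _+_ (eval-sumP k (point x) f is)
                                 (trans (eval-sumP k (point x) boolean (allFin N)) (∑-zero (allFin N) (λ a → boolean-vanish (g a) a x))))
                      (ℚ.+-identityʳ (∑ is (λ i → eval k (point x) (f i)))))))
          (L-∑ (λ i x → eval k (point x) (f i)) is)

    Λ-one : ∀ k → Λ k (constant 1ℝ) ≡ Z
    Λ-one k = ∑-cong (vectors n) (λ x → trans (cong (D x *_) (eval-constant k (point x) 1ℝ)) (ℚ.*-identityʳ (D x)))

    Λ-Null : ∀ {p q : Poly N} → p ≋ q → Null (λ k → Λ k p - Λ k q)
    Λ-Null {p} {q} p≋q = Null-cong eq (Null-∑ (vectors n) (λ x → Null-* (D x) (≋⇒Null p≋q (point x))))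
      where
      e : ∀ d a b → d * (a - b) ≡ d * a + - 1ℚ * (d * b)
      e = solve-∀ ℚ-ring
      e′ : ∀ a b → a + - 1ℚ * b ≡ a - b
      e′ = solve-∀ ℚ-ring
      eq : ∀ k → ∑ (vectors n) (λ x → D x * (eval k (point x) p - eval k (point x) q)) ≡ Λ k p - Λ k q
      eq k = trans (∑-cong (vectors n) (λ x → e (D x) (eval k (point x) p) (eval k (point x) q)))
        (trans (∑-+ (λ x → D x * eval k (point x) p) (λ x → - 1ℚ * (D x * eval k (point x) q)) (vectors n))
        (trans (cong (Λ k p +_) (∑-*ˡ (- 1ℚ) (λ x → D x * eval k (point x) q) (vectors n))) (e′ (Λ k p) (Λ k q))))

    -- At index k the identity holds only up to a null error, so the functional at the certificate
    -- is eventually at least Z/2. Squaring gives the factor ½ * ½, and one Z of Z² cancels against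
    -- the Z in b.
    size-bound : ∀ {axioms : List (Poly N)} → (∀ {p} → p ∈ axioms → IsPHPAxiom n p) → (π : NullstellensatzProof axioms) →
                 ∃ λ K → ∀ k → K ℕ.≤ k → let s = seq (totalCoefficientSize π) k in
                 0ℚ ≤ s × ι m * ι (m !) * (½ * ½) ≤ s * s * (ι n * (ι m * (½ * ½)) ^ l)
    size-bound {axioms} isAxiom π = K , λ k K≤k → bound k (close k K≤k)
      where
      open NullstellensatzProof π using (identity)
      cert = certificate axioms (NullstellensatzProof.q π) (NullstellensatzProof.g π)
      limit = Λ-Null identity (½ * Z) (½-pos 0<Z)
      K = proj₁ limit
      close = proj₂ limit
      bound : ∀ k → ∣ Λ k (constant 1ℝ) - Λ k cert ∣ < ½ * Z → let s = seq (totalCoefficientSize π) k in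
              0ℚ ≤ s × ι m * ι (m !) * (½ * ½) ≤ s * s * (ι n * (ι m * (½ * ½)) ^ l)
      bound k near = Bounded.scale≥0 bd , ≤-cancelˡ Z 0<Z (begin
        Z * (ι m * ι (m !) * (½ * ½))   ≡⟨ cong (λ z → Z * (z * (½ * ½))) (sym Z≡m*m!) ⟩
        Z * (Z * (½ * ½))               ≡⟨ e₁ Z ⟩
        ½ * Z * (½ * Z)                 ≤⟨ *-mono-≤ (ℚ.<⇒≤ (½-pos 0<Z)) (ℚ.<⇒≤ (½-pos 0<Z)) half≤ half≤ ⟩
        Λ k cert * Λ k cert             ≤⟨ Bounded.square≤ bd ⟩
        s * s * (Z * ι n * (ι m * (½ * ½)) ^ l)    ≡⟨ e₂ (s * s) Z (ι n) ((ι m * (½ * ½)) ^ l) ⟩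
        Z * (s * s * (ι n * (ι m * (½ * ½)) ^ l))  ∎)
        where
        open ℚ.≤-Reasoning
        s = seq (totalCoefficientSize π) k
        bd : Bounded (b k) (Λ k cert) s
        bd = certificate-bound k isAxiom π
        e₁ : ∀ z → z * (z * (½ * ½)) ≡ ½ * z * (½ * z)
        e₁ = solve-∀ ℚ-ring
        e₂ : ∀ t z n p → t * (z * n * p) ≡ z * (t * (n * p))
        e₂ = solve-∀ ℚ-ring
        e₄ : ∀ z v → z - v + (v - ½ * z) ≡ ½ * z
        e₄ = solve-∀ ℚ-ring
        e₅ : ∀ z v → ½ * z + (v - ½ * z) ≡ v
        e₅ = solve-∀ ℚ-ring
        near′ : Z - Λ k cert ≤ ½ * Z
        near′ = ℚ.≤-trans (p≤∣p∣ (Z - Λ k cert)) (ℚ.<⇒≤ (subst (λ z → ∣ z - Λ k cert ∣ < ½ * Z) (Λ-one k) near))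
        half≤ : ½ * Z ≤ Λ k cert
        half≤ = subst₂ _≤_ (e₄ Z (Λ k cert)) (e₅ Z (Λ k cert)) (ℚ.+-monoˡ-≤ (Λ k cert - ½ * Z) near′)

  -- A Stirling bound for eⁿ

  ι≡/1 : ∀ k → ι k ≡ ℤ.+ k ℚ./ 1
  ι≡/1 zero    = refl
  ι≡/1 (suc k) = trans (cong (1ℚ +_) (ι≡/1 k)) (trans (sym (fromℚᵘ-homo-+ (ℚᵘ.mkℚᵘ (ℤ.+ 1) 0) (ℚᵘ.mkℚᵘ (ℤ.+ k) 0)))
    (ℚ.fromℚᵘ-cong {ℚᵘ.mkℚᵘ (ℤ.+ 1) 0 ℚᵘ.+ ℚᵘ.mkℚᵘ (ℤ.+ k) 0} {ℚᵘ.mkℚᵘ (ℤ.+ suc k) 0}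
      (ℚᵘ.*≡* (cong (λ z → (ℤ.+ 1 ℤ.+ z) ℤ.* ℤ.+ 1) (ℤ.*-identityʳ (ℤ.+ k))))))

  ι*1/ : ∀ k .{{_ : ℕ.NonZero k}} → ι k * (ℤ.+ 1 ℚ./ k) ≡ 1ℚ
  ι*1/ (suc k) = trans (cong (_* (ℤ.+ 1 ℚ./ suc k)) (ι≡/1 (suc k)))
    (trans (sym (fromℚᵘ-homo-* (ℚᵘ.mkℚᵘ (ℤ.+ suc k) 0) (ℚᵘ.mkℚᵘ (ℤ.+ 1) k)))
      (ℚ.fromℚᵘ-cong {ℚᵘ.mkℚᵘ (ℤ.+ suc k) 0 ℚᵘ.* ℚᵘ.mkℚᵘ (ℤ.+ 1) k} {ℚᵘ.mkℚᵘ (ℤ.+ 1) 0} (ℚᵘ.*≡* (cong ℤ.+_ (eq k)))))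
    where
    eq : ∀ k → suc k ℕ.* 1 ℕ.* 1 ≡ 1 ℕ.* suc (k ℕ.+ 0)
    eq = ℕ-Solver.solve-∀

  ι!*invFact : ∀ k → ι (k !) * invFact k ≡ 1ℚ
  ι!*invFact k = ι*1/ (k !) {{k ℕ.!≢0}}

  ≡-cancelˡ : ∀ r {p q} → 0ℚ < r → r * p ≡ r * q → p ≡ q
  ≡-cancelˡ r 0<r eq = ℚ.≤-antisym (≤-cancelˡ r 0<r (ℚ.≤-reflexive eq)) (≤-cancelˡ r 0<r (ℚ.≤-reflexive (sym eq)))

  invFact-suc : ∀ k → ι (suc k) * invFact (suc k) ≡ invFact k
  invFact-suc k = ≡-cancelˡ (ι (k !)) (0<ι! k) (begin
    ι (k !) * (ι (suc k) * invFact (suc k))   ≡⟨ e (ι (k !)) (ι (suc k)) (invFact (suc k)) ⟩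
    ι (suc k) * ι (k !) * invFact (suc k)     ≡⟨ cong (_* invFact (suc k)) (sym (ι-* (suc k) (k !))) ⟩
    ι (suc k !) * invFact (suc k)             ≡⟨ ι!*invFact (suc k) ⟩
    1ℚ                                        ≡⟨ sym (ι!*invFact k) ⟩
    ι (k !) * invFact k                       ∎)
    where
    open ≡-Reasoning
    e : ∀ a b c → a * (b * c) ≡ b * a * c
    e = solve-∀ ℚ-ring

  ∑≤ : ℕ → (ℕ → ℚ) → ℚ
  ∑≤ zero    f = f 0
  ∑≤ (suc K) f = ∑≤ K f + f (suc K)

  ∑≤-cong : ∀ K {f g : ℕ → ℚ} → (∀ k → f k ≡ g k) → ∑≤ K f ≡ ∑≤ K g
  ∑≤-cong zero    h = h 0
  ∑≤-cong (suc K) h = cong₂ _+_ (∑≤-cong K h) (h (suc K))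

  ∑≤-+ : ∀ K f g → ∑≤ K (λ k → f k + g k) ≡ ∑≤ K f + ∑≤ K g
  ∑≤-+ zero    f g = refl
  ∑≤-+ (suc K) f g = trans (cong (_+ (f (suc K) + g (suc K))) (∑≤-+ K f g)) (e (∑≤ K f) (∑≤ K g) (f (suc K)) (g (suc K)))
    where
    e : ∀ a b c d → a + b + (c + d) ≡ a + c + (b + d)
    e = solve-∀ ℚ-ring

  ∑≤-*ˡ : ∀ K c f → ∑≤ K (λ k → c * f k) ≡ c * ∑≤ K f
  ∑≤-*ˡ zero    c f = refl
  ∑≤-*ˡ (suc K) c f = trans (cong (_+ c * f (suc K)) (∑≤-*ˡ K c f)) (sym (ℚ.*-distribˡ-+ c (∑≤ K f) (f (suc K))))

  ∑≤-front : ∀ K f → ∑≤ (suc K) f ≡ f 0 + ∑≤ K (λ k → f (suc k))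
  ∑≤-front zero    f = refl
  ∑≤-front (suc K) f = trans (cong (_+ f (suc (suc K))) (∑≤-front K f)) (ℚ.+-assoc (f 0) (∑≤ K (λ k → f (suc k))) (f (suc (suc K))))

  ∑≤-nonNeg : ∀ K {f} → (∀ k → 0ℚ ≤ f k) → 0ℚ ≤ ∑≤ K f
  ∑≤-nonNeg zero    h = h 0
  ∑≤-nonNeg (suc K) h = 0≤-+ (∑≤-nonNeg K h) (h (suc K))

  ∑≤-mono : ∀ K {f g : ℕ → ℚ} → (∀ k → k ℕ.≤ K → f k ≤ g k) → ∑≤ K f ≤ ∑≤ K g
  ∑≤-mono zero    h = h 0 ℕ.z≤n
  ∑≤-mono (suc K) h = ℚ.+-mono-≤ (∑≤-mono K (λ k k≤K → h k (ℕ.m≤n⇒m≤1+n k≤K))) (h (suc K) ℕ.≤-refl)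

  ∑≤-const : ∀ K c → ∑≤ K (λ _ → c) ≡ ι (suc K) * c
  ∑≤-const zero    c = e c
    where
    e : ∀ c → c ≡ (1ℚ + 0ℚ) * c
    e = solve-∀ ℚ-ring
  ∑≤-const (suc K) c = trans (cong (_+ c) (∑≤-const K c)) (e (ι (suc K)) c)
    where
    e : ∀ k c → k * c + c ≡ (1ℚ + k) * c
    e = solve-∀ ℚ-ring

  ∑≤-tail : ∀ n J f → (∀ k → 0ℚ ≤ f k) → ∑≤ J (λ j → f (n ℕ.+ j)) ≤ ∑≤ (n ℕ.+ J) f
  ∑≤-tail zero    zero    f h = ℚ.≤-refl
  ∑≤-tail (suc n) zero    f h rewrite ℕ.+-identityʳ n = subst (_≤ ∑≤ n f + f (suc n)) (ℚ.+-identityˡ (f (suc n)))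
    (ℚ.+-monoˡ-≤ (f (suc n)) (∑≤-nonNeg n h))
  ∑≤-tail n       (suc J) f h rewrite ℕ.+-suc n J = ℚ.+-monoˡ-≤ (f (suc (n ℕ.+ J))) (∑≤-tail n J f h)

  ∑≤-extend : ∀ {K L} f → (∀ k → 0ℚ ≤ f k) → K ℕ.≤′ L → ∑≤ K f ≤ ∑≤ L f
  ∑≤-extend f h ℕ.≤′-refl = ℚ.≤-refl
  ∑≤-extend f h (ℕ.≤′-step K≤L) = ℚ.≤-trans (∑≤-extend f h K≤L) (≤-+ʳ _ (h _))

  expSeq≡∑≤ : ∀ K → expSeq K ≡ ∑≤ K invFact
  expSeq≡∑≤ zero    = refl
  expSeq≡∑≤ (suc K) = cong (_+ invFact (suc K)) (expSeq≡∑≤ K)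

  -- Cauchy products and powers of the exponential series

  conv : (ℕ → ℚ) → (ℕ → ℚ) → ℕ → ℚ
  conv f g zero    = f 0 * g 0
  conv f g (suc k) = f 0 * g (suc k) + conv (λ i → f (suc i)) g k

  conv-cong : ∀ {f f′ g g′ : ℕ → ℚ} → (∀ i → f i ≡ f′ i) → (∀ j → g j ≡ g′ j) → ∀ k → conv f g k ≡ conv f′ g′ k
  conv-cong hf hg zero    = cong₂ _*_ (hf 0) (hg 0)
  conv-cong hf hg (suc k) = cong₂ _+_ (cong₂ _*_ (hf 0) (hg (suc k))) (conv-cong (λ i → hf (suc i)) hg k)

  conv-+ˡ : ∀ f f′ g k → conv (λ i → f i + f′ i) g k ≡ conv f g k + conv f′ g k
  conv-+ˡ f f′ g zero    = ℚ.*-distribʳ-+ (g 0) (f 0) (f′ 0)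
  conv-+ˡ f f′ g (suc k) = trans (cong ((f 0 + f′ 0) * g (suc k) +_) (conv-+ˡ (λ i → f (suc i)) (λ i → f′ (suc i)) g k))
    (e (f 0) (f′ 0) (g (suc k)) (conv (λ i → f (suc i)) g k) (conv (λ i → f′ (suc i)) g k))
    where
    e : ∀ a b c d d′ → (a + b) * c + (d + d′) ≡ a * c + d + (b * c + d′)
    e = solve-∀ ℚ-ring

  conv-* : ∀ c d f g k → conv (λ i → c * f i) (λ j → d * g j) k ≡ c * d * conv f g k
  conv-* c d f g zero    = e c d (f 0) (g 0)
    where
    e : ∀ c d a b → c * a * (d * b) ≡ c * d * (a * b)
    e = solve-∀ ℚ-ring
  conv-* c d f g (suc k) = trans (cong (c * f 0 * (d * g (suc k)) +_) (conv-* c d (λ i → f (suc i)) g k))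
    (e c d (f 0) (g (suc k)) (conv (λ i → f (suc i)) g k))
    where
    e : ∀ c d a b s → c * a * (d * b) + c * d * s ≡ c * d * (a * b + s)
    e = solve-∀ ℚ-ring

  conv-last : ∀ f g k → conv f g (suc k) ≡ conv f (λ j → g (suc j)) k + f (suc k) * g 0
  conv-last f g zero    = refl
  conv-last f g (suc k) = trans (cong (f 0 * g (suc (suc k)) +_) (conv-last (λ i → f (suc i)) g k))
    (sym (ℚ.+-assoc (f 0 * g (suc (suc k))) (conv (λ i → f (suc i)) (λ j → g (suc j)) k) (f (suc (suc k)) * g 0)))

  -- The product rule for the generating functions of f and g.
  conv-weight : ∀ f g k → conv (λ i → ι i * f i) g k + conv f (λ j → ι j * g j) k ≡ ι k * conv f g k
  conv-weight f g zero    = e (f 0) (g 0)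
    where
    e : ∀ a b → 0ℚ * a * b + a * (0ℚ * b) ≡ 0ℚ * (a * b)
    e = solve-∀ ℚ-ring
  conv-weight f g (suc k) = begin
    0ℚ * f 0 * g (suc k) + conv (λ i → (1ℚ + ι i) * f (suc i)) g k + (f 0 * (ι (suc k) * g (suc k)) + conv f⁺ (λ j → ι j * g j) k)
      ≡⟨ cong (λ z → 0ℚ * f 0 * g (suc k) + z + (f 0 * (ι (suc k) * g (suc k)) + conv f⁺ (λ j → ι j * g j) k))
           (trans (conv-cong {g = g} (λ i → e₁ (ι i) (f (suc i))) (λ _ → refl) k) (conv-+ˡ f⁺ (λ i → ι i * f⁺ i) g k)) ⟩
    0ℚ * f 0 * g (suc k) + (conv f⁺ g k + conv (λ i → ι i * f⁺ i) g k) + (f 0 * (ι (suc k) * g (suc k)) + conv f⁺ (λ j → ι j * g j) k)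
      ≡⟨ e₂ (f 0) (g (suc k)) (conv f⁺ g k) (conv (λ i → ι i * f⁺ i) g k) (ι k) (conv f⁺ (λ j → ι j * g j) k) ⟩
    (1ℚ + ι k) * (f 0 * g (suc k)) + (conv f⁺ g k + (conv (λ i → ι i * f⁺ i) g k + conv f⁺ (λ j → ι j * g j) k))
      ≡⟨ cong (λ z → (1ℚ + ι k) * (f 0 * g (suc k)) + (conv f⁺ g k + z)) (conv-weight f⁺ g k) ⟩
    (1ℚ + ι k) * (f 0 * g (suc k)) + (conv f⁺ g k + ι k * conv f⁺ g k)
      ≡⟨ e₃ (ι k) (f 0 * g (suc k)) (conv f⁺ g k) ⟩
    ι (suc k) * (f 0 * g (suc k) + conv f⁺ g k) ∎
    where
    open ≡-Reasoning
    f⁺ : ℕ → ℚ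
    f⁺ i = f (suc i)
    e₁ : ∀ t a → (1ℚ + t) * a ≡ a + t * a
    e₁ = solve-∀ ℚ-ring
    e₂ : ∀ a b s p k r → 0ℚ * a * b + (s + p) + (a * ((1ℚ + k) * b) + r) ≡ (1ℚ + k) * (a * b) + (s + (p + r))
    e₂ = solve-∀ ℚ-ring
    e₃ : ∀ k a s → (1ℚ + k) * a + (s + k * s) ≡ (1ℚ + k) * (a + s)
    e₃ = solve-∀ ℚ-ring

  -- The pairs with i + j ≤ K lie in the square i, j ≤ K, and the products left out are nonnegative.
  ∑≤-conv : ∀ K f g → (∀ k → 0ℚ ≤ f k) → (∀ k → 0ℚ ≤ g k) → ∑≤ K (conv f g) ≤ ∑≤ K f * ∑≤ K g
  ∑≤-conv zero    f g 0≤f 0≤g = ℚ.≤-refl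
  ∑≤-conv (suc K) f g 0≤f 0≤g = begin
    ∑≤ (suc K) (conv f g)
      ≡⟨ ∑≤-front K (conv f g) ⟩
    f 0 * g 0 + ∑≤ K (λ k → f 0 * g (suc k) + conv f⁺ g k)
      ≡⟨ cong (f 0 * g 0 +_) (trans (∑≤-+ K (λ k → f 0 * g (suc k)) (conv f⁺ g)) (cong (_+ ∑≤ K (conv f⁺ g)) (∑≤-*ˡ K (f 0) (λ k → g (suc k))))) ⟩
    f 0 * g 0 + (f 0 * ∑≤ K (λ k → g (suc k)) + ∑≤ K (conv f⁺ g))
      ≡⟨ e₁ (f 0) (g 0) (∑≤ K (λ k → g (suc k))) (∑≤ K (conv f⁺ g)) ⟩
    f 0 * (g 0 + ∑≤ K (λ k → g (suc k))) + ∑≤ K (conv f⁺ g)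
      ≡⟨ cong (λ z → f 0 * z + ∑≤ K (conv f⁺ g)) (sym (∑≤-front K g)) ⟩
    f 0 * ∑≤ (suc K) g + ∑≤ K (conv f⁺ g)
      ≤⟨ ℚ.+-monoʳ-≤ (f 0 * ∑≤ (suc K) g) (∑≤-conv K f⁺ g (λ k → 0≤f (suc k)) 0≤g) ⟩
    f 0 * ∑≤ (suc K) g + ∑≤ K f⁺ * ∑≤ K g
      ≤⟨ ℚ.+-monoʳ-≤ (f 0 * ∑≤ (suc K) g) (≤-mulˡ (∑≤ K f⁺) (∑≤-nonNeg K (λ k → 0≤f (suc k))) (≤-+ʳ (∑≤ K g) (0≤g (suc K)))) ⟩
    f 0 * ∑≤ (suc K) g + ∑≤ K f⁺ * ∑≤ (suc K) g
      ≡⟨ sym (ℚ.*-distribʳ-+ (∑≤ (suc K) g) (f 0) (∑≤ K f⁺)) ⟩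
    (f 0 + ∑≤ K f⁺) * ∑≤ (suc K) g
      ≡⟨ cong (_* ∑≤ (suc K) g) (sym (∑≤-front K f)) ⟩
    ∑≤ (suc K) f * ∑≤ (suc K) g ∎
    where
    open ℚ.≤-Reasoning
    f⁺ : ℕ → ℚ
    f⁺ i = f (suc i)
    e₁ : ∀ a b c d → a * b + (a * c + d) ≡ a * (b + c) + d
    e₁ = solve-∀ ℚ-ring

  term : ℚ → ℕ → ℚ
  term x k = x ^ k * invFact k

  term-nonNeg : ∀ {x} → 0ℚ ≤ x → ∀ k → 0ℚ ≤ term x k
  term-nonNeg 0≤x k = 0≤-* (^-nonNeg k 0≤x) (invFact≥0 k)

  term-suc : ∀ x k → ι (suc k) * term x (suc k) ≡ x * term x k
  term-suc x k = trans (e (ι (suc k)) x (x ^ k) (invFact (suc k))) (cong (λ z → x * (x ^ k * z)) (invFact-suc k))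
    where
    e : ∀ t x p i → t * (x * p * i) ≡ x * (p * (t * i))
    e = solve-∀ ℚ-ring

  -- The binomial theorem without binomial coefficients: both sides start at 1 and satisfy (k + 1)
  -- c(k + 1) = (x + y) c(k), the left one by `conv-weight` and `term-suc`.
  conv-term : ∀ x y k → conv (term x) (term y) k ≡ term (x + y) k
  conv-term x y zero    = refl
  conv-term x y (suc k) = ≡-cancelˡ (ι (suc k)) (0<ι k) (begin
    ι (suc k) * conv (term x) (term y) (suc k)
      ≡⟨ sym (conv-weight (term x) (term y) (suc k)) ⟩
    0ℚ * term x 0 * term y (suc k) + conv (λ i → ι (suc i) * term x (suc i)) (term y) k + conv (term x) (λ j → ι j * term y j) (suc k)
      ≡⟨ cong₂ _+_ (cong (0ℚ * term x 0 * term y (suc k) +_) (trans (conv-cong (term-suc x) (λ j → sym (ℚ.*-identityˡ (term y j))) k) (conv-* x 1ℚ (term x) (term y) k)))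
                   (trans (conv-last (term x) (λ j → ι j * term y j) k)
                     (cong (_+ term x (suc k) * (0ℚ * term y 0)) (trans (conv-cong (λ i → sym (ℚ.*-identityˡ (term x i))) (term-suc y) k) (conv-* 1ℚ y (term x) (term y) k)))) ⟩
    0ℚ * term x 0 * term y (suc k) + x * 1ℚ * c + (1ℚ * y * c + term x (suc k) * (0ℚ * term y 0))
      ≡⟨ e x y c (term x 0) (term y (suc k)) (term x (suc k)) (term y 0) ⟩
    (x + y) * c
      ≡⟨ cong ((x + y) *_) (conv-term x y k) ⟩
    (x + y) * term (x + y) k
      ≡⟨ sym (term-suc (x + y) k) ⟩
    ι (suc k) * term (x + y) (suc k) ∎)
    where
    open ≡-Reasoning
    c = conv (term x) (term y) k
    e : ∀ x y c p q r s → 0ℚ * p * q + x * 1ℚ * c + (1ℚ * y * c + r * (0ℚ * s)) ≡ (x + y) * c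
    e = solve-∀ ℚ-ring

  1^ : ∀ k → 1ℚ ^ k ≡ 1ℚ
  1^ zero    = refl
  1^ (suc k) = trans (ℚ.*-identityˡ (1ℚ ^ k)) (1^ k)

  -- The truncated series of eⁿ consists of some of the products in the n-th power of the truncated
  -- series of e; induction along 1 + n.
  ∑≤-term≤expSeq^ : ∀ n K → ∑≤ K (term (ι n)) ≤ expSeq K ^ n
  ∑≤-term≤expSeq^ zero K = ℚ.≤-reflexive (only-first K)
    where
    only-first : ∀ K → ∑≤ K (term 0ℚ) ≡ 1ℚ
    only-first zero    = refl
    only-first (suc K) = cong₂ _+_ (only-first K) (e (0ℚ ^ K) (invFact (suc K)))
      where
      e : ∀ a b → 0ℚ * a * b ≡ 0ℚ
      e = solve-∀ ℚ-ring
  ∑≤-term≤expSeq^ (suc n) K = begin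
    ∑≤ K (term (1ℚ + ι n))                  ≡⟨ ∑≤-cong K (λ k → sym (conv-term 1ℚ (ι n) k)) ⟩
    ∑≤ K (conv (term 1ℚ) (term (ι n)))      ≤⟨ ∑≤-conv K (term 1ℚ) (term (ι n)) (term-nonNeg 0≤1) (term-nonNeg (0≤ι n)) ⟩
    ∑≤ K (term 1ℚ) * ∑≤ K (term (ι n))      ≡⟨ cong (_* ∑≤ K (term (ι n))) (trans (∑≤-cong K (λ k → trans (cong (_* invFact k) (1^ k)) (ℚ.*-identityˡ (invFact k)))) (sym (expSeq≡∑≤ K))) ⟩
    expSeq K * ∑≤ K (term (ι n))            ≤⟨ ≤-mulˡ (expSeq K) (ℚ.≤-trans 0≤1 (expSeq≥1 K)) (∑≤-term≤expSeq^ n K) ⟩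
    expSeq K * expSeq K ^ n                 ∎
    where open ℚ.≤-Reasoning

  -- The terms of the series of eⁿ from nⁿ/n! onwards

  module _ (m : ℕ) where

    private
      n = suc m
      x = ι n
      u : ℕ → ℚ
      u j = term x (n ℕ.+ j)

      0≤u : ∀ j → 0ℚ ≤ u j
      0≤u j = term-nonNeg (0≤ι n) (n ℕ.+ j)

      u-suc : ∀ j → x * u (suc j) + ι (suc j) * u (suc j) ≡ x * u j
      u-suc j = begin
        x * u (suc j) + ι (suc j) * u (suc j)          ≡⟨ sym (ℚ.*-distribʳ-+ (u (suc j)) x (ι (suc j))) ⟩
        (x + ι (suc j)) * u (suc j)                    ≡⟨ cong (_* u (suc j)) (sym (ι-+ n (suc j))) ⟩
        ι (n ℕ.+ suc j) * term x (n ℕ.+ suc j)         ≡⟨ cong (λ k → ι k * term x k) (ℕ.+-suc n j) ⟩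
        ι (suc (n ℕ.+ j)) * term x (suc (n ℕ.+ j))     ≡⟨ term-suc x (n ℕ.+ j) ⟩
        x * u j                                        ∎
        where open ≡-Reasoning

      u≤u₀ : ∀ j → u j ≤ u 0
      u≤u₀ zero    = ℚ.≤-refl
      u≤u₀ (suc j) = ℚ.≤-trans (≤-cancelˡ x (0<ι m) (subst (x * u (suc j) ≤_) (u-suc j)
        (≤-+ʳ (x * u (suc j)) (0≤-* (0≤ι (suc j)) (0≤u (suc j)))))) (u≤u₀ j)

      -- By `u-suc` the step from j to j + 1 lowers n u by (j + 1) u(j + 1), which is at most (j +
      -- 1) u(0), and 1 + ... + j ≤ j².
      u-lower : ∀ j → x * u 0 ≤ x * u j + ι (j ℕ.* j) * u 0
      u-lower zero    = ≤-+ʳ (x * u 0) (ℚ.≤-reflexive (sym (ℚ.*-zeroˡ (u 0))))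
      u-lower (suc j) = begin
        x * u 0                                                        ≤⟨ u-lower j ⟩
        x * u j + ι (j ℕ.* j) * u 0                                    ≡⟨ cong (_+ ι (j ℕ.* j) * u 0) (sym (u-suc j)) ⟩
        x * u (suc j) + ι (suc j) * u (suc j) + ι (j ℕ.* j) * u 0      ≤⟨ ℚ.+-monoˡ-≤ (ι (j ℕ.* j) * u 0) (ℚ.+-monoʳ-≤ (x * u (suc j)) (≤-mulˡ (ι (suc j)) (0≤ι (suc j)) (u≤u₀ (suc j)))) ⟩
        x * u (suc j) + ι (suc j) * u 0 + ι (j ℕ.* j) * u 0            ≡⟨ e (x * u (suc j)) (ι (suc j)) (ι (j ℕ.* j)) (u 0) ⟩
        x * u (suc j) + (ι (suc j) + ι (j ℕ.* j)) * u 0                ≡⟨ cong (λ z → x * u (suc j) + z * u 0) (sym (ι-+ (suc j) (j ℕ.* j))) ⟩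
        x * u (suc j) + ι (suc j ℕ.+ j ℕ.* j) * u 0                    ≤⟨ ℚ.+-monoʳ-≤ (x * u (suc j)) (≤-mulʳ (u 0) (0≤u 0) (ι-mono (ℕ.+-monoʳ-≤ (suc j) (ℕ.*-monoʳ-≤ j (ℕ.n≤1+n j))))) ⟩
        x * u (suc j) + ι (suc j ℕ.* suc j) * u 0                      ∎
        where
        open ℚ.≤-Reasoning
        e : ∀ a b c d → a + b * d + c * d ≡ a + (b + c) * d
        e = solve-∀ ℚ-ring

      u-three-quarters : ∀ j → 4 ℕ.* (j ℕ.* j) ℕ.≤ n → ι 3 * u 0 ≤ ι 4 * u j
      u-three-quarters j 4j²≤n = ≤-cancelˡ x (0<ι m) (subst₂ _≤_ (e₁ x (u 0)) (e₂ x (u 0) (u j)) (ℚ.+-monoˡ-≤ (- (x * u 0)) (begin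
        ι 4 * (x * u 0)                                ≤⟨ ≤-mulˡ (ι 4) (0≤ι 4) (u-lower j) ⟩
        ι 4 * (x * u j + ι (j ℕ.* j) * u 0)            ≡⟨ e₃ (x * u j) (ι (j ℕ.* j)) (u 0) ⟩
        ι 4 * (x * u j) + ι 4 * ι (j ℕ.* j) * u 0      ≡⟨ cong (λ z → ι 4 * (x * u j) + z * u 0) (sym (ι-* 4 (j ℕ.* j))) ⟩
        ι 4 * (x * u j) + ι (4 ℕ.* (j ℕ.* j)) * u 0    ≤⟨ ℚ.+-monoʳ-≤ (ι 4 * (x * u j)) (≤-mulʳ (u 0) (0≤u 0) (ι-mono 4j²≤n)) ⟩
        ι 4 * (x * u j) + x * u 0                      ∎)))
        where
        open ℚ.≤-Reasoning
        e₁ : ∀ x a → (1ℚ + (1ℚ + (1ℚ + (1ℚ + 0ℚ)))) * (x * a) + - (x * a) ≡ x * ((1ℚ + (1ℚ + (1ℚ + 0ℚ))) * a)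
        e₁ = solve-∀ ℚ-ring
        e₂ : ∀ x a b → (1ℚ + (1ℚ + (1ℚ + (1ℚ + 0ℚ)))) * (x * b) + x * a + - (x * a) ≡ x * ((1ℚ + (1ℚ + (1ℚ + (1ℚ + 0ℚ)))) * b)
        e₂ = solve-∀ ℚ-ring
        e₃ : ∀ a b c → (1ℚ + (1ℚ + (1ℚ + (1ℚ + 0ℚ)))) * (a + b * c) ≡ (1ℚ + (1ℚ + (1ℚ + (1ℚ + 0ℚ)))) * a + (1ℚ + (1ℚ + (1ℚ + (1ℚ + 0ℚ)))) * b * c
        e₃ = solve-∀ ℚ-ring

    -- The J + 1 terms of the series of eⁿ next to nⁿ/n! are within a factor ¾ of it;
    -- for J ≈ √n / 2 this is Stirling's bound up to a constant.
    expSeq^-lower : ∀ J K → 4 ℕ.* (J ℕ.* J) ℕ.≤ n → n ℕ.+ J ℕ.≤ K → ι (suc J) * (ι 3 * term x n) ≤ ι 4 * expSeq K ^ n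
    expSeq^-lower J K 4J²≤n n+J≤K = begin
      ι (suc J) * (ι 3 * term x n)     ≡⟨ cong (λ k → ι (suc J) * (ι 3 * term x k)) (sym (ℕ.+-identityʳ n)) ⟩
      ι (suc J) * (ι 3 * u 0)          ≡⟨ sym (∑≤-const J (ι 3 * u 0)) ⟩
      ∑≤ J (λ _ → ι 3 * u 0)           ≤⟨ ∑≤-mono J (λ j j≤J → u-three-quarters j (ℕ.≤-trans (ℕ.*-monoʳ-≤ 4 (ℕ.*-mono-≤ j≤J j≤J)) 4J²≤n)) ⟩
      ∑≤ J (λ j → ι 4 * u j)           ≡⟨ ∑≤-*ˡ J (ι 4) u ⟩
      ι 4 * ∑≤ J u                     ≤⟨ ≤-mulˡ (ι 4) (0≤ι 4) (begin
          ∑≤ J u                         ≤⟨ ∑≤-tail n J (term x) (term-nonNeg (0≤ι n)) ⟩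
          ∑≤ (n ℕ.+ J) (term x)          ≤⟨ ∑≤-extend (term x) (term-nonNeg (0≤ι n)) (ℕ.≤⇒≤′ n+J≤K) ⟩
          ∑≤ K (term x)                  ≤⟨ ∑≤-term≤expSeq^ n K ⟩
          expSeq K ^ n                   ∎) ⟩
      ι 4 * expSeq K ^ n               ∎
      where open ℚ.≤-Reasoning

  -- The real lower bound

  1/32 : ℚ
  1/32 = ½ * ½ * ½ * ½ * ½

  -- Bernoulli's inequality from above: while 2 i η ≤ 1, the quadratic term 2 i η · η of a step is
  -- at most η.
  bernoulli : ∀ η → 0ℚ ≤ η → ∀ i → (ι i + ι i) * η ≤ 1ℚ → (1ℚ + η) ^ i ≤ 1ℚ + (ι i + ι i) * η
  bernoulli η 0≤η zero    h = ≤-+ʳ 1ℚ (ℚ.≤-reflexive (sym (ℚ.*-zeroˡ η)))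
  bernoulli η 0≤η (suc i) h = begin
    (1ℚ + η) * (1ℚ + η) ^ i              ≤⟨ ≤-mulˡ (1ℚ + η) (0≤-+ 0≤1 0≤η) (bernoulli η 0≤η i (ℚ.≤-trans smaller h)) ⟩
    (1ℚ + η) * (1ℚ + 2iη)                ≡⟨ e₁ η (ι i) ⟩
    1ℚ + 2iη + (η + 2iη * η)             ≤⟨ ℚ.+-monoʳ-≤ (1ℚ + 2iη) (ℚ.+-monoʳ-≤ η (≤-mulʳ η 0≤η (ℚ.≤-trans smaller h))) ⟩
    1ℚ + 2iη + (η + 1ℚ * η)              ≡⟨ e₂ η (ι i) ⟩
    1ℚ + (ι (suc i) + ι (suc i)) * η     ∎
    where
    open ℚ.≤-Reasoning
    2iη = (ι i + ι i) * η
    smaller : (ι i + ι i) * η ≤ (ι (suc i) + ι (suc i)) * η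
    smaller = ≤-mulʳ η 0≤η (ℚ.+-mono-≤ (ι-mono (ℕ.n≤1+n i)) (ι-mono (ℕ.n≤1+n i)))
    e₁ : ∀ η i → (1ℚ + η) * (1ℚ + (i + i) * η) ≡ 1ℚ + (i + i) * η + (η + (i + i) * η * η)
    e₁ = solve-∀ ℚ-ring
    e₂ : ∀ η i → 1ℚ + (i + i) * η + (η + 1ℚ * η) ≡ 1ℚ + (1ℚ + i + (1ℚ + i)) * η
    e₂ = solve-∀ ℚ-ring

  -- Since r ≥ ¼, the additive error ¼ η is a relative error of at most η. Its effect on x ^ n is
  -- then (1 + η)ⁿ squared, at most (5/4)² ≤ 2.
  root-growth : ∀ n x r η → 0ℚ ≤ η → 0ℚ ≤ x → 0ℚ ≤ r → ½ * ½ ≤ r → x ≤ (r + ½ * ½ * η) * (r + ½ * ½ * η) →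
                (1ℚ + η) ^ n ≤ 1ℚ + ½ * ½ → x ^ n ≤ (1ℚ + 1ℚ) * (r * r) ^ n
  root-growth n x r η 0≤η 0≤x 0≤r ¼≤r x≤ growth = begin
    x ^ n                                                 ≤⟨ ^-mono-≤ n 0≤x base ⟩
    (r * r * ((1ℚ + η) * (1ℚ + η))) ^ n                   ≡⟨ ^-distrib-* (r * r) ((1ℚ + η) * (1ℚ + η)) n ⟩
    (r * r) ^ n * ((1ℚ + η) * (1ℚ + η)) ^ n               ≡⟨ cong ((r * r) ^ n *_) (^-distrib-* (1ℚ + η) (1ℚ + η) n) ⟩
    (r * r) ^ n * ((1ℚ + η) ^ n * (1ℚ + η) ^ n)           ≤⟨ ≤-mulˡ ((r * r) ^ n) (^-nonNeg n (0≤-² r)) (*-mono-≤ 0≤p 0≤p growth growth) ⟩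
    (r * r) ^ n * ((1ℚ + ½ * ½) * (1ℚ + ½ * ½))           ≤⟨ ≤-mulˡ ((r * r) ^ n) (^-nonNeg n (0≤-² r)) (ℚ.≤ᵇ⇒≤ _) ⟩
    (r * r) ^ n * (1ℚ + 1ℚ)                               ≡⟨ ℚ.*-comm ((r * r) ^ n) (1ℚ + 1ℚ) ⟩
    (1ℚ + 1ℚ) * (r * r) ^ n                               ∎
    where
    open ℚ.≤-Reasoning
    e₁ : ∀ r η → r * (1ℚ + η) * (r * (1ℚ + η)) ≡ r * r * ((1ℚ + η) * (1ℚ + η))
    e₁ = solve-∀ ℚ-ring
    e₂ : ∀ r η → r + r * η ≡ r * (1ℚ + η)
    e₂ = solve-∀ ℚ-ring
    0≤p = ^-nonNeg n (0≤-+ 0≤1 0≤η)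
    r+δ≤ : r + ½ * ½ * η ≤ r * (1ℚ + η)
    r+δ≤ = subst (r + ½ * ½ * η ≤_) (e₂ r η) (ℚ.+-monoʳ-≤ r (≤-mulʳ η 0≤η ¼≤r))
    0≤r+δ : 0ℚ ≤ r + ½ * ½ * η
    0≤r+δ = 0≤-+ 0≤r (0≤-* (ℚ.nonNegative⁻¹ (½ * ½)) 0≤η)
    base : x ≤ r * r * ((1ℚ + η) * (1ℚ + η))
    base = begin
      x                                           ≤⟨ x≤ ⟩
      (r + ½ * ½ * η) * (r + ½ * ½ * η)           ≤⟨ *-mono-≤ 0≤r+δ 0≤r+δ r+δ≤ r+δ≤ ⟩
      r * (1ℚ + η) * (r * (1ℚ + η))               ≡⟨ e₁ r η ⟩
      r * r * ((1ℚ + η) * (1ℚ + η))               ∎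

  √eSeq : ℕ → ℚ
  √eSeq k = sqrtApprox (expSeq k) k

  √eSeq-pos : ∃ λ K → ∀ k → K ℕ.≤ k → ½ * ½ < √eSeq k
  √eSeq-pos = proj₁ sqrt-expSeq-lower , λ k K≤k →
    ℚ.≤-<-trans (ℚ.≤-reflexive (sym (ℚ.+-identityˡ (½ * ½)))) (proj₂ sqrt-expSeq-lower k K≤k)

  -- At a finite index the square of the approximation to √e falls short of the partial sum of e;
  -- for fixed n the n-th powers still agree up to a factor 2 from some index on.
  expSeq^≤2√eSeq^ : ∀ m → ∃ λ K → ∀ k → K ℕ.≤ k → expSeq k ^ suc m ≤ (1ℚ + 1ℚ) * (√eSeq k * √eSeq k) ^ suc m
  expSeq^≤2√eSeq^ m =
    -- η = 1/(8 n), so that 2 n η = ¼ and `bernoulli` bounds (1 + η)ⁿ by 5/4.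
    let η , 0<η , 2nη≡¼ = quotient {½ * ½} {ι (suc m) + ι (suc m)} (ℚ.positive⁻¹ (½ * ½)) (ℚ.+-mono-< (0<ι m) (0<ι m))
        0≤η    = ℚ.<⇒≤ 0<η
        K , f  = archimedean (pos-* (ℚ.positive⁻¹ (½ * ½)) 0<η)
        K′ , g = √eSeq-pos
        growth : (1ℚ + η) ^ suc m ≤ 1ℚ + ½ * ½
        growth = ℚ.≤-trans (bernoulli η 0≤η (suc m) (ℚ.≤-trans (ℚ.≤-reflexive 2nη≡¼) (ℚ.≤ᵇ⇒≤ _)))
                   (ℚ.+-monoʳ-≤ 1ℚ (ℚ.≤-reflexive 2nη≡¼))
    in K ℕ.⊔ K′ , λ k h → root-growth (suc m) (expSeq k) (√eSeq k) η 0≤η (ℚ.≤-trans 0≤1 (expSeq≥1 k))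
         (sqrtApprox≥0 (expSeq k) k) (ℚ.<⇒≤ (g k (ℕ.m⊔n≤o⇒n≤o K K′ h)))
         (ℚ.≤-trans (p≤∣p∣ (expSeq k)) (ℚ.<⇒≤ (sqrtApprox-upper (expSeq k) k (f k (ℕ.m⊔n≤o⇒m≤o K K′ h)))))
         growth

  -- J = ⌊√n / 2⌋. The lower half admits J + 1 terms in the Stirling bound; the upper half gives
  -- n^(3/2) ≤ 2 n (J + 1). Thus √n is replaced by J + 1 throughout.
  half-sqrt : ∀ n → ∃ λ J → 4 ℕ.* (J ℕ.* J) ℕ.≤ n × n ℕ.< 4 ℕ.* (suc J ℕ.* suc J)
  half-sqrt zero = 0 , ℕ.z≤n , ℕ.s≤s ℕ.z≤n
  half-sqrt (suc n) with half-sqrt n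
  ... | J , lower , upper with suc n ℕ.<? 4 ℕ.* (suc J ℕ.* suc J)
  ...   | yes h = J , ℕ.m≤n⇒m≤1+n lower , h
  ...   | no ¬h = suc J , ℕ.≮⇒≥ ¬h , ℕ.≤-<-trans upper (ℕ.*-monoʳ-< 4 (ℕ.*-mono-< (ℕ.n<1+n (suc J)) (ℕ.n<1+n (suc J))))

  seq-^ : ∀ x n k → seq (x ℝ.^ n) k ≡ seq x k ^ n
  seq-^ x zero    k = refl
  seq-^ x (suc n) k = cong (seq x k *_) (seq-^ x n k)

  -- `sqrtApprox` never exceeds the root, so s² ≤ r and r² ≤ n³ carry no error term, and n < 4 (J +
  -- 1)² bounds n³ by the square of 2 n (J + 1).
  square-root-bound : ∀ n J v r s → v ≡ ι n * (ι n * (ι n * 1ℚ)) → n ℕ.< 4 ℕ.* (suc J ℕ.* suc J) →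
                      0ℚ ≤ r → r * r ≤ ∣ v ∣ → s * s ≤ ∣ r ∣ → s * s ≤ (1ℚ + 1ℚ) * (ι n * ι (suc J))
  square-root-bound n J v r s v≡ upper 0≤r r² s² = begin
    s * s          ≤⟨ s² ⟩
    ∣ r ∣          ≡⟨ ℚ.0≤p⇒∣p∣≡p 0≤r ⟩
    r              ≤⟨ square-cancel-≤ (0≤-* (0≤-+ 0≤1 0≤1) (0≤-* (0≤ι n) (0≤ι (suc J)))) r²≤ ⟩
    2nJ            ∎
    where
    open ℚ.≤-Reasoning
    2nJ = (1ℚ + 1ℚ) * (ι n * ι (suc J))
    e₁ : ∀ n → n * (n * (n * 1ℚ)) ≡ n * n * n
    e₁ = solve-∀ ℚ-ring
    e₂ : ∀ n j → n * n * ((1ℚ + (1ℚ + (1ℚ + (1ℚ + 0ℚ)))) * (j * j)) ≡ (1ℚ + 1ℚ) * (n * j) * ((1ℚ + 1ℚ) * (n * j))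
    e₂ = solve-∀ ℚ-ring
    0≤v : 0ℚ ≤ v
    0≤v = ℚ.≤-trans (0≤-* (0≤ι n) (0≤-* (0≤ι n) (0≤-* (0≤ι n) 0≤1))) (ℚ.≤-reflexive (sym v≡))
    r²≤ : r * r ≤ 2nJ * 2nJ
    r²≤ = begin
      r * r                                       ≤⟨ r² ⟩
      ∣ v ∣                                       ≡⟨ trans (ℚ.0≤p⇒∣p∣≡p 0≤v) (trans v≡ (e₁ (ι n))) ⟩
      ι n * ι n * ι n                             ≤⟨ ≤-mulˡ (ι n * ι n) (0≤-² (ι n)) (ι-mono (ℕ.<⇒≤ upper)) ⟩
      ι n * ι n * ι (4 ℕ.* (suc J ℕ.* suc J))     ≡⟨ cong (ι n * ι n *_) (trans (ι-* 4 (suc J ℕ.* suc J)) (cong (ι 4 *_) (ι-* (suc J) (suc J)))) ⟩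
      ι n * ι n * (ι 4 * (ι (suc J) * ι (suc J))) ≡⟨ e₂ (ι n) (ι (suc J)) ⟩
      2nJ * 2nJ                                   ∎

  SquareBounded : ℝ → ℚ → Set
  SquareBounded y b = ∀ k → seq y k * seq y k ≤ b

  √√-square : ∀ x n J → (∀ k → seq x k ≡ ι n ^ 3) → n ℕ.< 4 ℕ.* (suc J ℕ.* suc J) →
              SquareBounded (√ √ x) ((1ℚ + 1ℚ) * (ι n * ι (suc J)))
  √√-square x n J x≡ upper k = square-root-bound n J (seq x k) (seq (√ x) k) (seq (√ √ x) k)
    (x≡ k) upper (sqrtApprox≥0 (seq x k) k) (sqrtApprox-lower (seq x k) k) (sqrtApprox-lower (seq (√ x) k) k)

  fromℕ^3 : ∀ n k → seq (fromℕ n ℝ.^ 3) k ≡ ι n ^ 3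
  fromℕ^3 n k = trans (seq-^ (fromℕ n) 3 k) (cong (_^ 3) (sym (ι≡/1 n)))

  -- Stated separately so that _^¾ is unfolded without unfolding the square roots.
  ^¾≡√√ : ∀ n → n ^¾ ≡ √ √ (fromℕ n ℝ.^ 3)
  ^¾≡√√ n = refl

  ^¾-square : ∀ n J → n ℕ.< 4 ℕ.* (suc J ℕ.* suc J) → SquareBounded (n ^¾) ((1ℚ + 1ℚ) * (ι n * ι (suc J)))
  ^¾-square n J upper = subst (λ y → SquareBounded y ((1ℚ + 1ℚ) * (ι n * ι (suc J)))) (sym (^¾≡√√ n))
    (√√-square (fromℕ n ℝ.^ 3) n J (fromℕ^3 n) upper)

  -- Combination of the size bound with the Stirling bound

  four : ℚ
  four = (1ℚ + 1ℚ) * (1ℚ + 1ℚ)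

  -- Clears the denominator of (m/4)^l; the 4^l on the left becomes the power of 2 in the final
  -- bound.
  rescale : ∀ l a b x s → a * (½ * ½) ≤ s * (b * (x * (½ * ½)) ^ l) → a * four ^ l * (½ * ½) ≤ s * (b * x ^ l)
  rescale l a b x s h = begin
    a * four ^ l * (½ * ½)                       ≡⟨ e₁ a (four ^ l) (½ * ½) ⟩
    a * (½ * ½) * four ^ l                       ≤⟨ ≤-mulʳ (four ^ l) (^-nonNeg l (0≤-² (1ℚ + 1ℚ))) h ⟩
    s * (b * (x * (½ * ½)) ^ l) * four ^ l       ≡⟨ e₂ s b ((x * (½ * ½)) ^ l) (four ^ l) ⟩
    s * (b * ((x * (½ * ½)) ^ l * four ^ l))     ≡⟨ cong (λ z → s * (b * z)) (sym (^-distrib-* (x * (½ * ½)) four l)) ⟩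
    s * (b * (x * (½ * ½) * four) ^ l)           ≡⟨ cong (λ z → s * (b * z ^ l)) (trans (ℚ.*-assoc x (½ * ½) four) (ℚ.*-identityʳ x)) ⟩
    s * (b * x ^ l)                              ∎
    where
    open ℚ.≤-Reasoning
    e₁ : ∀ a b c → a * b * c ≡ a * c * b
    e₁ = solve-∀ ℚ-ring
    e₂ : ∀ a b c d → a * (b * c) * d ≡ a * (b * (c * d))
    e₂ = solve-∀ ℚ-ring

  -- With ν = n, μ = m, M = m^(m-1), U = n^(m-1), f = m!, F = n!, P = 4^(m-1),
  -- R = r^(2n) and p = (2/r)^n for an approximation r of √e.
  combine-bounds : ∀ ν μ M U f F j P R s t p → 0ℚ < R → 0ℚ < ν * M * F → 0ℚ ≤ ν → 0ℚ ≤ μ → 0ℚ ≤ M → 0ℚ ≤ U → 0ℚ ≤ f → 0ℚ ≤ j → 0ℚ ≤ P → 0ℚ ≤ t →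
                   F ≡ ν * f → R * (p * p) ≡ four * (four * P) → ν ≤ ι 3 * μ → M ≤ U →
                   s * s ≤ (1ℚ + 1ℚ) * (ν * j) →
                   ½ * ½ * ½ * (ι 3 * j * (ν * (ν * U))) ≤ R * F →
                   μ * f * P * (½ * ½) ≤ t * t * (ν * M) →
                   1/32 * s * p ≤ t
  combine-bounds ν μ M U f F j P R s t p 0<R 0<Q 0≤ν 0≤μ 0≤M 0≤U 0≤f 0≤j 0≤P 0≤t F≡ Rp² ν≤3μ M≤U s² stirling size =
    square-cancel-≤ 0≤t (≤-cancelˡ (R * Q) (pos-* 0<R 0<Q) (begin
      R * Q * (1/32 * s * p * (1/32 * s * p))                                  ≡⟨ e₁ R Q 1/32 s p ⟩
      1/32 * 1/32 * Q * (s * s) * (R * (p * p))                                ≡⟨ cong (1/32 * 1/32 * Q * (s * s) *_) Rp² ⟩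
      1/32 * 1/32 * Q * (s * s) * (four * (four * P))                          ≤⟨ ≤-mulʳ (four * (four * P)) (0≤-* 0≤four (0≤-* 0≤four 0≤P))
                                                                                    (≤-mulˡ (1/32 * 1/32 * Q) (0≤-* (0≤-² 1/32) (ℚ.<⇒≤ 0<Q)) s²) ⟩
      1/32 * 1/32 * Q * ((1ℚ + 1ℚ) * (ν * j)) * (four * (four * P))            ≡⟨ cong (λ z → 1/32 * 1/32 * (ν * M * z) * ((1ℚ + 1ℚ) * (ν * j)) * (four * (four * P))) F≡ ⟩
      1/32 * 1/32 * (ν * M * (ν * f)) * ((1ℚ + 1ℚ) * (ν * j)) * (four * (four * P))  ≡⟨ e₂ ν M f j P 1/32 (1ℚ + 1ℚ) four ⟩
      -- The origin of the constant: 2 · 4 · 4 = 32 turns 1/32² into 1/32, which splits below as ¼ ·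
      -- ⅛, the factors carried by the size bound and the Stirling bound.
      1/32 * 1/32 * ((1ℚ + 1ℚ) * (four * four)) * (ν * (ν * ν * M) * (j * f * P))    ≡⟨⟩
      1/32 * (ν * (ν * ν * M) * (j * f * P))                                   ≤⟨ ≤-mulˡ 1/32 (ℚ.nonNegative⁻¹ 1/32) (≤-mulʳ (j * f * P) (0≤-* (0≤-* 0≤j 0≤f) 0≤P)
                                                                                    (*-mono-≤ 0≤ν (0≤-* (0≤-² ν) 0≤M) ν≤3μ (≤-mulˡ (ν * ν) (0≤-² ν) M≤U))) ⟩
      1/32 * (ι 3 * μ * (ν * ν * U) * (j * f * P))                             ≡⟨ e₃ (½ * ½) (½ * ½ * ½) (ι 3) μ ν U f j P ⟩
      μ * f * P * (½ * ½) * (½ * ½ * ½ * (ι 3 * j * (ν * (ν * U))))            ≤⟨ *-mono-≤ 0≤size 0≤stirling size stirling ⟩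
      t * t * (ν * M) * (R * F)                                                ≡⟨ e₄ t ν M R F ⟩
      R * Q * (t * t)                                                          ∎))
    where
    open ℚ.≤-Reasoning
    Q = ν * M * F
    0≤four : 0ℚ ≤ four
    0≤four = ℚ.nonNegative⁻¹ four
    0≤size : 0ℚ ≤ μ * f * P * (½ * ½)
    0≤size = 0≤-* (0≤-* (0≤-* 0≤μ 0≤f) 0≤P) (ℚ.nonNegative⁻¹ (½ * ½))
    0≤stirling : 0ℚ ≤ ½ * ½ * ½ * (ι 3 * j * (ν * (ν * U)))
    0≤stirling = 0≤-* (ℚ.nonNegative⁻¹ (½ * ½ * ½)) (0≤-* (0≤-* (0≤ι 3) 0≤j) (0≤-* 0≤ν (0≤-* 0≤ν 0≤U)))
    e₁ : ∀ R Q c s p → R * Q * (c * s * p * (c * s * p)) ≡ c * c * Q * (s * s) * (R * (p * p))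
    e₁ = solve-∀ ℚ-ring
    e₂ : ∀ ν M f j p c t q → c * c * (ν * M * (ν * f)) * (t * (ν * j)) * (q * (q * p)) ≡ c * c * (t * (q * q)) * (ν * (ν * ν * M) * (j * f * p))
    e₂ = solve-∀ ℚ-ring
    e₃ : ∀ a b h m ν u f j p → a * b * (h * m * (ν * ν * u) * (j * f * p)) ≡ m * f * p * a * (b * (h * j * (ν * (ν * u))))
    e₃ = solve-∀ ℚ-ring
    e₄ : ∀ t ν M R F → t * t * (ν * M) * (R * F) ≡ R * (ν * M * F) * (t * t)
    e₄ = solve-∀ ℚ-ring

  ^-pos : ∀ k {q} → 0ℚ < q → 0ℚ < q ^ k
  ^-pos zero    0<q = ℚ.positive⁻¹ 1ℚ
  ^-pos (suc k) 0<q = pos-* 0<q (^-pos k 0<q)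

  -- Clears 1/n! from the Stirling bound. The ⅛ absorbs the 4 of the ratio ¾ and the 2 of
  -- `expSeq^≤2√eSeq^`.
  cancel-factorial : ∀ j N F i R → 0ℚ ≤ F → F * i ≡ 1ℚ → j * (ι 3 * (N * i)) ≤ ι 4 * ((1ℚ + 1ℚ) * R) →
                     ½ * ½ * ½ * (ι 3 * j * N) ≤ R * F
  cancel-factorial j N F i R 0≤F Fi≡1 h = begin
    ½ * ½ * ½ * (ι 3 * j * N)                        ≡⟨ e₁ (½ * ½ * ½) (ι 3) j N ⟩
    ½ * ½ * ½ * (j * (ι 3 * (N * 1ℚ)))               ≡⟨ cong (λ z → ½ * ½ * ½ * (j * (ι 3 * (N * z)))) (sym Fi≡1) ⟩
    ½ * ½ * ½ * (j * (ι 3 * (N * (F * i))))          ≡⟨ e₂ (½ * ½ * ½) (ι 3) j N F i ⟩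
    ½ * ½ * ½ * F * (j * (ι 3 * (N * i)))            ≤⟨ ≤-mulˡ (½ * ½ * ½ * F) (0≤-* (ℚ.nonNegative⁻¹ (½ * ½ * ½)) 0≤F) h ⟩
    ½ * ½ * ½ * F * (ι 4 * ((1ℚ + 1ℚ) * R))          ≡⟨ e₃ (½ * ½ * ½) (ι 4) (1ℚ + 1ℚ) F R ⟩
    ½ * ½ * ½ * (ι 4 * (1ℚ + 1ℚ)) * (R * F)          ≡⟨ ℚ.*-identityˡ (R * F) ⟩
    R * F                                            ∎
    where
    open ℚ.≤-Reasoning
    e₁ : ∀ a h j p → a * (h * j * p) ≡ a * (j * (h * (p * 1ℚ)))
    e₁ = solve-∀ ℚ-ring
    e₂ : ∀ a h j p f i → a * (j * (h * (p * (f * i)))) ≡ a * f * (j * (h * (p * i)))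
    e₂ = solve-∀ ℚ-ring
    e₃ : ∀ a b c f r → a * f * (b * (c * r)) ≡ a * (b * c) * (r * f)
    e₃ = solve-∀ ℚ-ring

  power-cancel : ∀ n r i → r * i ≡ 1ℚ → (r * r) ^ n * (((1ℚ + 1ℚ) * i) ^ n * ((1ℚ + 1ℚ) * i) ^ n) ≡ four ^ n
  power-cancel n r i ri≡1 = begin
    (r * r) ^ n * (p ^ n * p ^ n)       ≡⟨ cong ((r * r) ^ n *_) (sym (^-distrib-* p p n)) ⟩
    (r * r) ^ n * (p * p) ^ n           ≡⟨ sym (^-distrib-* (r * r) (p * p) n) ⟩
    (r * r * (p * p)) ^ n               ≡⟨ cong (_^ n) (trans (e r i (1ℚ + 1ℚ)) (trans (cong (λ z → four * (z * z)) ri≡1) (ℚ.*-identityʳ four))) ⟩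
    four ^ n                            ∎
    where
    open ≡-Reasoning
    p = (1ℚ + 1ℚ) * i
    e : ∀ r i c → r * r * (c * i * (c * i)) ≡ c * c * (r * i * (r * i))
    e = solve-∀ ℚ-ring

  -- The whole estimate at one index: r stands for √e and i for its inverse, s for n^(3/4), t for
  -- the total size.
  index-bound : ∀ l J r i s t → 0ℚ < r → r * i ≡ 1ℚ → 0ℚ ≤ t →
                s * s ≤ (1ℚ + 1ℚ) * (ι (suc (suc l)) * ι (suc J)) →
                ι (suc J) * (ι 3 * term (ι (suc (suc l))) (suc (suc l))) ≤ ι 4 * ((1ℚ + 1ℚ) * (r * r) ^ (suc (suc l))) →
                ι (suc l) * ι (suc l !) * (½ * ½) ≤ t * t * (ι (suc (suc l)) * (ι (suc l) * (½ * ½)) ^ l) →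
                1/32 * s * ((1ℚ + 1ℚ) * i) ^ (suc (suc l)) ≤ t
  index-bound l J r i s t 0<r ri≡1 0≤t s² stirling size =
    combine-bounds (ι n) (ι m) (ι m ^ l) (ι n ^ l) (ι (m !)) (ι (n !)) (ι (suc J)) (four ^ l) ((r * r) ^ n) s t (((1ℚ + 1ℚ) * i) ^ n)
      (^-pos n (pos-* 0<r 0<r)) (pos-* (pos-* (0<ι m) (^-pos l (0<ι l))) (0<ι! n))
      (0≤ι n) (0≤ι m) (^-nonNeg l (0≤ι m)) (^-nonNeg l (0≤ι n)) (0≤ι (m !)) (0≤ι (suc J)) (^-nonNeg l (ℚ.nonNegative⁻¹ four)) 0≤t
      (ι-* n (m !)) (power-cancel n r i ri≡1) n≤3m (^-mono-≤ l (0≤ι m) (ι-mono (ℕ.n≤1+n m)))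
      s² (cancel-factorial (ι (suc J)) (ι n ^ n) (ι (n !)) (invFact n) ((r * r) ^ n) (0≤ι (n !)) (ι!*invFact n) stirling)
      (rescale l (ι m * ι (m !)) (ι n) (ι m) (t * t) size)
    where
    m = suc l
    n = suc m
    -- The factor 3 is chosen to meet the 3 of ¾ in the Stirling bound.
    n≤3m : ι n ≤ ι 3 * ι m
    n≤3m = ℚ.≤-trans (ι-mono (ℕ.s≤s (ℕ.≤-trans (ℕ.≤-reflexive (ℕ.+-comm 1 l)) (ℕ.+-monoʳ-≤ l (ℕ.s≤s ℕ.z≤n))))) (ℚ.≤-reflexive (ι-* 3 m))

  SizeBound : ℕ → ℝ → Set
  SizeBound l T = ∃ λ K → ∀ k → K ℕ.≤ k →
    0ℚ ≤ seq T k × ι (suc l) * ι (suc l !) * (½ * ½) ≤ seq T k * seq T k * (ι (suc (suc l)) * (ι (suc l) * (½ * ½)) ^ l)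

  -- The reals y, z and T are abstract and enter through their sequences only. Past the threshold
  -- the inequality between rationals holds without slack, so ε merely makes it strict.
  asymptotic-bound : ∀ l J (y z T : ℝ) → 4 ℕ.* (J ℕ.* J) ℕ.≤ suc (suc l) →
                     SquareBounded y ((1ℚ + 1ℚ) * (ι (suc (suc l)) * ι (suc J))) →
                     (∀ k → seq z k ≡ (1ℚ + 1ℚ) * inv (√eSeq k)) → SizeBound l T →
                     fromℚ 1/32 ℝ.* y ℝ.* z ℝ.^ (suc (suc l)) ℝ.≤ T
  asymptotic-bound l J y z T 4J²≤n y² z≡ (K₁ , size) = mk≤ λ ε 0<ε →
    -- In turn: the size bound, the comparison of e with the square of √e, the root bounded away
    -- from 0 so that `inv` inverts it, and partial sums of e long enough to contain the J + 1
    -- Stirling terms.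
    K₁ ℕ.⊔ (K₂ ℕ.⊔ (K₃ ℕ.⊔ (n ℕ.+ J))) , λ k h →
      let h₂ = ℕ.m⊔n≤o⇒n≤o K₁ _ h
          h₃ = ℕ.m⊔n≤o⇒n≤o K₂ _ h₂
          0≤T , size-k = size k (ℕ.m⊔n≤o⇒m≤o K₁ _ h)
      in ℚ.≤-<-trans
           (at k 0≤T size-k (growth k (ℕ.m⊔n≤o⇒m≤o K₂ _ h₂)) (ℚ.<-trans (ℚ.positive⁻¹ (½ * ½)) (positive-root k (ℕ.m⊔n≤o⇒m≤o K₃ _ h₃)))
               (ℕ.m⊔n≤o⇒n≤o K₃ _ h₃))
           (ℚ.≤-<-trans (ℚ.≤-reflexive (sym (ℚ.+-identityʳ (seq T k)))) (ℚ.+-monoʳ-< (seq T k) 0<ε))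
    where
    n = suc (suc l)
    K₂ = proj₁ (expSeq^≤2√eSeq^ (suc l))
    growth = proj₂ (expSeq^≤2√eSeq^ (suc l))
    K₃ = proj₁ √eSeq-pos
    positive-root = proj₂ √eSeq-pos
    at : ∀ k → 0ℚ ≤ seq T k → ι (suc l) * ι (suc l !) * (½ * ½) ≤ seq T k * seq T k * (ι n * (ι (suc l) * (½ * ½)) ^ l) →
         expSeq k ^ n ≤ (1ℚ + 1ℚ) * (√eSeq k * √eSeq k) ^ n → 0ℚ < √eSeq k → n ℕ.+ J ℕ.≤ k →
         1/32 * seq y k * seq (z ℝ.^ n) k ≤ seq T k
    at k 0≤T size-k growth-k 0<r n+J≤k = ℚ.≤-trans
      (ℚ.≤-reflexive (cong (1/32 * seq y k *_) (trans (seq-^ z n k) (cong (_^ n) (z≡ k)))))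
      (index-bound l J (√eSeq k) (inv (√eSeq k)) (seq y k) (seq T k) 0<r (inv-inverse 0<r) 0≤T (y² k)
        (ℚ.≤-trans (expSeq^-lower (suc l) J k 4J²≤n n+J≤k) (≤-mulˡ (ι 4) (0≤ι 4) growth-k)) size-k)

  2/√e≡ : 2/√e ≡ fromℕ 2 ℝ.* recip (√ ℝ.e) 0<√e
  2/√e≡ = refl

  2/√e-seq : ∀ k → seq 2/√e k ≡ (1ℚ + 1ℚ) * inv (√eSeq k)
  2/√e-seq k = cong (λ z → seq z k) 2/√e≡

  PHP-size : ∀ l (π : NullstellensatzProof (PHP (suc (suc l)))) → SizeBound l (totalCoefficientSize π)
  PHP-size l π = let μ , _ , mμ≡1 = quotient {1ℚ} {ι (suc l)} (ℚ.positive⁻¹ 1ℚ) (0<ι l) in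
    Pigeonhole.size-bound l μ mμ≡1 (isPHPAxiom (suc (suc l))) π

  PHP-lower-bound : ∀ l (π : NullstellensatzProof (PHP (suc (suc l)))) →
                    fromℚ 1/32 ℝ.* (suc (suc l)) ^¾ ℝ.* 2/√e ℝ.^ (suc (suc l)) ℝ.≤ totalCoefficientSize π
  PHP-lower-bound l π = let J , lower , upper = half-sqrt (suc (suc l)) in
    asymptotic-bound l J ((suc (suc l)) ^¾) 2/√e (totalCoefficientSize π) lower (^¾-square (suc (suc l)) J upper) 2/√e-seq (PHP-size l π)

  0<1/32 : 0ℝ ℝ.< fromℚ 1/32
  0<1/32 = mk< (½ * 1/32 , ℚ.positive⁻¹ (½ * 1/32) , 0 , λ _ _ → toWitness {a? = 0ℚ + ½ * 1/32 ℚ.<? 1/32} _)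

open import Defs using (_*_; _≤_; _<_; _^_)

theorem1 : ∃ λ (c : ℝ) → 0ℝ < c × (∀ (n : ℕ) → 2 ℕ.≤ n → (π : NullstellensatzProof (PHP n)) → c * n ^¾ * 2/√e ^ n ≤ totalCoefficientSize π)
theorem1 = fromℚ 1/32 , 0<1/32 , bound
  where
  bound : ∀ (n : ℕ) → 2 ℕ.≤ n → (π : NullstellensatzProof (PHP n)) → fromℚ 1/32 * n ^¾ * 2/√e ^ n ≤ totalCoefficientSize π
  bound (suc (suc l)) _ π = PHP-lower-bound l π
  bound (suc zero)    (ℕ.s≤s ())
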